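{- Let $s,k\ge 0$ be integers and let $G=G(s,k)$ be a path-friendship graph with $s$ triangles and $k$ paths. If $H$ is a graph that is $L$-cospectral with $G$, then $H$ is a path-friendship graph (with $s$ triangles and $k$ paths).
   Context: All graphs are finite and simple. The Laplacian matrix of a graph is $L(G)=D(G)-A(G)$, where $A(G)$ is the adjacency matrix and $D(G)$ the diagonal matrix of vertex degrees. Two graphs are $L$-cospectral if their Laplacian matrices have the same multiset of eigenvalues. The friendship graph $F_s$ consists of $s$ triangles sharing exactly one common vertex (its center). A path-friendship graph $G(s,k)$ is obtained by taking $F_s$ and $k$ paths (each with at least one edge) and identifying the center of $F_s$ with one endpoint of each of the $k$ paths; so it consists of $s$ triangles and $k$ pendant paths all sharing one common vertex. (The notation $G(s,k)$ denotes any such graph; the path lengths are not specified.) -}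

module Defs where

open import Data.Bool using (Bool; true; false; if_then_else_; _∨_; _∧_)
open import Data.Nat as ℕ using (ℕ; zero; suc; _≡ᵇ_; _≤_)
open import Data.Fin using (Fin; toℕ; punchIn; _≟_)
open import Data.Fin as Fin using ()
open import Data.Integer as ℤ using (ℤ; +_; -[1+_])
open import Data.List using (List; []; _∷_; _++_; length)
open import Data.Nat.ListAction using (sum)
open import Data.Bool.ListAction using (any)
open import Data.List.Relation.Unary.All using (All)
open import Data.Product using (_×_; _,_; Σ; ∃)
open import Relation.Nullary.Decidable using (⌊_⌋)
open import Relation.Binary.PropositionalEquality using (_≡_)
open import Function.Bundles using (_↔_; Inverse)

record Graph (n : ℕ) : Set where
  field
    adj    : Fin n → Fin n → Bool
    sym    : ∀ i j → adj i j ≡ adj j i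
    irrefl : ∀ i → adj i i ≡ false
open Graph public

sumFin : ∀ {n} → (Fin n → ℤ) → ℤ
sumFin {zero}  f = + 0
sumFin {suc n} f = f Fin.zero ℤ.+ sumFin (λ i → f (Fin.suc i))

b2ℤ : Bool → ℤ
b2ℤ true  = + 1
b2ℤ false = + 0

degree : ∀ {n} → Graph n → Fin n → ℤ
degree G i = sumFin (λ j → b2ℤ (adj G i j))

laplacian : ∀ {n} → Graph n → Fin n → Fin n → ℤ
laplacian G i j = (if ⌊ i ≟ j ⌋ then degree G i else + 0) ℤ.- b2ℤ (adj G i j)

det : ∀ {n} → (Fin n → Fin n → ℤ) → ℤ
det {zero}  M = + 1
det {suc n} M =
  sumFin (λ j → sign j ℤ.* (M Fin.zero j ℤ.* det (λ a b → M (Fin.suc a) (punchIn j b))))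
  where
  sign : Fin (suc n) → ℤ
  sign j = if ⌊ toℕ j ℕ.% 2 ℕ.≟ 0 ⌋ then + 1 else -[1+ 0 ]

charPolyL : ∀ {n} → Graph n → ℤ → ℤ
charPolyL G x = det (λ i j → (if ⌊ i ≟ j ⌋ then x else + 0) ℤ.- laplacian G i j)

-- L-cospectral: same order and same Laplacian characteristic polynomial
-- (equivalently, the same multiset of Laplacian eigenvalues).
LCospectral : ∀ {n m} → Graph n → Graph m → Set
LCospectral {n} {m} G H = (n ≡ m) × (∀ x → charPolyL G x ≡ charPolyL H x)

-- The model path-friendship graph on vertex labels 0 .. N-1.
-- Vertex 0 is the center; triangle i uses vertices 2i+1, 2i+2;
-- the paths follow, with consecutive fresh vertices.

triEdges : ℕ → List (ℕ × ℕ)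
triEdges zero    = []
triEdges (suc i) = triEdges i ++
  ((0 , 1 ℕ.+ 2 ℕ.* i) ∷ (0 , 2 ℕ.+ 2 ℕ.* i) ∷ (1 ℕ.+ 2 ℕ.* i , 2 ℕ.+ 2 ℕ.* i) ∷ [])

chain : ℕ → ℕ → ℕ → List (ℕ × ℕ)
chain p o zero    = []
chain p o (suc l) = (p , o) ∷ chain o (suc o) l

pathEdges : ℕ → List ℕ → List (ℕ × ℕ)
pathEdges o []       = []
pathEdges o (l ∷ ls) = chain 0 o l ++ pathEdges (o ℕ.+ l) ls

pfEdges : ℕ → List ℕ → List (ℕ × ℕ)
pfEdges s ls = triEdges s ++ pathEdges (1 ℕ.+ 2 ℕ.* s) ls

pfOrder : ℕ → List ℕ → ℕ
pfOrder s ls = 1 ℕ.+ 2 ℕ.* s ℕ.+ sum ls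

edgeIn : List (ℕ × ℕ) → ℕ → ℕ → Bool
edgeIn es a b = any (λ { (x , y) → ((x ≡ᵇ a) ∧ (y ≡ᵇ b)) ∨ ((x ≡ᵇ b) ∧ (y ≡ᵇ a)) }) es

pfAdj : (s : ℕ) (ls : List ℕ) → Fin (pfOrder s ls) → Fin (pfOrder s ls) → Bool
pfAdj s ls i j = edgeIn (pfEdges s ls) (toℕ i) (toℕ j)

IsPathFriendship : ℕ → ℕ → ∀ {n} → Graph n → Set
IsPathFriendship s k {n} G =
  Σ (List ℕ) λ ls → (length ls ≡ k) × All (1 ≤_) ls ×
  Σ (Fin n ↔ Fin (pfOrder s ls)) λ f →
    ∀ i j → adj G i j ≡ pfAdj s ls (Inverse.to f i) (Inverse.to f j)

{-# OPTIONS --safe #-}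
-- Put D = 2s + k. The traces of L, L², L³ show that Σ d, Σ d² and Σ d³ − tr A³ agree for G and H, and the
-- linear coefficient of the characteristic polynomial shows that both have 3ˢ spanning trees; in particular
-- H is connected. Hence Σ (d − 1)(d − 2) = (D − 1)(D − 2) and Σ (d − 1)(d − 2)(D − d) = 6s − tr A³ over the
-- vertices of H.
--
-- If some vertex of H has degree D, all others have degree 1 or 2 and tr A³ = 6s. Starting at that vertex one
-- embeds s triangles and then greedily paths until, by connectivity, every vertex is reached; the embedded
-- path-friendship graph has as many edges as H.
--
-- Otherwise all degrees are below D, so (D − 1)(D − 2) ≤ 6s, which leaves a few small cases. All but two fall
-- to the degree sums (one of them, of order 5, by enumeration). In the remaining two, H is triangle-free and
-- either unicyclic with 3 spanning trees or bicyclic with 9. Projecting an edge onto the cycle space and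
-- multiplying by the number T of spanning trees gives an integral circulation of square norm T · a whose value
-- on the edge is the number a of spanning trees avoiding it. Without triangles it is supported on at least four
-- edges, which forces T ≥ 4 in the unicyclic case; applying this to H minus an edge excludes the bicyclic case.
module Submission where

open import Defs renaming (sym to adj-sym)
open import Data.Bool using (Bool; true; false; if_then_else_; not; _∨_; _∧_)
import Data.Bool.Properties as Boolₚ
open import Data.Nat as ℕ using (ℕ; zero; suc; z≤n; s≤s; _≡ᵇ_)
open import Data.Nat.DivMod using ([m+n]%n≡m%n)
open import Data.Nat.ListAction using () renaming (sum to sumℕ)
import Data.Nat.Properties as ℕₚ
open import Data.Fin using (Fin; zero; suc; toℕ; punchIn; _≟_; inject₁; fromℕ; fromℕ<)
open import Data.Fin.Permutation using (↔⇒≡)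
import Data.Fin.Properties as Finₚ
open import Data.Integer using (ℤ; +_; -[1+_]; _+_; _*_; _-_; -_; _^_; _≤_; _<_; ∣_∣; +≤+; +<+)
import Data.Integer.Properties as ℤₚ
open import Data.Integer.Tactic.RingSolver using (solve-∀)
open import Data.List using (List; []; _∷_; _++_; length)
import Data.List.Properties as Listₚ
open import Data.List.Relation.Unary.All using (All; []; _∷_)
import Data.List.Relation.Unary.All as All
import Data.List.Relation.Unary.All.Properties as Allₚ
open import Data.Vec using (Vec; []; _∷_; lookup)
open import Data.Product using (_×_; _,_; ∃; proj₁; proj₂)
open import Data.Sum using (_⊎_; inj₁; inj₂)
open import Data.Empty using (⊥; ⊥-elim)
open import Relation.Nullary using (¬_; ¬?; Dec; yes; no; _×-dec_)
open import Relation.Nullary.Decidable using (⌊_⌋; decidable-stable)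
open import Relation.Binary using (Tri; tri<; tri≈; tri>)
open import Relation.Binary.PropositionalEquality using (_≡_; _≢_; refl; sym; trans; cong; cong₂; subst; subst₂; module ≡-Reasoning)
open import Function using (_∘_; id)
open import Function.Bundles using (_↔_; mk↔ₛ′; Inverse)

-- Finite sums

-- Eigenvalues never occur: all arithmetic is in ℤ, and the spectrum enters only through the values
-- of det (xI + yM). Coefficients of such forms are compared by divisibility rather than by limits.
-- The degree sums are made for the model. All its vertices but the center have degree 1 or 2, so (d
-- - 1)(d - 2) sees only the center, and the factor D - d removes that as well, leaving the
-- triangles. If all degrees of H are below D, then D - d ≥ 1, so the second sum dominates the
-- first; this is the origin of (D - 1)(D - 2) ≤ 6s. For (s, k) = (1, 2) and (2, 1) this bound is an
-- equality, so the degree sums leave nothing to exploit and the number of spanning trees is needed.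
-- Exhibiting the cycles of H would be awkward; the projection onto the cycle space replaces them.
-- Conservation, the norm identity and Foster's sum of effective resistances say enough about its
-- support. In the bicyclic case the values avoiding an edge have total 36, and each vertex of the
-- support takes at least 8 of it, which leaves room for four vertices only.

sum-cong : ∀ {n} {f g : Fin n → ℤ} → (∀ i → f i ≡ g i) → sumFin f ≡ sumFin g
sum-cong {zero}  e = refl
sum-cong {suc n} e = cong₂ _+_ (e zero) (sum-cong (λ i → e (suc i)))

sum-0 : ∀ n → sumFin {n} (λ _ → + 0) ≡ + 0
sum-0 zero    = refl
sum-0 (suc n) = trans (ℤₚ.+-identityˡ _) (sum-0 n)

sum-zero : ∀ {n} {f : Fin n → ℤ} → (∀ i → f i ≡ + 0) → sumFin f ≡ + 0
sum-zero {n} e = trans (sum-cong e) (sum-0 n)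

+-interchange : ∀ a b c d → (a + b) + (c + d) ≡ (a + c) + (b + d)
+-interchange = solve-∀

sum-+ : ∀ {n} (f g : Fin n → ℤ) → sumFin (λ i → f i + g i) ≡ sumFin f + sumFin g
sum-+ {zero}  f g = refl
sum-+ {suc n} f g = trans (cong (_+_ (f zero + g zero)) (sum-+ (f ∘ suc) (g ∘ suc)))
  (+-interchange (f zero) (g zero) (sumFin (f ∘ suc)) (sumFin (g ∘ suc)))

sum-*ˡ : ∀ {n} c (f : Fin n → ℤ) → sumFin (λ i → c * f i) ≡ c * sumFin f
sum-*ˡ {zero}  c f = sym (ℤₚ.*-zeroʳ c)
sum-*ˡ {suc n} c f = trans (cong (_+_ (c * f zero)) (sum-*ˡ c (f ∘ suc)))
  (sym (ℤₚ.*-distribˡ-+ c (f zero) _))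

sum-*ʳ : ∀ {n} c (f : Fin n → ℤ) → sumFin (λ i → f i * c) ≡ sumFin f * c
sum-*ʳ c f = trans (sum-cong (λ i → ℤₚ.*-comm (f i) c))
  (trans (sum-*ˡ c f) (ℤₚ.*-comm c _))

sum-neg : ∀ {n} (f : Fin n → ℤ) → sumFin (λ i → - f i) ≡ - sumFin f
sum-neg f = trans (sum-cong (λ i → sym (ℤₚ.-1*i≡-i (f i))))
  (trans (sum-*ˡ (- + 1) f) (ℤₚ.-1*i≡-i _))

sum-minus : ∀ {n} (f g : Fin n → ℤ) → sumFin (λ i → f i - g i) ≡ sumFin f - sumFin g
sum-minus f g = trans (sum-+ f (λ i → - g i)) (cong (_+_ (sumFin f)) (sum-neg g))

sum-swap : ∀ {m n} (f : Fin m → Fin n → ℤ) →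
  sumFin (λ i → sumFin (λ j → f i j)) ≡ sumFin (λ j → sumFin (λ i → f i j))
sum-swap {zero} {n} f = sym (sum-0 n)
sum-swap {suc m} f = trans (cong (_+_ (sumFin (f zero))) (sum-swap (f ∘ suc)))
  (sym (sum-+ (f zero) (λ j → sumFin (λ i → f (suc i) j))))

sum-const : ∀ n c → sumFin {n} (λ _ → c) ≡ + n * c
sum-const zero c = sym (ℤₚ.*-zeroˡ c)
sum-const (suc n) c = trans (cong (_+_ c) (sum-const n c)) (lem c (+ n))
  where
  lem : ∀ c m → c + m * c ≡ (+ 1 + m) * c
  lem = solve-∀

-- Defined by recursion rather than through `_≟_`, so that it reduces on constructors; `δ-if` is the
-- bridge to the conditionals of the given definitions.
δ : ∀ {n} → Fin n → Fin n → ℤ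
δ zero    zero    = + 1
δ zero    (suc j) = + 0
δ (suc i) zero    = + 0
δ (suc i) (suc j) = δ i j

δ-refl : ∀ {n} (i : Fin n) → δ i i ≡ + 1
δ-refl zero    = refl
δ-refl (suc i) = δ-refl i

δ-≢ : ∀ {n} {i j : Fin n} → i ≢ j → δ i j ≡ + 0
δ-≢ {i = zero}  {zero}  ne = ⊥-elim (ne refl)
δ-≢ {i = zero}  {suc j} ne = refl
δ-≢ {i = suc i} {zero}  ne = refl
δ-≢ {i = suc i} {suc j} ne = δ-≢ (λ e → ne (cong suc e))

δ-sym : ∀ {n} (i j : Fin n) → δ i j ≡ δ j i
δ-sym zero    zero    = refl
δ-sym zero    (suc j) = refl
δ-sym (suc i) zero    = refl
δ-sym (suc i) (suc j) = δ-sym i j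

δ-if : ∀ {n} (i j : Fin n) x → (if ⌊ i ≟ j ⌋ then x else + 0) ≡ x * δ i j
δ-if i j x with i ≟ j
... | yes refl = sym (trans (cong (x *_) (δ-refl i)) (ℤₚ.*-identityʳ x))
... | no ne    = sym (trans (cong (x *_) (δ-≢ ne)) (ℤₚ.*-zeroʳ x))

δ-subst : ∀ {n} (i j : Fin n) (f : Fin n → ℤ) → δ i j * f i ≡ δ i j * f j
δ-subst i j f with i ≟ j
... | yes refl = refl
... | no ne rewrite δ-≢ ne = trans (ℤₚ.*-zeroˡ (f i)) (sym (ℤₚ.*-zeroˡ (f j)))

sum-δ : ∀ {n} (i : Fin n) (f : Fin n → ℤ) → sumFin (λ j → δ i j * f j) ≡ f i
sum-δ zero f = trans (cong₂ _+_ (ℤₚ.*-identityˡ (f zero)) (sum-zero (λ j → ℤₚ.*-zeroˡ (f (suc j))))) (ℤₚ.+-identityʳ (f zero))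
sum-δ (suc i) f = trans (cong₂ _+_ (ℤₚ.*-zeroˡ (f zero)) (sum-δ i (f ∘ suc))) (ℤₚ.+-identityˡ _)

sum-δʳ : ∀ {n} (i : Fin n) (f : Fin n → ℤ) → sumFin (λ j → f j * δ j i) ≡ f i
sum-δʳ i f = trans (sum-cong (λ j → trans (ℤₚ.*-comm (f j) _) (cong (_* f j) (δ-sym j i)))) (sum-δ i f)

sum-δ1 : ∀ {n} (i : Fin n) → sumFin (δ i) ≡ + 1
sum-δ1 i = trans (sum-cong (λ j → sym (ℤₚ.*-identityʳ (δ i j)))) (sum-δ i (λ _ → + 1))

upd : ∀ {n} {A : Set} → (Fin n → A) → Fin n → A → Fin n → A
upd f zero    a zero    = a
upd f zero    a (suc j) = f (suc j)
upd f (suc i) a zero    = f zero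
upd f (suc i) a (suc j) = upd (f ∘ suc) i a j

upd-same : ∀ {n} {A : Set} (f : Fin n → A) i a → upd f i a i ≡ a
upd-same f zero    a = refl
upd-same f (suc i) a = upd-same (f ∘ suc) i a

upd-other : ∀ {n} {A : Set} (f : Fin n → A) {i j} a → i ≢ j → upd f i a j ≡ f j
upd-other f {zero}  {zero}  a ne = ⊥-elim (ne refl)
upd-other f {zero}  {suc j} a ne = refl
upd-other f {suc i} {zero}  a ne = refl
upd-other f {suc i} {suc j} a ne = upd-other (f ∘ suc) a (λ e → ne (cong suc e))

-- Splitting off a term leaves a sum over the same index type with a zero at `p`. Repeating this at
-- distinct indices yields the bounds `sum≥2` to `sum≥5`.
sum-upd : ∀ {n} (f : Fin n → ℤ) p → sumFin f ≡ f p + sumFin (upd f p (+ 0))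
sum-upd f zero = cong (_+_ (f zero)) (sym (ℤₚ.+-identityˡ _))
sum-upd f (suc p) = trans (cong (_+_ (f zero)) (sum-upd (f ∘ suc) p)) (lem (f zero) (f (suc p)) _)
  where
  lem : ∀ a b c → a + (b + c) ≡ b + (a + c)
  lem = solve-∀

sum-mono : ∀ {n} {f g : Fin n → ℤ} → (∀ i → f i ≤ g i) → sumFin f ≤ sumFin g
sum-mono {zero} h = ℤₚ.≤-refl
sum-mono {suc n} h = ℤₚ.+-mono-≤ (h zero) (sum-mono (h ∘ suc))

sum-nonneg : ∀ {n} {f : Fin n → ℤ} → (∀ i → + 0 ≤ f i) → + 0 ≤ sumFin f
sum-nonneg {n} {f} h = subst (_≤ sumFin f) (sum-0 n) (sum-mono h)

upd-nonneg : ∀ {n} {f : Fin n → ℤ} → (∀ i → + 0 ≤ f i) → ∀ p i → + 0 ≤ upd f p (+ 0) i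
upd-nonneg {f = f} h p i with p ≟ i
... | yes refl = subst (+ 0 ≤_) (sym (upd-same f p (+ 0))) ℤₚ.≤-refl
... | no ne = subst (+ 0 ≤_) (sym (upd-other f (+ 0) ne)) (h i)

sum≥1 : ∀ {n} {f : Fin n → ℤ} → (∀ i → + 0 ≤ f i) → ∀ p → f p ≤ sumFin f
sum≥1 {f = f} h p = subst (f p ≤_) (sym (sum-upd f p))
  (subst (_≤ f p + sumFin (upd f p (+ 0))) (ℤₚ.+-identityʳ (f p))
    (ℤₚ.+-monoʳ-≤ (f p) (sum-nonneg (upd-nonneg h p))))

sum-from : ∀ {n} {f : Fin n → ℤ} → (∀ i → + 0 ≤ f i) → ∀ p {c} → c ≤ sumFin (upd f p (+ 0)) → f p + c ≤ sumFin f
sum-from {f = f} h p le = subst (_ ≤_) (sym (sum-upd f p)) (ℤₚ.+-monoʳ-≤ (f p) le)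

sum≥2 : ∀ {n} {f : Fin n → ℤ} → (∀ i → + 0 ≤ f i) → ∀ {p q} → p ≢ q → f p + f q ≤ sumFin f
sum≥2 {f = f} h {p} {q} pq = sum-from h p
  (subst (_≤ sumFin (upd f p (+ 0))) (upd-other f _ pq) (sum≥1 (upd-nonneg h p) q))

sum≥3 : ∀ {n} {f : Fin n → ℤ} → (∀ i → + 0 ≤ f i) → ∀ {p q r} → p ≢ q → p ≢ r → q ≢ r → f p + (f q + f r) ≤ sumFin f
sum≥3 {f = f} h {p} {q} {r} pq pr qr = sum-from h p
  (subst (_≤ sumFin (upd f p (+ 0))) (cong₂ _+_ (upd-other f _ pq) (upd-other f _ pr)) (sum≥2 (upd-nonneg h p) qr))

sum≥4 : ∀ {n} {f : Fin n → ℤ} → (∀ i → + 0 ≤ f i) → ∀ {p q r s} → p ≢ q → p ≢ r → p ≢ s → q ≢ r → q ≢ s → r ≢ s →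
  f p + (f q + (f r + f s)) ≤ sumFin f
sum≥4 {f = f} h {p} {q} {r} {s} pq pr ps qr qs rs = sum-from h p
  (subst (_≤ sumFin (upd f p (+ 0))) (cong₂ _+_ (upd-other f _ pq) (cong₂ _+_ (upd-other f _ pr) (upd-other f _ ps)))
    (sum≥3 (upd-nonneg h p) qr qs rs))

sum≥5 : ∀ {n} {f : Fin n → ℤ} → (∀ i → + 0 ≤ f i) → ∀ {p q r s t} → p ≢ q → p ≢ r → p ≢ s → p ≢ t →
  q ≢ r → q ≢ s → q ≢ t → r ≢ s → r ≢ t → s ≢ t →
  f p + (f q + (f r + (f s + f t))) ≤ sumFin f
sum≥5 {f = f} h {p} pq pr ps pt qr qs qt rs rt st = sum-from h p
  (subst (_≤ sumFin (upd f p (+ 0)))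
    (cong₂ _+_ (upd-other f _ pq) (cong₂ _+_ (upd-other f _ pr) (cong₂ _+_ (upd-other f _ ps) (upd-other f _ pt))))
    (sum≥4 (upd-nonneg h p) qr qs qt rs rt st))

sum-nonneg-zero : ∀ {n} {f : Fin n → ℤ} → (∀ i → + 0 ≤ f i) → sumFin f ≡ + 0 → ∀ i → f i ≡ + 0
sum-nonneg-zero h e i = ℤₚ.≤-antisym (subst (_ ≤_) e (sum≥1 h i)) (h i)

sum-eq-pointwise : ∀ {n} {f g : Fin n → ℤ} → (∀ i → f i ≤ g i) → sumFin f ≡ sumFin g → ∀ i → f i ≡ g i
sum-eq-pointwise {f = f} {g} h e i = sym (ℤₚ.i-j≡0⇒i≡j (g i) (f i)
  (sum-nonneg-zero {f = λ i → g i - f i} (λ i → ℤₚ.i≤j⇒0≤j-i (h i))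
    (trans (sum-minus g f) (ℤₚ.i≡j⇒i-j≡0 (sym e))) i))

sum-nonzero : ∀ {n} (f : Fin n → ℤ) → sumFin f ≢ + 0 → ∃ λ i → f i ≢ + 0
sum-nonzero f ne with Finₚ.any? (λ i → ¬? (f i ℤₚ.≟ + 0))
... | yes p = p
... | no np = ⊥-elim (ne (sum-zero (λ i → lem i (f i ℤₚ.≟ + 0))))
  where
  lem : ∀ i → Dec (f i ≡ + 0) → f i ≡ + 0
  lem i (yes e) = e
  lem i (no q) = ⊥-elim (np (i , q))

*-nonzero : ∀ {x k} → x ≢ + 0 → x * k ≡ + 0 → k ≡ + 0
*-nonzero {x} {k} nz e = go (ℤₚ.i*j≡0⇒i≡0∨j≡0 x e)
  where
  go : x ≡ + 0 ⊎ k ≡ + 0 → k ≡ + 0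
  go (inj₁ q) = ⊥-elim (nz q)
  go (inj₂ q) = q

+-cancelʳ : ∀ a b c → a + c ≡ b + c → a ≡ b
+-cancelʳ a b c e = trans (lem a c) (trans (cong (_- c) e) (sym (lem b c)))
  where
  lem : ∀ a c → a ≡ a + c - c
  lem = solve-∀

-- Alternating multilinear functions and the determinant

sgn : ∀ {n} → Fin n → ℤ
sgn zero    = + 1
sgn (suc j) = - sgn j

sgnℕ : ℕ → ℤ
sgnℕ zero    = + 1
sgnℕ (suc m) = - sgnℕ m

sgnℕ-toℕ : ∀ {n} (j : Fin n) → sgnℕ (toℕ j) ≡ sgn j
sgnℕ-toℕ zero    = refl
sgnℕ-toℕ (suc j) = cong -_ (sgnℕ-toℕ j)

-- Induction in steps of two: the given sign depends on the residue mod 2, whereas `sgnℕ` alternates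
-- by recursion.
sign-parity : ∀ m → (if ⌊ m ℕ.% 2 ℕ.≟ 0 ⌋ then + 1 else -[1+ 0 ]) ≡ sgnℕ m
sign-parity zero          = refl
sign-parity (suc zero)    = refl
sign-parity (suc (suc m)) = trans
  (cong (λ r → if ⌊ r ℕ.≟ 0 ⌋ then + 1 else -[1+ 0 ])
    (trans (cong (ℕ._% 2) (ℕₚ.+-comm 2 m)) ([m+n]%n≡m%n m 2)))
  (trans (sign-parity m) (sym (ℤₚ.neg-involutive _)))

Row : ℕ → Set
Row n = Fin n → ℤ

det-expand : ∀ {n} (M : Fin (suc n) → Row (suc n)) →
  det M ≡ sumFin (λ j → sgn j * (M zero j * det (λ a b → M (suc a) (punchIn j b))))
det-expand M = sum-cong (λ j → cong (_* (M zero j * det (λ a b → M (suc a) (punchIn j b))))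
  (trans (sign-parity (toℕ j)) (sgnℕ-toℕ j)))

det-cong : ∀ {n} {A B : Fin n → Row n} → (∀ i j → A i j ≡ B i j) → det A ≡ det B
det-cong {zero}  e = refl
det-cong {suc n} {A} {B} e = trans (det-expand A) (trans
  (sum-cong (λ j → cong (sgn j *_) (cong₂ _*_ (e zero j) (det-cong (λ a b → e (suc a) (punchIn j b))))))
  (sym (det-expand B)))

infixr 5 _▹_
_▹_ : ∀ {n} {A : Set} → A → (Fin n → A) → Fin (suc n) → A
(u ▹ R) zero    = u
(u ▹ R) (suc i) = R i

upd-map : ∀ {n} {A B : Set} (g : A → B) (f : Fin n → A) i x j → g (upd f i x j) ≡ upd (g ∘ f) i (g x) j
upd-map g f zero    x zero    = refl
upd-map g f zero    x (suc j) = refl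
upd-map g f (suc i) x zero    = refl
upd-map g f (suc i) x (suc j) = upd-map g (f ∘ suc) i x j

upd-comm : ∀ {n} {A : Set} (f : Fin n → A) {p q} x y → p ≢ q → ∀ i → upd (upd f p x) q y i ≡ upd (upd f q y) p x i
upd-comm f {zero}  {zero}  x y ne i = ⊥-elim (ne refl)
upd-comm f {zero}  {suc q} x y ne zero = refl
upd-comm f {zero}  {suc q} x y ne (suc i) = refl
upd-comm f {suc p} {zero}  x y ne zero = refl
upd-comm f {suc p} {zero}  x y ne (suc i) = refl
upd-comm f {suc p} {suc q} x y ne zero = refl
upd-comm f {suc p} {suc q} x y ne (suc i) = upd-comm (f ∘ suc) x y (λ e → ne (cong suc e)) i

upd-id : ∀ {n} {A : Set} (f : Fin n → A) p i → upd f p (f p) i ≡ f i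
upd-id f zero    zero    = refl
upd-id f zero    (suc i) = refl
upd-id f (suc p) zero    = refl
upd-id f (suc p) (suc i) = upd-id (f ∘ suc) p i

-- Stated for `k` rows of length `m` rather than for square matrices, so that freezing the top row
-- or embedding the rows into a longer space stays within the class. `respects` stands in for
-- function extensionality.
record Multilinear {k m} (F : (Fin k → Row m) → ℤ) : Set where
  field
    respects : ∀ {A B} → (∀ i c → A i c ≡ B i c) → F A ≡ F B
    linear   : ∀ R i s u w → F (upd R i (λ c → s * u c + w c)) ≡ s * F (upd R i u) + F (upd R i w)
open Multilinear

record Alternating {k m} (F : (Fin k → Row m) → ℤ) : Set where
  field
    multilinear : Multilinear F
    alternates  : ∀ R {i j} → i ≢ j → (∀ c → R i c ≡ R j c) → F R ≡ + 0
open Alternating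

upd-▹ : ∀ {n} {A : Set} (u : A) (R : Fin n → A) i x j → upd (u ▹ R) (suc i) x j ≡ (u ▹ upd R i x) j
upd-▹ u R i x zero    = refl
upd-▹ u R i x (suc j) = refl

upd₀-▹ : ∀ {n} {A : Set} (u : A) (R : Fin n → A) x j → upd (u ▹ R) zero x j ≡ (x ▹ R) j
upd₀-▹ u R x zero    = refl
upd₀-▹ u R x (suc j) = refl

▹-tail : ∀ {n m} (M : Fin (suc n) → Row m) i c → M i c ≡ (M zero ▹ (M ∘ suc)) i c
▹-tail M zero    c = refl
▹-tail M (suc i) c = refl

▹-rows : ∀ {n m} {u u′ : Row m} {R R′ : Fin n → Row m} → (∀ c → u c ≡ u′ c) → (∀ i c → R i c ≡ R′ i c) →
  ∀ i c → (u ▹ R) i c ≡ (u′ ▹ R′) i c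
▹-rows e e′ zero    c = e c
▹-rows e e′ (suc i) c = e′ i c

app : ∀ {n m} {A B : Fin n → Row m} → (∀ i → A i ≡ B i) → ∀ i c → A i c ≡ B i c
app e i c = cong (λ r → r c) (e i)

module _ {k m} {F : (Fin (suc k) → Row m) → ℤ} (ml : Multilinear F) where

  linear-head : ∀ s u w R → F ((λ c → s * u c + w c) ▹ R) ≡ s * F (u ▹ R) + F (w ▹ R)
  linear-head s u w R = trans (respects ml (app (λ i → sym (upd₀-▹ u R _ i))))
    (trans (linear ml (u ▹ R) zero s u w)
      (cong₂ (λ x y → s * x + y) (respects ml (app (upd₀-▹ u R u))) (respects ml (app (upd₀-▹ u R w)))))

  zero-head : ∀ R → F ((λ _ → + 0) ▹ R) ≡ + 0
  zero-head R = trans (respects ml (▹-rows (λ _ → refl) (λ _ _ → refl)))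
    (trans (linear-head (- + 1) (λ _ → + 0) (λ _ → + 0) R) (lem (F ((λ _ → + 0) ▹ R))))
    where
    lem : ∀ x → - + 1 * x + x ≡ + 0
    lem = solve-∀

  sum-head : ∀ {l} (t : Fin l → ℤ) (w : Fin l → Row m) R →
    F ((λ c → sumFin (λ j → t j * w j c)) ▹ R) ≡ sumFin (λ j → t j * F (w j ▹ R))
  sum-head {zero}  t w R = zero-head R
  sum-head {suc l} t w R = trans (linear-head (t zero) (w zero) _ R)
    (cong (_+_ (t zero * F (w zero ▹ R))) (sum-head (t ∘ suc) (w ∘ suc) R))

  Multilinear-▹ : ∀ u → Multilinear (λ R → F (u ▹ R))
  Multilinear-▹ u = record
    { respects = λ e → respects ml (▹-rows (λ _ → refl) e)
    ; linear = λ R i s v w → trans (respects ml (app (λ j → sym (upd-▹ u R i _ j))))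
        (trans (linear ml (u ▹ R) (suc i) s v w)
          (cong₂ (λ x y → s * x + y) (respects ml (app (upd-▹ u R i v))) (respects ml (app (upd-▹ u R i w)))))
    }

-- When all rows are expanded, every term with `w` in two rows vanishes, so only those with `w` in
-- at most one row survive. For `det` this is the matrix determinant lemma.
rank-one : ∀ {k m} {F : (Fin k → Row m) → ℤ} → Multilinear F → (w : Row m) →
  (∀ R {i j} → i ≢ j → (∀ c → R i c ≡ w c) → (∀ c → R j c ≡ w c) → F R ≡ + 0) →
  ∀ R (t : Fin k → ℤ) → F (λ i c → t i * w c + R i c) ≡ F R + sumFin (λ i → t i * F (upd R i w))
rank-one {zero} {F = F} ml w van R t = trans (respects ml (λ ())) (sym (ℤₚ.+-identityʳ (F R)))
rank-one {suc k} {F = F} ml w van R t = begin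
  F (λ i c → t i * w c + R i c)
    ≡⟨ respects ml (▹-tail _) ⟩
  F ((λ c → t zero * w c + R zero c) ▹ R′)
    ≡⟨ linear-head ml (t zero) w (R zero) R′ ⟩
  t zero * F (w ▹ R′) + F (R zero ▹ R′)
    ≡⟨ cong₂ (λ x y → t zero * x + y) step₁ step₂ ⟩
  t zero * F (w ▹ (R ∘ suc)) + (F (R zero ▹ (R ∘ suc)) + sumFin (λ i → t (suc i) * F (R zero ▹ upd (R ∘ suc) i w)))
    ≡⟨ cong₂ (λ x y → t zero * x + y) (respects ml (λ { zero c → refl ; (suc i) c → refl }))
         (cong₂ _+_ (respects ml (λ i c → sym (▹-tail R i c)))
           (sum-cong (λ i → cong (t (suc i) *_) (respects ml (λ { zero c → refl ; (suc i) c → refl }))))) ⟩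
  t zero * F (upd R zero w) + (F R + sumFin (λ i → t (suc i) * F (upd R (suc i) w)))
    ≡⟨ lem (t zero * F (upd R zero w)) (F R) _ ⟩
  F R + sumFin (λ i → t i * F (upd R i w)) ∎
  where
  open ≡-Reasoning
  R′ : Fin k → Row _
  R′ i c = t (suc i) * w c + R (suc i) c
  lem : ∀ a b c → a + (b + c) ≡ b + (a + c)
  lem = solve-∀
  step₁ : F (w ▹ R′) ≡ F (w ▹ (R ∘ suc))
  step₁ = trans (rank-one (Multilinear-▹ ml w) w
      (λ S ne e e′ → van (w ▹ S) (λ q → ne (Finₚ.suc-injective q)) e e′) (R ∘ suc) (t ∘ suc))
    (trans (cong (_+_ (F (w ▹ (R ∘ suc)))) (sum-zero (λ i → trans
        (cong (t (suc i) *_) (van (w ▹ upd (R ∘ suc) i w) {zero} {suc i} (λ ()) (λ _ → refl)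
          (λ c → cong (λ r → r c) (upd-same (R ∘ suc) i w))))
        (ℤₚ.*-zeroʳ (t (suc i))))))
      (ℤₚ.+-identityʳ (F (w ▹ (R ∘ suc)))))
  step₂ : F (R zero ▹ R′) ≡ F (R zero ▹ (R ∘ suc)) + sumFin (λ i → t (suc i) * F (R zero ▹ upd (R ∘ suc) i w))
  step₂ = rank-one (Multilinear-▹ ml (R zero)) w
      (λ S ne e e′ → van (R zero ▹ S) (λ q → ne (Finₚ.suc-injective q)) e e′) (R ∘ suc) (t ∘ suc)

-- Expand the vanishing value with u + w in both rows. Vanishing is asked only for the rows `p` and
-- `q`, so the lemma applies while the alternation of `det` is still being proved.
swap-rows : ∀ {k m} {F : (Fin k → Row m) → ℤ} → Multilinear F → ∀ {p q} → p ≢ q →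
  (∀ R → (∀ c → R p c ≡ R q c) → F R ≡ + 0) →
  ∀ R u w → F (upd (upd R p u) q w) ≡ - F (upd (upd R p w) q u)
swap-rows {F = F} ml {p} {q} ne van R u w = lem (P u w) (P w u) (begin
  + 0
    ≡⟨ sym (P-diag v) ⟩
  P v v
    ≡⟨ linear ml (upd R p v) q (+ 1) u w ⟩
  + 1 * P v u + P v w
    ≡⟨ cong₂ (λ x y → + 1 * x + y) (P-left u) (P-left w) ⟩
  + 1 * (+ 1 * P u u + P w u) + (+ 1 * P u w + P w w)
    ≡⟨ cong₂ (λ x y → + 1 * (+ 1 * x + P w u) + (+ 1 * P u w + y)) (P-diag u) (P-diag w) ⟩
  + 1 * (+ 1 * + 0 + P w u) + (+ 1 * P u w + + 0) ∎)
  where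
  open ≡-Reasoning
  P : Row _ → Row _ → ℤ
  P x y = F (upd (upd R p x) q y)
  v : Row _
  v c = + 1 * u c + w c
  P-diag : ∀ x → P x x ≡ + 0
  P-diag x = van _ (λ c → cong (λ r → r c)
    (trans (trans (upd-other (upd R p x) x (λ e → ne (sym e))) (upd-same R p x)) (sym (upd-same (upd R p x) q x))))
  P-comm : ∀ x y → P x y ≡ F (upd (upd R q y) p x)
  P-comm x y = respects ml (app (upd-comm R x y ne))
  P-left : ∀ y → P v y ≡ + 1 * P u y + P w y
  P-left y = trans (P-comm v y) (trans (linear ml (upd R q y) p (+ 1) u w)
    (cong₂ (λ a b → + 1 * a + b) (sym (P-comm u y)) (sym (P-comm w y))))
  lem : ∀ a b → + 0 ≡ + 1 * (+ 1 * + 0 + b) + (+ 1 * a + + 0) → a ≡ - b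
  lem a b e = trans (lem₁ a b) (trans (cong (_- b) (sym e)) (ℤₚ.+-identityˡ (- b)))
    where
    lem₁ : ∀ a b → a ≡ + 1 * (+ 1 * + 0 + b) + (+ 1 * a + + 0) - b
    lem₁ = solve-∀

det-multilinear : ∀ {n} → Multilinear (det {n})
det-multilinear {zero} = record { respects = λ _ → refl ; linear = λ R () }
det-multilinear {suc n} = record { respects = det-cong ; linear = lin }
  where
  open ≡-Reasoning
  minor : Row (suc n) → (Fin n → Row (suc n)) → Fin (suc n) → ℤ
  minor u R j = sgn j * (u j * det (λ a b → R a (punchIn j b)))
  collect : ∀ s f g h → (∀ j → h j ≡ s * f j + g j) → sumFin {suc n} h ≡ s * sumFin f + sumFin g
  collect s f g h e = trans (sum-cong e) (trans (sum-+ (λ j → s * f j) g) (cong (_+ sumFin g) (sum-*ˡ s f)))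
  lin : ∀ R i s u w → det (upd R i (λ c → s * u c + w c)) ≡ s * det (upd R i u) + det (upd R i w)
  lin R zero s u w = trans (det-expand (upd R zero (λ c → s * u c + w c)))
    (trans (collect s (minor u (R ∘ suc)) (minor w (R ∘ suc)) (minor (λ c → s * u c + w c) (R ∘ suc))
        (λ j → lem s (u j) (w j) (sgn j) (det (λ a b → R (suc a) (punchIn j b)))))
      (sym (cong₂ (λ x y → s * x + y) (det-expand (upd R zero u)) (det-expand (upd R zero w)))))
    where
    lem : ∀ s u w g d → g * ((s * u + w) * d) ≡ s * (g * (u * d)) + g * (w * d)
    lem = solve-∀
  lin R (suc i) s u w = trans (det-expand (upd R (suc i) (λ c → s * u c + w c)))
    (trans (collect s (m u) (m w) (m (λ c → s * u c + w c)) step)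
      (sym (cong₂ (λ x y → s * x + y) (det-expand (upd R (suc i) u)) (det-expand (upd R (suc i) w)))))
    where
    m : Row (suc n) → Fin (suc n) → ℤ
    m x j = minor (R zero) (upd (R ∘ suc) i x) j
    inner : ∀ x j → det (λ a b → upd (R ∘ suc) i x a (punchIn j b)) ≡
      det (upd (λ a b → R (suc a) (punchIn j b)) i (λ b → x (punchIn j b)))
    inner x j = det-cong (app (upd-map (λ r b → r (punchIn j b)) (R ∘ suc) i x))
    lem : ∀ s r g x y → g * (r * (s * x + y)) ≡ s * (g * (r * x)) + g * (r * y)
    lem = solve-∀
    step : ∀ j → m (λ c → s * u c + w c) j ≡ s * m u j + m w j
    step j = trans (cong (λ d → sgn j * (R zero j * d))
        (trans (inner (λ c → s * u c + w c) j)
          (trans (linear det-multilinear (λ a b → R (suc a) (punchIn j b)) i s (λ b → u (punchIn j b)) (λ b → w (punchIn j b)))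
            (sym (cong₂ (λ x y → s * x + y) (inner u j) (inner w j))))))
      (lem s (R zero j) (sgn j) _ _)

-- The double expansion pairs the column choices (j, k) and (k, j) with opposite signs.
double-expansion-cancels : ∀ n (Φ : Fin (2 ℕ.+ n) → Fin (2 ℕ.+ n) → (Fin n → Fin (2 ℕ.+ n)) → ℤ) →
  (∀ a b g → Φ a b g ≡ Φ b a g) → (∀ a b {g g′} → (∀ c → g c ≡ g′ c) → Φ a b g ≡ Φ a b g′) →
  sumFin (λ j → sgn j * sumFin (λ k → sgn k * Φ j (punchIn j k) (λ c → punchIn j (punchIn k c)))) ≡ + 0
double-expansion-cancels n Φ symm ext = begin
  + 1 * X + sumFin (λ j → - sgn j * (+ 1 * A j + B j))
    ≡⟨ cong (_+_ (+ 1 * X)) (trans (sum-cong (λ j → lem (sgn j) (A j) (B j)))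
         (trans (sum-+ (λ j → - (sgn j * A j)) (λ j → - sgn j * B j))
           (cong₂ _+_ (sum-neg (λ j → sgn j * A j)) (rest n Φ symm ext)))) ⟩
  + 1 * X + (- sumFin (λ j → sgn j * A j) + + 0)
    ≡⟨ cong (λ x → + 1 * X + (- x + + 0)) (sum-cong (λ j → cong (sgn j *_) (symm (suc j) zero (λ c → suc (punchIn j c))))) ⟩
  + 1 * X + (- X + + 0)
    ≡⟨ lem₂ X ⟩
  + 0 ∎
  where
  open ≡-Reasoning
  X : ℤ
  X = sumFin (λ k → sgn k * Φ zero (suc k) (λ c → suc (punchIn k c)))
  A : Fin (suc n) → ℤ
  A j = Φ (suc j) zero (λ c → suc (punchIn j c))
  B : Fin (suc n) → ℤ
  B j = sumFin (λ k → sgn (suc k) * Φ (suc j) (suc (punchIn j k)) (λ c → punchIn (suc j) (punchIn (suc k) c)))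
  lem : ∀ s a b → - s * (+ 1 * a + b) ≡ - (s * a) + - s * b
  lem = solve-∀
  lem₂ : ∀ x → + 1 * x + (- x + + 0) ≡ + 0
  lem₂ = solve-∀
  rest : ∀ n (Φ : Fin (2 ℕ.+ n) → Fin (2 ℕ.+ n) → (Fin n → Fin (2 ℕ.+ n)) → ℤ) →
    (∀ a b g → Φ a b g ≡ Φ b a g) → (∀ a b {g g′} → (∀ c → g c ≡ g′ c) → Φ a b g ≡ Φ a b g′) →
    sumFin (λ j → - sgn j * sumFin (λ k → - sgn k * Φ (suc j) (suc (punchIn j k)) (λ c → punchIn (suc j) (punchIn (suc k) c)))) ≡ + 0
  rest zero Φ symm ext = sum-zero {1} (λ j → ℤₚ.*-zeroʳ (- sgn j))
  rest (suc n) Φ symm ext = trans (sum-cong step)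
    (double-expansion-cancels n Φ′ (λ a b g → symm (suc a) (suc b) _)
      (λ a b e → ext (suc a) (suc b) (λ { zero → refl ; (suc c) → cong suc (e c) })))
    where
    lift : (Fin n → Fin (2 ℕ.+ n)) → Fin (suc n) → Fin (3 ℕ.+ n)
    lift g zero    = zero
    lift g (suc c) = suc (g c)
    Φ′ : Fin (2 ℕ.+ n) → Fin (2 ℕ.+ n) → (Fin n → Fin (2 ℕ.+ n)) → ℤ
    Φ′ a b g = Φ (suc a) (suc b) (lift g)
    lem₃ : ∀ s x → - s * - x ≡ s * x
    lem₃ = solve-∀
    step : ∀ j → - sgn j * sumFin (λ k → - sgn k * Φ (suc j) (suc (punchIn j k)) (λ c → punchIn (suc j) (punchIn (suc k) c)))
      ≡ sgn j * sumFin (λ k → sgn k * Φ′ j (punchIn j k) (λ c → punchIn j (punchIn k c)))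
    old new : Fin (2 ℕ.+ n) → Fin (suc n) → ℤ
    old j k = Φ (suc j) (suc (punchIn j k)) (λ c → punchIn (suc j) (punchIn (suc k) c))
    new j k = Φ′ j (punchIn j k) (λ c → punchIn j (punchIn k c))
    old≡new : ∀ j k → old j k ≡ new j k
    old≡new j k = ext (suc j) (suc (punchIn j k)) (λ { zero → refl ; (suc c) → refl })
    step j = trans (cong (- sgn j *_) (trans
        (sum-cong (λ k → trans (sym (ℤₚ.neg-distribˡ-* (sgn k) (old j k))) (cong (λ x → - (sgn k * x)) (old≡new j k))))
        (sum-neg (λ k → sgn k * new j k))))
      (lem₃ (sgn j) (sumFin (λ k → sgn k * new j k)))

Alternates : ℕ → Set
Alternates n = ∀ (R : Fin n → Row n) {i j} → i ≢ j → (∀ c → R i c ≡ R j c) → det R ≡ + 0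

private
  upd-cong : ∀ {n} {A : Set} {f g : Fin n → A} → (∀ i → f i ≡ g i) → ∀ p x i → upd f p x i ≡ upd g p x i
  upd-cong h zero    x zero    = refl
  upd-cong h zero    x (suc i) = h (suc i)
  upd-cong h (suc p) x zero    = h zero
  upd-cong h (suc p) x (suc i) = upd-cong (h ∘ suc) p x i

  alternates-tail : ∀ {n} → Alternates n → ∀ (R : Fin (suc n) → Row (suc n)) {i j} → i ≢ j →
    (∀ c → R (suc i) c ≡ R (suc j) c) → det R ≡ + 0
  alternates-tail IH R ne e = trans (det-expand R)
    (sum-zero (λ c → trans
      (cong (λ x → sgn c * (R zero c * x)) (IH (λ a b → R (suc a) (punchIn c b)) ne (λ b → e (punchIn c b))))
      (lem (sgn c) (R zero c))))
    where
    lem : ∀ s r → s * (r * + 0) ≡ + 0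
    lem = solve-∀

  alternates-01 : ∀ {n} (R : Fin (2 ℕ.+ n) → Row (2 ℕ.+ n)) → (∀ c → R zero c ≡ R (suc zero) c) → det R ≡ + 0
  alternates-01 {n} R e = trans (det-expand R) (trans
      (sum-cong (λ j → cong (sgn j *_) (trans
        (cong (R zero j *_) (det-expand (λ a b → R (suc a) (punchIn j b))))
        (trans (sym (sum-*ˡ (R zero j) (λ k → sgn k * (R (suc zero) (punchIn j k) * minor j k))))
          (sum-cong (λ k → lem (R zero j) (sgn k) (R (suc zero) (punchIn j k)) (minor j k)))))))
      (double-expansion-cancels n Φ
        (λ a b g → cong (_* det (λ x y → R (suc (suc x)) (g y))) (trans (cong (R zero a *_) (sym (e b)))
          (trans (ℤₚ.*-comm (R zero a) (R zero b)) (cong (R zero b *_) (e a)))))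
        (λ a b eq → cong (R zero a * R (suc zero) b *_) (det-cong (λ x y → cong (R (suc (suc x))) (eq y))))))
    where
    minor : Fin (2 ℕ.+ n) → Fin (suc n) → ℤ
    minor j k = det (λ a b → R (suc (suc a)) (punchIn j (punchIn k b)))
    Φ : Fin (2 ℕ.+ n) → Fin (2 ℕ.+ n) → (Fin n → Fin (2 ℕ.+ n)) → ℤ
    Φ a b g = R zero a * R (suc zero) b * det (λ x y → R (suc (suc x)) (g y))
    lem : ∀ r s t d → r * (s * (t * d)) ≡ s * (r * t * d)
    lem = solve-∀

  -- If the row equal to row 0 lies beyond row 1, exchanging it with row 1 reduces to equal rows 0
  -- and 1. That exchange takes place below row 0, where alternation is already known from the
  -- minors.
  alternates-head : ∀ {n} → Alternates n → ∀ (R : Fin (suc n) → Row (suc n)) j →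
    (∀ c → R zero c ≡ R (suc j) c) → det R ≡ + 0
  alternates-head {suc n} IH R zero e = alternates-01 R e
  alternates-head {suc (suc n)} IH R (suc j) e = begin
    det R
      ≡⟨ det-cong (app (λ i → sym (trans (upd-cong (upd-id R one) q (R q) i) (upd-id R q i)))) ⟩
    det (upd (upd R one (R one)) q (R q))
      ≡⟨ swap-rows det-multilinear {one} {q} (λ ())
           (λ S → alternates-tail IH S {zero} {suc j} (λ ())) R (R one) (R q) ⟩
    - det (upd (upd R one (R q)) q (R one))
      ≡⟨ cong -_ (alternates-01 (upd (upd R one (R q)) q (R one)) e) ⟩
    + 0 ∎
    where
    open ≡-Reasoning
    one : Fin (3 ℕ.+ n)
    one = suc zero
    q : Fin (3 ℕ.+ n)
    q = suc (suc j)

det-alternates : ∀ {n} → Alternates n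
det-alternates {suc n} R {zero}  {zero}  ne e = ⊥-elim (ne refl)
det-alternates {suc n} R {zero}  {suc j} ne e = alternates-head (det-alternates {n}) R j e
det-alternates {suc n} R {suc i} {zero}  ne e = alternates-head (det-alternates {n}) R i (λ c → sym (e c))
det-alternates {suc n} R {suc i} {suc j} ne e = alternates-tail (det-alternates {n}) R (λ q → ne (cong suc q)) e

det-alternating : ∀ {n} → Alternating (det {n})
det-alternating = record { multilinear = det-multilinear ; alternates = det-alternates }

-- Alternating forms are multiples of the determinant: products, relabelling, Cramer's rule

module _ {k m} {F : (Fin (suc (suc k)) → Row m) → ℤ} (al : Alternating F) where

  swap-head : ∀ u w R → F (u ▹ (w ▹ R)) ≡ - F (w ▹ (u ▹ R))
  swap-head u w R = trans (respects ml (app (λ i → sym (eq u w i))))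
    (trans (swap-rows ml {zero} {suc zero} (λ ()) (λ S → alternates al S (λ ())) (u ▹ (w ▹ R)) u w)
      (cong -_ (respects ml (app (eq w u)))))
    where
    ml = multilinear al
    eq : ∀ x y i → upd (upd (u ▹ (w ▹ R)) zero x) (suc zero) y i ≡ (x ▹ (y ▹ R)) i
    eq x y zero = refl
    eq x y (suc zero) = refl
    eq x y (suc (suc i)) = refl

-- Inserts a zero at column `j`, the embedding of rows that goes with the restriction along
-- `punchIn j` in a minor.
ins0 : ∀ {n} → Fin (suc n) → Row n → Row (suc n)
ins0 zero            u zero    = + 0
ins0 zero            u (suc c) = u c
ins0 {suc n} (suc j) u zero    = u zero
ins0 {suc n} (suc j) u (suc c) = ins0 j (u ∘ suc) c

ins0-linear : ∀ {n} j s (u w : Row n) c → ins0 j (λ c → s * u c + w c) c ≡ s * ins0 j u c + ins0 j w c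
ins0-linear zero s u w zero = lem s
  where
  lem : ∀ s → + 0 ≡ s * + 0 + + 0
  lem = solve-∀
ins0-linear zero s u w (suc c) = refl
ins0-linear {suc n} (suc j) s u w zero = refl
ins0-linear {suc n} (suc j) s u w (suc c) = ins0-linear j s (u ∘ suc) (w ∘ suc) c

ins0-cong : ∀ {n} j {u w : Row n} → (∀ c → u c ≡ w c) → ∀ c → ins0 j u c ≡ ins0 j w c
ins0-cong zero e zero = refl
ins0-cong zero e (suc c) = e c
ins0-cong {suc n} (suc j) e zero = e zero
ins0-cong {suc n} (suc j) e (suc c) = ins0-cong j (e ∘ suc) c

ins0-δ : ∀ {n} j (a : Fin n) c → ins0 j (δ a) c ≡ δ (punchIn j a) c
ins0-δ zero a zero = refl
ins0-δ zero a (suc c) = refl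
ins0-δ {suc n} (suc j) zero zero = refl
ins0-δ {suc n} (suc j) (suc a) zero = refl
ins0-δ {suc n} (suc j) zero (suc c) = ins0-0 j c
  where
  ins0-0 : ∀ {n} (j : Fin (suc n)) c → ins0 j (λ _ → + 0) c ≡ + 0
  ins0-0 zero zero = refl
  ins0-0 zero (suc c) = refl
  ins0-0 {suc n} (suc j) zero = refl
  ins0-0 {suc n} (suc j) (suc c) = ins0-0 j c
ins0-δ {suc n} (suc j) (suc a) (suc c) = ins0-δ j a c

ins0-punchIn : ∀ {n} j (u : Row (suc n)) c → u c ≡ u j * δ j c + ins0 j (λ b → u (punchIn j b)) c
ins0-punchIn zero u zero = lem (u zero)
  where
  lem : ∀ a → a ≡ a * + 1 + + 0
  lem = solve-∀
ins0-punchIn zero u (suc c) = lem (u zero) (u (suc c))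
  where
  lem : ∀ a b → b ≡ a * + 0 + b
  lem = solve-∀
ins0-punchIn {suc n} (suc j) u zero = lem (u (suc j)) (u zero)
  where
  lem : ∀ a b → b ≡ a * + 0 + b
  lem = solve-∀
ins0-punchIn {suc n} (suc j) u (suc c) = ins0-punchIn j (u ∘ suc) c

Alternating-map : ∀ {k m m′} {F : (Fin k → Row m′) → ℤ} → Alternating F → (L : Row m → Row m′) →
  (∀ {u w} → (∀ c → u c ≡ w c) → ∀ c → L u c ≡ L w c) →
  (∀ s u w c → L (λ c → s * u c + w c) c ≡ s * L u c + L w c) →
  Alternating (λ R → F (λ i → L (R i)))
Alternating-map {F = F} al L L-cong L-lin = record
  { multilinear = record
    { respects = λ e → respects ml (λ i → L-cong (e i))
    ; linear = λ R i s u w → trans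
        (respects ml (λ j c → trans (cong (λ r → r c) (upd-map L R i (λ c → s * u c + w c) j))
          (lift-lin R i s u w j c)))
        (trans (linear ml (L ∘ R) i s (L u) (L w))
          (sym (cong₂ (λ x y → s * x + y) (respects ml (app (upd-map L R i u))) (respects ml (app (upd-map L R i w))))))
    }
  ; alternates = λ R ne e → alternates al (L ∘ R) ne (L-cong e)
  }
  where
  ml = multilinear al
  lift-lin : ∀ R i s u w j c → upd (L ∘ R) i (L (λ c → s * u c + w c)) j c ≡ upd (L ∘ R) i (λ c → s * L u c + L w c) j c
  lift-lin R i s u w j c with i ≟ j
  ... | yes refl = trans (cong (λ r → r c) (upd-same (L ∘ R) i _)) (trans (L-lin s u w c) (sym (cong (λ r → r c) (upd-same (L ∘ R) i _))))
  ... | no ne = trans (cong (λ r → r c) (upd-other (L ∘ R) _ ne)) (sym (cong (λ r → r c) (upd-other (L ∘ R) _ ne)))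

Alternating-▹ : ∀ {k m} {F : (Fin (suc k) → Row m) → ℤ} → Alternating F → ∀ u → Alternating (λ R → F (u ▹ R))
Alternating-▹ al u = record
  { multilinear = Multilinear-▹ (multilinear al) u
  ; alternates = λ R ne e → alternates al (u ▹ R) (λ q → ne (Finₚ.suc-injective q)) e
  }

-- The rows are those of the identity with row `j` moved to the top, a cycle of sign (-1)^j. One
-- swap brings `δ zero` to the top; with that row frozen, the same situation remains one dimension
-- lower.
cycle-sign : ∀ {n} {F : (Fin (suc n) → Row (suc n)) → ℤ} → Alternating F → ∀ j →
  F (δ j ▹ (λ a → δ (punchIn j a))) ≡ sgn j * F δ
cycle-sign {F = F} al zero = trans (respects (multilinear al) (λ i c → sym (▹-tail δ i c))) (sym (ℤₚ.*-identityˡ (F δ)))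
cycle-sign {suc n} {F} al (suc j) = begin
  F (δ (suc j) ▹ (λ a → δ (punchIn (suc j) a)))
    ≡⟨ respects ml (▹-rows (λ _ → refl) (λ { zero c → refl ; (suc a) c → refl })) ⟩
  F (δ (suc j) ▹ (δ zero ▹ (λ a → δ (suc (punchIn j a)))))
    ≡⟨ swap-head al (δ (suc j)) (δ zero) _ ⟩
  - F (δ zero ▹ (δ (suc j) ▹ (λ a → δ (suc (punchIn j a)))))
    ≡⟨ cong -_ (respects ml (▹-rows (λ _ → refl) (λ { zero c → shift j c ; (suc a) c → shift (punchIn j a) c }))) ⟩
  - G (δ j ▹ (λ a → δ (punchIn j a)))
    ≡⟨ cong -_ (cycle-sign G-alt j) ⟩
  - (sgn j * G δ)
    ≡⟨ cong (λ x → - (sgn j * x)) (respects ml (λ { zero c → refl ; (suc a) c → sym (shift a c) })) ⟩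
  - (sgn j * F δ)
    ≡⟨ ℤₚ.neg-distribˡ-* (sgn j) (F δ) ⟩
  - sgn j * F δ ∎
  where
  open ≡-Reasoning
  ml = multilinear al
  shift : ∀ {n} (a : Fin n) c → δ (suc a) c ≡ ins0 zero (δ a) c
  shift a zero = refl
  shift a (suc c) = refl
  G : (Fin (suc n) → Row (suc n)) → ℤ
  G R = F (δ zero ▹ (λ a → ins0 zero (R a)))
  G-alt : Alternating G
  G-alt = Alternating-map (Alternating-▹ al (δ zero)) (ins0 zero) (ins0-cong zero) (ins0-linear zero)

-- Expanding the first row reduces to rows δ j, and column j can then be cleared from the other rows.
alternating-unique : ∀ {n} {F : (Fin n → Row n) → ℤ} → Alternating F → ∀ M → F M ≡ F δ * det M
alternating-unique {zero} {F} al M = trans (respects (multilinear al) (λ ())) (sym (ℤₚ.*-identityʳ (F δ)))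
alternating-unique {suc n} {F} al M = begin
  F M
    ≡⟨ respects ml (λ { zero c → sym (sum-δʳ c (M zero)) ; (suc i) c → refl }) ⟩
  F ((λ c → sumFin (λ j → M zero j * δ j c)) ▹ (M ∘ suc))
    ≡⟨ sum-head ml (M zero) δ (M ∘ suc) ⟩
  sumFin (λ j → M zero j * F (δ j ▹ (M ∘ suc)))
    ≡⟨ sum-cong (λ j → trans (cong (M zero j *_) (step j)) (lem (M zero j) (sgn j) (F δ) (minor j))) ⟩
  sumFin (λ j → F δ * (sgn j * (M zero j * minor j)))
    ≡⟨ sum-*ˡ (F δ) (λ j → sgn j * (M zero j * minor j)) ⟩
  F δ * sumFin (λ j → sgn j * (M zero j * minor j))
    ≡⟨ cong (F δ *_) (sym (det-expand M)) ⟩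
  F δ * det M ∎
  where
  open ≡-Reasoning
  ml = multilinear al
  minor : Fin (suc n) → ℤ
  minor j = det (λ a b → M (suc a) (punchIn j b))
  lem : ∀ m s f d → m * (s * f * d) ≡ f * (s * (m * d))
  lem = solve-∀
  G : Fin (suc n) → (Fin n → Row n) → ℤ
  G j R = F (δ j ▹ (λ a → ins0 j (R a)))
  step : ∀ j → F (δ j ▹ (M ∘ suc)) ≡ sgn j * F δ * minor j
  step j = begin
    F (δ j ▹ (M ∘ suc))
      ≡⟨ respects ml (▹-rows (λ _ → refl) (λ a → ins0-punchIn j (M (suc a)))) ⟩
    F (δ j ▹ (λ a c → M (suc a) j * δ j c + R a c))
      ≡⟨ rank-one (Multilinear-▹ ml (δ j)) (δ j)
           (λ S {i} _ e _ → alternates al (δ j ▹ S) {zero} {suc i} (λ ()) (λ c → sym (e c))) R (λ a → M (suc a) j) ⟩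
    F (δ j ▹ R) + sumFin (λ a → M (suc a) j * F (δ j ▹ upd R a (δ j)))
      ≡⟨ cong (_+_ (F (δ j ▹ R))) (sum-zero (λ a → trans (cong (M (suc a) j *_)
           (alternates al (δ j ▹ upd R a (δ j)) {zero} {suc a} (λ ()) (λ c → sym (cong (λ r → r c) (upd-same R a (δ j))))))
           (ℤₚ.*-zeroʳ (M (suc a) j)))) ⟩
    F (δ j ▹ R) + + 0
      ≡⟨ ℤₚ.+-identityʳ (F (δ j ▹ R)) ⟩
    G j (λ a b → M (suc a) (punchIn j b))
      ≡⟨ alternating-unique (Alternating-map (Alternating-▹ al (δ j)) (ins0 j) (ins0-cong j) (ins0-linear j)) _ ⟩
    G j δ * minor j
      ≡⟨ cong (_* minor j) (trans (respects ml (▹-rows (λ _ → refl) (λ a → ins0-δ j a))) (cycle-sign al j)) ⟩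
    sgn j * F δ * minor j ∎
    where
    R : Fin n → Row (suc n)
    R a = ins0 j (λ b → M (suc a) (punchIn j b))

det-δ : ∀ n → det (δ {n}) ≡ + 1
det-δ zero = refl
det-δ (suc n) = trans (det-expand (δ {suc n})) (trans
  (cong₂ _+_ (trans (lem₀ (det (δ {n}))) (det-δ n))
    (sum-zero {n} (λ j → lem (- sgn j) (det (λ a b → δ {suc n} (suc a) (punchIn (suc j) b))))))
  refl)
  where
  lem₀ : ∀ d → + 1 * (+ 1 * d) ≡ d
  lem₀ = solve-∀
  lem : ∀ s d → s * (+ 0 * d) ≡ + 0
  lem = solve-∀

infixl 7 _⊗_
_⊗_ : ∀ {l m n} → (Fin l → Row m) → (Fin m → Row n) → Fin l → Row n
(A ⊗ B) i j = sumFin (λ k → A i k * B k j)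

δ-⊗ : ∀ {m n} (B : Fin m → Row n) i j → (δ ⊗ B) i j ≡ B i j
δ-⊗ B i j = sum-δ i (λ k → B k j)

-- As a function of `A` the left side is alternating, and its value at the identity is `det B`.
det-⊗ : ∀ {n} (A B : Fin n → Row n) → det (A ⊗ B) ≡ det A * det B
det-⊗ {n} A B = trans
  (alternating-unique (Alternating-map det-alternating (λ u j → sumFin (λ k → u k * B k j))
    (λ e j → sum-cong (λ k → cong (_* B k j) (e k)))
    (λ s u w j → trans (sum-cong (λ k → lem s (u k) (w k) (B k j)))
      (trans (sum-+ (λ k → s * (u k * B k j)) (λ k → w k * B k j))
        (cong (_+ sumFin (λ k → w k * B k j)) (sum-*ˡ s (λ k → u k * B k j)))))) A)
  (trans (cong (_* det A) (det-cong (δ-⊗ B))) (ℤₚ.*-comm (det B) (det A)))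
  where
  lem : ∀ s u w b → (s * u + w) * b ≡ s * (u * b) + w * b
  lem = solve-∀

-- Permuting rows and columns together gives an alternating form with value 1 at the identity, so no
-- sign of a permutation has to be computed.
det-relabel : ∀ {n} (π π⁻¹ : Fin n → Fin n) → (∀ i → π (π⁻¹ i) ≡ i) → (∀ i → π⁻¹ (π i) ≡ i) →
  ∀ M → det (λ i j → M (π i) (π j)) ≡ det M
det-relabel {n} π π⁻¹ inv₁ inv₂ M = trans (alternating-unique al M)
  (trans (cong (_* det M) (trans (det-cong δ-π) (det-δ n))) (ℤₚ.*-identityˡ (det M)))
  where
  π-inj : ∀ {i j} → π i ≡ π j → i ≡ j
  π-inj {i} {j} e = trans (sym (inv₂ i)) (trans (cong π⁻¹ e) (inv₂ j))
  δ-π : ∀ i j → δ (π i) (π j) ≡ δ i j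
  δ-π i j with i ≟ j
  ... | yes refl = trans (δ-refl (π i)) (sym (δ-refl i))
  ... | no ne = trans (δ-≢ (λ e → ne (π-inj e))) (sym (δ-≢ ne))
  upd-π : ∀ (R : Fin n → Row n) p x i → upd R p x (π i) ≡ upd (R ∘ π) (π⁻¹ p) x i
  upd-π R p x i with π⁻¹ p ≟ i
  ... | yes refl = trans (cong (upd R p x) (inv₁ p)) (trans (upd-same R p x) (sym (upd-same (R ∘ π) (π⁻¹ p) x)))
  ... | no ne = trans (upd-other R x (λ e → ne (trans (cong π⁻¹ e) (inv₂ i)))) (sym (upd-other (R ∘ π) x ne))
  G : (Fin n → Row n) → ℤ
  G R = det (λ i j → R i (π j))
  G-alt : Alternating G
  G-alt = Alternating-map det-alternating (λ u j → u (π j)) (λ e j → e (π j)) (λ _ _ _ _ → refl)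
  al : Alternating (λ R → G (R ∘ π))
  al = record
    { multilinear = record
      { respects = λ e → respects (multilinear G-alt) (λ i → e (π i))
      ; linear = λ R p s u w → trans (respects (multilinear G-alt) (app (upd-π R p (λ c → s * u c + w c))))
          (trans (linear (multilinear G-alt) (R ∘ π) (π⁻¹ p) s u w)
            (sym (cong₂ (λ x y → s * x + y) (respects (multilinear G-alt) (app (upd-π R p u)))
              (respects (multilinear G-alt) (app (upd-π R p w))))))
      }
    ; alternates = λ R {i} {j} ne e → alternates G-alt (R ∘ π) {π⁻¹ i} {π⁻¹ j}
        (λ q → ne (trans (sym (inv₁ i)) (trans (cong π q) (inv₁ j))))
        (λ c → trans (cong (λ x → R x c) (inv₁ i)) (trans (e c) (cong (λ x → R x c) (sym (inv₁ j)))))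
    }

det-rank-one : ∀ {n} (M : Fin n → Row n) (t : Fin n → ℤ) (w : Row n) →
  det (λ i c → t i * w c + M i c) ≡ det M + sumFin (λ i → t i * det (upd M i w))
det-rank-one M t w = rank-one det-multilinear w
  (λ R ne e e′ → det-alternates R ne (λ c → trans (e c) (sym (e′ c)))) M t

det-upd-linear : ∀ {n} (M : Fin n → Row n) i s u w →
  det (upd M i (λ c → s * u c + w c)) ≡ s * det (upd M i u) + det (upd M i w)
det-upd-linear = linear det-multilinear

det-upd-cong : ∀ {n} (M : Fin n → Row n) i {u w : Row n} → (∀ c → u c ≡ w c) → det (upd M i u) ≡ det (upd M i w)
det-upd-cong M i {u} {w} e = det-cong (λ j c → go j c)
  where
  go : ∀ j c → upd M i u j c ≡ upd M i w j c
  go j c with i ≟ j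
  ... | yes refl = trans (cong (λ r → r c) (upd-same M i u)) (trans (e c) (sym (cong (λ r → r c) (upd-same M i w))))
  ... | no ne = cong (λ r → r c) (trans (upd-other M u ne) (sym (upd-other M w ne)))

det-upd-sum : ∀ {n l} (M : Fin n → Row n) i (t : Fin l → ℤ) (w : Fin l → Row n) →
  det (upd M i (λ c → sumFin (λ j → t j * w j c))) ≡ sumFin (λ j → t j * det (upd M i (w j)))
det-upd-sum {l = zero} M i t w = trans (det-upd-cong M i {w = λ c → - + 1 * + 0 + + 0} (λ _ → refl))
  (trans (det-upd-linear M i (- + 1) (λ _ → + 0) (λ _ → + 0)) (lem (det (upd M i (λ _ → + 0)))))
  where
  lem : ∀ x → - + 1 * x + x ≡ + 0
  lem = solve-∀
det-upd-sum {l = suc l} M i t w = trans (det-upd-linear M i (t zero) (w zero) _)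
  (cong (_+_ (t zero * det (upd M i (w zero)))) (det-upd-sum M i (t ∘ suc) (w ∘ suc)))

det-upd-id : ∀ {n} (M : Fin n → Row n) i → det (upd M i (M i)) ≡ det M
det-upd-id M i = det-cong (app (upd-id M i))

det-upd-row : ∀ {n} (M : Fin n → Row n) {i j} → i ≢ j → det (upd M i (M j)) ≡ + 0
det-upd-row M {i} {j} ne = det-alternates (upd M i (M j)) ne
  (λ c → cong (λ r → r c) (trans (upd-same M i (M j)) (sym (upd-other M (M j) ne))))

det-upd-rows : ∀ {n} (M : Fin n → Row n) i (t : Fin n → ℤ) →
  det (upd M i (λ c → sumFin (λ j → t j * M j c))) ≡ t i * det M
det-upd-rows M i t = trans (det-upd-sum M i t M) (trans (sum-cong term) (sum-δ i (λ j → t j * det M)))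
  where
  lem : ∀ t d → t * d ≡ + 1 * (t * d)
  lem = solve-∀
  lem₂ : ∀ t d → t * + 0 ≡ + 0 * (t * d)
  lem₂ = solve-∀
  term : ∀ j → t j * det (upd M i (M j)) ≡ δ i j * (t j * det M)
  term j with i ≟ j
  ... | yes refl rewrite δ-refl i | det-upd-id M i = lem (t i) (det M)
  ... | no ne rewrite δ-≢ ne | det-upd-row M ne = lem₂ (t j) (det M)

det-δ-upd : ∀ {n} (v : Row n) i → det (upd δ i v) ≡ v i
det-δ-upd {n} v i = trans (det-upd-cong δ i (λ c → sym (sum-δʳ c v)))
  (trans (det-upd-rows δ i v) (trans (cong (v i *_) (det-δ n)) (ℤₚ.*-identityʳ (v i))))

-- The left side is alternating in `M`, so it suffices to evaluate it at the identity, where it is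
-- `v j`. If rows `a` and `b` agree, all terms but these two vanish, and the two cancel after a row
-- swap.
cramer : ∀ {n} (M : Fin n → Row n) (v : Row n) j →
  sumFin (λ i → det (upd M i v) * M i j) ≡ det M * v j
cramer {n} M v j = trans (alternating-unique al M) (trans
  (cong (_* det M) (trans (sum-δʳ j (λ i → det (upd δ i v))) (det-δ-upd v j)))
  (ℤₚ.*-comm (v j) (det M)))
  where
  F : (Fin n → Row n) → ℤ
  F M = sumFin (λ i → det (upd M i v) * M i j)
  upd-twice : ∀ {n} {A : Set} (f : Fin n → A) p x y i → upd (upd f p x) p y i ≡ upd f p y i
  upd-twice f zero x y zero = refl
  upd-twice f zero x y (suc i) = refl
  upd-twice f (suc p) x y zero = refl
  upd-twice f (suc p) x y (suc i) = upd-twice (f ∘ suc) p x y i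
  upd-cong₁ : ∀ {A B : Fin n → Row n} → (∀ i c → A i c ≡ B i c) → ∀ p i c → upd A p v i c ≡ upd B p v i c
  upd-cong₁ {A} {B} e p i c with p ≟ i
  ... | yes refl = cong (λ r → r c) (trans (upd-same A p v) (sym (upd-same B p v)))
  ... | no ne = trans (cong (λ r → r c) (upd-other A v ne)) (trans (e i c) (sym (cong (λ r → r c) (upd-other B v ne))))
  lin : ∀ R i s u w → F (upd R i (λ c → s * u c + w c)) ≡ s * F (upd R i u) + F (upd R i w)
  lin R i s u w = trans (sum-cong term)
      (trans (sum-+ (λ p → s * g u p) (g w)) (cong (_+ sumFin (g w)) (sum-*ˡ s (g u))))
    where
    g : Row n → Fin n → ℤ
    g x p = det (upd (upd R i x) p v) * upd R i x p j
    lem₁ : ∀ d s a b → d * (s * a + b) ≡ s * (d * a) + d * b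
    lem₁ = solve-∀
    lem₂ : ∀ a b s r → (s * a + b) * r ≡ s * (a * r) + b * r
    lem₂ = solve-∀
    same : ∀ x → g x i ≡ det (upd R i v) * x j
    same x = cong₂ _*_ (det-cong (app (upd-twice R i x v))) (cong (λ r → r j) (upd-same R i x))
    other : ∀ x {p} → i ≢ p → g x p ≡ det (upd (upd R p v) i x) * R p j
    other x ne = cong₂ _*_ (det-cong (app (upd-comm R x v ne))) (cong (λ r → r j) (upd-other R x ne))
    term : ∀ p → g (λ c → s * u c + w c) p ≡ s * g u p + g w p
    term p with i ≟ p
    ... | yes refl = trans (same (λ c → s * u c + w c)) (trans (lem₁ (det (upd R i v)) s (u j) (w j))
            (sym (cong₂ (λ x y → s * x + y) (same u) (same w))))
    ... | no ne = trans (other (λ c → s * u c + w c) ne) (trans (cong (_* R p j) (det-upd-linear (upd R p v) i s u w))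
            (trans (lem₂ (det (upd (upd R p v) i u)) (det (upd (upd R p v) i w)) s (R p j))
            (sym (cong₂ (λ x y → s * x + y) (other u ne) (other w ne)))))
  alt : ∀ R {a b} → a ≢ b → (∀ c → R a c ≡ R b c) → F R ≡ + 0
  alt R {a} {b} ne e = trans (sum-cong term)
    (trans (sum-+ (λ p → δ a p * g p) (λ p → δ b p * g p))
      (trans (cong₂ _+_ (sum-δ a g) (sum-δ b g)) cancel))
    where
    g : Fin n → ℤ
    g p = det (upd R p v) * R p j
    lem₁ : ∀ x y → x ≡ + 1 * x + + 0 * y
    lem₁ = solve-∀
    lem₂ : ∀ x y → x ≡ + 0 * y + + 1 * x
    lem₂ = solve-∀
    term : ∀ p → g p ≡ δ a p * g p + δ b p * g p
    term p with a ≟ p | b ≟ p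
    ... | yes refl | yes refl = ⊥-elim (ne refl)
    ... | yes refl | no bp rewrite δ-refl a | δ-≢ bp = lem₁ (g a) (g a)
    ... | no ap | yes refl rewrite δ-refl b | δ-≢ ap = lem₂ (g b) (g b)
    ... | no ap | no bp rewrite δ-≢ ap | δ-≢ bp = trans
      (cong (_* R p j) (det-alternates (upd R p v) ne
        (λ c → trans (cong (λ r → r c) (upd-other R v (λ q → ap (sym q))))
          (trans (e c) (sym (cong (λ r → r c) (upd-other R v (λ q → bp (sym q)))))))))
      (lem₀ (R p j) (g p))
      where
      lem₀ : ∀ r x → + 0 * r ≡ + 0 * x + + 0 * x
      lem₀ = solve-∀
    swapped : det (upd R a v) ≡ - det (upd R b v)
    swapped = trans (det-cong (λ i c → trans (cong (λ r → r c) (sym (upd-id (upd R a v) b i))) (upd-row i c)))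
      (trans (swap-rows det-multilinear ne (λ S → det-alternates S ne) R v (R b))
        (cong -_ (det-cong (λ i c → trans (sym (upd-row′ i c)) (cong (λ r → r c) (upd-back i))))))
      where
      upd-row : ∀ i c → upd (upd R a v) b (upd R a v b) i c ≡ upd (upd R a v) b (R b) i c
      upd-row i c = cong (λ x → upd (upd R a v) b x i c) (upd-other R v ne)
      upd-row′ : ∀ i c → upd (upd R a (R a)) b v i c ≡ upd (upd R a (R b)) b v i c
      upd-row′ i c with b ≟ i
      ... | yes refl = cong (λ r → r c) (trans (upd-same (upd R a (R a)) b v) (sym (upd-same (upd R a (R b)) b v)))
      ... | no bi = trans (cong (λ r → r c) (upd-other (upd R a (R a)) v bi))
              (trans (go i c) (sym (cong (λ r → r c) (upd-other (upd R a (R b)) v bi))))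
        where
        go : ∀ i c → upd R a (R a) i c ≡ upd R a (R b) i c
        go i c with a ≟ i
        ... | yes refl = trans (cong (λ r → r c) (upd-same R a (R a))) (trans (e c) (sym (cong (λ r → r c) (upd-same R a (R b)))))
        ... | no ai = cong (λ r → r c) (trans (upd-other R (R a) ai) (sym (upd-other R (R b) ai)))
      upd-back : ∀ i → upd (upd R a (R a)) b v i ≡ upd R b v i
      upd-back i with b ≟ i
      ... | yes refl = trans (upd-same (upd R a (R a)) b v) (sym (upd-same R b v))
      ... | no bi = trans (upd-other (upd R a (R a)) v bi) (trans (upd-id R a i) (sym (upd-other R v bi)))
    cancel : g a + g b ≡ + 0
    cancel = trans (cong₂ (λ x y → x * y + g b) swapped (e j)) (lem₃ (det (upd R b v)) (R b j))
      where
      lem₃ : ∀ d r → - d * r + d * r ≡ + 0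
      lem₃ = solve-∀
  al : Alternating F
  al = record
    { multilinear = record
      { respects = λ {A} {B} e → sum-cong (λ i → cong₂ _*_ (det-cong (upd-cong₁ e i)) (e i j))
      ; linear = lin
      }
    ; alternates = alt
    }

-- Matrix pencils and cospectral matrices

-- The form Σ c_i x^i y^(n-i) in Horner shape, peeling off the pure power of y.
hom : ∀ n → Row (suc n) → ℤ → ℤ → ℤ
hom zero    c x y = c zero
hom (suc n) c x y = c zero * y ^ suc n + x * hom n (c ∘ suc) x y

IsHom : ℕ → (ℤ → ℤ → ℤ) → Set
IsHom n f = ∃ λ c → ∀ x y → f x y ≡ hom n c x y

hom-linear : ∀ n s c d x y → hom n (λ i → s * c i + d i) x y ≡ s * hom n c x y + hom n d x y
hom-linear zero    s c d x y = refl
hom-linear (suc n) s c d x y = trans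
  (cong (λ h → (s * c zero + d zero) * y ^ suc n + x * h) (hom-linear n s (c ∘ suc) (d ∘ suc) x y))
  (lem s (c zero) (d zero) (y ^ suc n) x (hom n (c ∘ suc) x y) (hom n (d ∘ suc) x y))
  where
  lem : ∀ s c d p x h k → (s * c + d) * p + x * (s * h + k) ≡ s * (c * p + x * h) + (d * p + x * k)
  lem = solve-∀

snoc0 : ∀ {n} → Row n → Row (suc n)
snoc0 {zero}  c _       = + 0
snoc0 {suc n} c zero    = c zero
snoc0 {suc n} c (suc i) = snoc0 (c ∘ suc) i

hom-mul-y : ∀ n c x y → y * hom n c x y ≡ hom (suc n) (snoc0 c) x y
hom-mul-y zero c x y = lem (c zero) x y
  where
  lem : ∀ c x y → y * c ≡ c * (y * + 1) + x * + 0
  lem = solve-∀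
hom-mul-y (suc n) c x y = trans
  (lem (c zero) (y ^ suc n) x y (hom n (c ∘ suc) x y))
  (cong (λ h → c zero * (y * y ^ suc n) + x * h) (hom-mul-y n (c ∘ suc) x y))
  where
  lem : ∀ c p x y h → y * (c * p + x * h) ≡ c * (y * p) + x * (y * h)
  lem = solve-∀

IsHom-0 : ∀ n → IsHom n (λ _ _ → + 0)
IsHom-0 n = (λ _ → + 0) , go n
  where
  go : ∀ n x y → + 0 ≡ hom n (λ _ → + 0) x y
  go zero x y = refl
  go (suc n) x y = trans (lem (y ^ suc n) x) (cong (λ h → + 0 * y ^ suc n + x * h) (go n x y))
    where
    lem : ∀ p x → + 0 ≡ + 0 * p + x * + 0
    lem = solve-∀

IsHom-linear : ∀ {n f g} s → IsHom n f → IsHom n g → IsHom n (λ x y → s * f x y + g x y)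
IsHom-linear {n} s (c , e) (d , e′) = (λ i → s * c i + d i) ,
  λ x y → trans (cong₂ (λ a b → s * a + b) (e x y) (e′ x y)) (sym (hom-linear n s c d x y))

IsHom-sum : ∀ {n l} (s : Fin l → ℤ) (f : Fin l → ℤ → ℤ → ℤ) → (∀ j → IsHom n (f j)) →
  IsHom n (λ x y → sumFin (λ j → s j * f j x y))
IsHom-sum {n} {zero}  s f h = IsHom-0 n
IsHom-sum {n} {suc l} s f h = IsHom-linear (s zero) (h zero) (IsHom-sum (s ∘ suc) (f ∘ suc) (h ∘ suc))

IsHom-mul : ∀ {n f} a b → IsHom n f → IsHom (suc n) (λ x y → (x * a + y * b) * f x y)
IsHom-mul {n} {f} a b (c , e) = (λ i → a * (+ 0 ▹ c) i + (b * snoc0 c i + + 0)) , λ x y → trans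
  (cong ((x * a + y * b) *_) (e x y)) (trans (lem x y a b (hom n c x y) (y ^ suc n))
    (trans (cong (λ h → a * (+ 0 * y ^ suc n + x * hom n c x y) + (b * h + + 0)) (hom-mul-y n c x y))
      (trans (cong (λ h → a * (+ 0 * y ^ suc n + x * hom n c x y) + (b * hom (suc n) (snoc0 c) x y + h)) (proj₂ (IsHom-0 (suc n)) x y))
        (sym (trans (hom-linear (suc n) a (+ 0 ▹ c) (λ i → b * snoc0 c i + + 0) x y)
          (cong (_+_ (a * hom (suc n) (+ 0 ▹ c) x y)) (hom-linear (suc n) b (snoc0 c) (λ _ → + 0) x y)))))))
  where
  lem : ∀ x y a b h p → (x * a + y * b) * h ≡ a * (+ 0 * p + x * h) + (b * (y * h) + + 0)
  lem = solve-∀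

pencil : ∀ {n} → (Fin n → Row n) → (Fin n → Row n) → ℤ → ℤ → Fin n → Row n
pencil A B x y i j = x * A i j + y * B i j

det-pencil : ∀ {n} (A B : Fin n → Row n) → IsHom n (λ x y → det (pencil A B x y))
det-pencil {zero}  A B = (λ _ → + 1) , λ _ _ → refl
det-pencil {suc n} A B = proj₁ h , λ x y → trans (det-expand (pencil A B x y)) (proj₂ h x y)
  where
  minor : (Fin (suc n) → Row (suc n)) → Fin (suc n) → Fin n → Row n
  minor M j a b = M (suc a) (punchIn j b)
  h : IsHom (suc n) (λ x y → sumFin (λ j → sgn j * ((x * A zero j + y * B zero j) * det (pencil (minor A j) (minor B j) x y))))
  h = IsHom-sum sgn (λ j x y → (x * A zero j + y * B zero j) * det (pencil (minor A j) (minor B j) x y))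
    (λ j → IsHom-mul (A zero j) (B zero j) (det-pencil (minor A j) (minor B j)))

-- Divisibility by ∣d∣ + 1 alone forces this. It serves wherever coefficients or traces are
-- compared.
multiple-of-all : ∀ d → (∀ m → ∃ λ r → d ≡ + suc m * r) → d ≡ + 0
multiple-of-all d h = go (proj₁ (h ∣ d ∣)) (proj₂ (h ∣ d ∣)) ∣ proj₁ (h ∣ d ∣) ∣ refl
  where
  go : ∀ r → d ≡ + suc ∣ d ∣ * r → ∀ k → ∣ r ∣ ≡ k → d ≡ + 0
  go r e zero eq = trans e (trans (cong (+ suc ∣ d ∣ *_) (ℤₚ.∣i∣≡0⇒i≡0 eq)) (ℤₚ.*-zeroʳ (+ suc ∣ d ∣)))
  go r e (suc k) eq = ⊥-elim (ℕₚ.n≮n ∣ d ∣ (ℕₚ.≤-trans (ℕₚ.m≤m*n (suc ∣ d ∣) (suc k))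
    (ℕₚ.≤-reflexive (sym (trans (cong ∣_∣ e) (trans (ℤₚ.abs-* (+ suc ∣ d ∣) r) (cong (suc ∣ d ∣ ℕ.*_) eq)))))))

^-unit : ∀ y → y * y ≡ + 1 → ∀ n → y ^ n * y ^ n ≡ + 1
^-unit y e zero    = refl
^-unit y e (suc n) = trans (lem y (y ^ n)) (trans (cong₂ _*_ e (^-unit y e n)) refl)
  where
  lem : ∀ y p → y * p * (y * p) ≡ (y * y) * (p * p)
  lem = solve-∀

-- As y = ±1, a zero at `X t` makes `c zero` divisible by `X t`, hence by t + 1. This holds for
-- every t, so `c zero` is 0; then the nonzero factor `X t` cancels and the next coefficient takes
-- its place.
hom-vanishes : ∀ n c y (X r : ℕ → ℤ) → y * y ≡ + 1 → (∀ t → X t ≡ + suc t * r t) → (∀ t → X t ≢ + 0) →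
  (∀ t → hom n c (X t) y ≡ + 0) → ∀ i → c i ≡ + 0
hom-vanishes zero c y X r unit div nz h zero = h 0
hom-vanishes (suc n) c y X r unit div nz h = go
  where
  k : ℕ → ℤ
  k t = hom n (c ∘ suc) (X t) y
  eliminate : ∀ c s x k → s * s ≡ + 1 → c * s + x * k ≡ + 0 → c ≡ x * (- (k * s))
  eliminate c s x k e e′ = trans (lem c s x k) (trans (cong₂ (λ a b → c - c * a + b * s - x * k * s) e e′) (lem′ c s x k))
    where
    lem : ∀ c s x k → c ≡ c - c * (s * s) + (c * s + x * k) * s - x * k * s
    lem = solve-∀
    lem′ : ∀ c s x k → c - c * + 1 + + 0 * s - x * k * s ≡ x * (- (k * s))
    lem′ = solve-∀
  c₀ : c zero ≡ + 0
  c₀ = multiple-of-all (c zero) (λ m → r m * - (k m * y ^ suc n) ,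
    trans (eliminate (c zero) (y ^ suc n) (X m) (k m) (^-unit y unit (suc n)) (h m))
      (trans (cong (_* - (k m * y ^ suc n)) (div m)) (ℤₚ.*-assoc (+ suc m) (r m) (- (k m * y ^ suc n)))))
  rest : ∀ t → k t ≡ + 0
  rest t = *-nonzero (nz t) (trans (lem (y ^ suc n) (X t * k t)) (trans (cong (λ a → a * y ^ suc n + X t * k t) (sym c₀)) (h t)))
    where
    lem : ∀ s x → x ≡ + 0 * s + x
    lem = solve-∀
  go : ∀ i → c i ≡ + 0
  go zero = c₀
  go (suc i) = hom-vanishes n (c ∘ suc) y X r unit div nz rest i

-- Sample points for x: at x = s², y = -1 the pencil of `M ⊗ M` factors into sI + M and sI - M, so
-- these are the points at which `cosp-square` obtains agreement directly.
square : ℕ → ℤ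
square t = + suc t * + suc t

-- The homogeneous form is chosen for its closure properties: adding the identity to the matrix
-- substitutes x + y for x, and both factors sI + M and sI - M of a square are members of the same
-- pencil.
record Cosp {n} (M N : Fin n → Row n) : Set where
  field
    det-eq : ∀ x y → det (pencil δ M x y) ≡ det (pencil δ N x y)
open Cosp public

cosp-from-squares : ∀ {n} (M N : Fin n → Row n) →
  (∀ t → det (pencil δ M (square t) (- + 1)) ≡ det (pencil δ N (square t) (- + 1))) → Cosp M N
cosp-from-squares {n} M N h .det-eq x y = trans (eM x y) (trans (hom-cong n c≡d x y) (sym (eN x y)))
  where
  c = proj₁ (det-pencil δ M)
  d = proj₁ (det-pencil δ N)
  eM = proj₂ (det-pencil δ M)
  eN = proj₂ (det-pencil δ N)
  hom-cong : ∀ n {c d} → (∀ i → c i ≡ d i) → ∀ x y → hom n c x y ≡ hom n d x y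
  hom-cong zero e x y = e zero
  hom-cong (suc n) e x y = cong₂ (λ a b → a * y ^ suc n + x * b) (e zero) (hom-cong n (e ∘ suc) x y)
  lem : ∀ a → - + 1 * a + a ≡ + 0
  lem = solve-∀
  agree : ∀ x y → det (pencil δ M x y) ≡ det (pencil δ N x y) → hom n (λ i → - + 1 * d i + c i) x y ≡ + 0
  agree x y e = trans (hom-linear n (- + 1) d c x y)
    (trans (cong₂ (λ a b → - + 1 * a + b) (sym (eN x y)) (trans (sym (eM x y)) e)) (lem (det (pencil δ N x y))))
  difference : ∀ i → - + 1 * d i + c i ≡ + 0
  difference = hom-vanishes n (λ i → - + 1 * d i + c i) (- + 1) square (λ t → + suc t) refl (λ _ → refl) (λ _ ())
    (λ t → agree (square t) (- + 1) (h t))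
  c≡d : ∀ i → c i ≡ d i
  c≡d i = trans (lem₁ (c i) (d i)) (trans (cong (_+ d i) (difference i)) (ℤₚ.+-identityˡ (d i)))
    where
    lem₁ : ∀ c d → c ≡ - + 1 * d + c + d
    lem₁ = solve-∀

cosp-shift : ∀ {n} {M N : Fin n → Row n} → Cosp M N → Cosp (λ i j → δ i j + M i j) (λ i j → δ i j + N i j)
cosp-shift {M = M} {N} h .det-eq x y = trans (det-cong (λ i j → lem x y (δ i j) (M i j)))
  (trans (det-eq h (x + y) y) (det-cong (λ i j → sym (lem x y (δ i j) (N i j)))))
  where
  lem : ∀ x y d m → x * d + y * (d + m) ≡ (x + y) * d + y * m
  lem = solve-∀

pencil-⊗ : ∀ {n} (M : Fin n → Row n) x y i j →
  (pencil δ M x y ⊗ pencil δ M x (- y)) i j ≡ pencil δ (M ⊗ M) (x * x) (- (y * y)) i j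
pencil-⊗ {n} M x y i j = begin
  sumFin (λ k → (x * δ i k + y * M i k) * (x * δ k j + - y * M k j))
    ≡⟨ sum-cong (λ k → lem x y (δ i k) (M i k) (δ k j) (M k j)) ⟩
  sumFin (λ k → δ i k * P k + (M i k * (x * y) * δ k j + - (y * y) * (M i k * M k j)))
    ≡⟨ trans (sum-+ (λ k → δ i k * P k) (λ k → Q k + - (y * y) * (M i k * M k j)))
         (cong (_+_ (sumFin (λ k → δ i k * P k))) (sum-+ Q (λ k → - (y * y) * (M i k * M k j)))) ⟩
  sumFin (λ k → δ i k * P k) + (sumFin Q + sumFin (λ k → - (y * y) * (M i k * M k j)))
    ≡⟨ cong₂ _+_ (sum-δ i P) (cong₂ _+_ (sum-δʳ j (λ k → M i k * (x * y))) (sum-*ˡ (- (y * y)) (λ k → M i k * M k j))) ⟩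
  P i + (M i j * (x * y) + - (y * y) * (M ⊗ M) i j)
    ≡⟨ lem₂ x y (δ i j) (M i j) ((M ⊗ M) i j) ⟩
  x * x * δ i j + - (y * y) * (M ⊗ M) i j ∎
  where
  open ≡-Reasoning
  P Q : Fin n → ℤ
  P k = x * x * δ k j - x * y * M k j
  Q k = M i k * (x * y) * δ k j
  lem : ∀ x y d m e k → (x * d + y * m) * (x * e + - y * k) ≡ d * (x * x * e - x * y * k) + (m * (x * y) * e + - (y * y) * (m * k))
  lem = solve-∀
  lem₂ : ∀ x y d m s → x * x * d - x * y * m + (m * (x * y) + - (y * y) * s) ≡ x * x * d + - (y * y) * s
  lem₂ = solve-∀

cosp-square : ∀ {n} {M N : Fin n → Row n} → Cosp M N → Cosp (M ⊗ M) (N ⊗ N)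
cosp-square {M = M} {N} h = cosp-from-squares (M ⊗ M) (N ⊗ N) (λ t → trans (factor M t) (trans
  (cong₂ _*_ (det-eq h (+ suc t) (+ 1)) (det-eq h (+ suc t) (- + 1))) (sym (factor N t))))
  where
  factor : ∀ M t → det (pencil δ (M ⊗ M) (square t) (- + 1)) ≡ det (pencil δ M (+ suc t) (+ 1)) * det (pencil δ M (+ suc t) (- + 1))
  factor M t = trans (det-cong (λ i j → sym (pencil-⊗ M (+ suc t) (+ 1) i j)))
    (det-⊗ (pencil δ M (+ suc t) (+ 1)) (pencil δ M (+ suc t) (- + 1)))

trace : ∀ {n} → (Fin n → Row n) → ℤ
trace M = sumFin (λ i → M i i)

column₀-divides : ∀ {n} y (c : Fin (suc n) → ℤ) (M : Fin (suc n) → Row (suc n)) → (∀ i → M i zero ≡ y * c i) → ∃ λ q → det M ≡ y * q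
column₀-divides {zero} y c M e = c zero , trans (det-expand M) (trans (cong (λ x → + 1 * (x * + 1) + + 0) (e zero)) (lem (y * c zero)))
  where
  lem : ∀ x → + 1 * (x * + 1) + + 0 ≡ x
  lem = solve-∀
column₀-divides {suc n} y c M e = q₀ + sumFin (λ j → - sgn j * (M zero (suc j) * proj₁ (rec j))) ,
  trans (det-expand M) (trans (cong₂ _+_ (trans (cong (λ x → + 1 * (x * D₀)) (e zero)) (lem₀ y (c zero) D₀))
    (trans (sum-cong (λ j → trans (cong (λ d → - sgn j * (M zero (suc j) * d)) (proj₂ (rec j))) (lem y (- sgn j) (M zero (suc j)) (proj₁ (rec j)))))
      (sum-*ˡ y (λ j → - sgn j * (M zero (suc j) * proj₁ (rec j))))))
    (sym (ℤₚ.*-distribˡ-+ y q₀ (sumFin (λ j → - sgn j * (M zero (suc j) * proj₁ (rec j)))))))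
  where
  D₀ = det (λ a b → M (suc a) (suc b))
  q₀ = c zero * D₀
  rec : ∀ j → ∃ λ q → det (λ a b → M (suc a) (punchIn (suc j) b)) ≡ y * q
  rec j = column₀-divides y (c ∘ suc) (λ a b → M (suc a) (punchIn (suc j) b)) (λ a → e (suc a))
  lem₀ : ∀ y c d → + 1 * (y * c * d) ≡ y * (c * d)
  lem₀ = solve-∀
  lem : ∀ y s m q → s * (m * (y * q)) ≡ y * (s * (m * q))
  lem = solve-∀

-- Off the diagonal, the entry in row 0 contributes one factor y, and the minor contributes another:
-- it drops row 0 but keeps column 0, all of whose remaining entries are multiples of y.
det-first-order : ∀ {n} (N : Fin n → Row n) y → ∃ λ q → det (pencil δ N (+ 1) y) ≡ + 1 + y * trace N + y * y * q
det-first-order {zero} N y = + 0 , lem y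
  where
  lem : ∀ y → + 1 ≡ + 1 + y * + 0 + y * y * + 0
  lem = solve-∀
det-first-order {suc n} N y = a * t + q + y * a * q + S , (begin
  det P
    ≡⟨ det-expand P ⟩
  + 1 * ((+ 1 * + 1 + y * a) * det (pencil δ N′ (+ 1) y)) + sumFin (λ j → - sgn j * ((+ 1 * + 0 + y * N zero (suc j)) * det (minor j)))
    ≡⟨ cong₂ (λ u v → + 1 * ((+ 1 * + 1 + y * a) * u) + v) (proj₂ IH)
         (trans (sum-cong (λ j → trans (cong (λ d → - sgn j * ((+ 1 * + 0 + y * N zero (suc j)) * d)) (proj₂ (rec n N j)))
           (lem y (- sgn j) (N zero (suc j)) (proj₁ (rec n N j)))))
           (sum-*ˡ (y * y) (λ j → - sgn j * (N zero (suc j) * proj₁ (rec n N j))))) ⟩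
  + 1 * ((+ 1 * + 1 + y * a) * (+ 1 + y * t + y * y * q)) + y * y * S
    ≡⟨ lem₂ y a t q S ⟩
  + 1 + y * (a + t) + y * y * (a * t + q + y * a * q + S) ∎)
  where
  open ≡-Reasoning
  P = pencil δ N (+ 1) y
  a = N zero zero
  N′ : Fin n → Row n
  N′ i j = N (suc i) (suc j)
  IH = det-first-order N′ y
  t = trace N′
  q = proj₁ IH
  minor : Fin n → Fin n → Row n
  minor j a b = P (suc a) (punchIn (suc j) b)
  rec : ∀ n (N : Fin (suc n) → Row (suc n)) (j : Fin n) → ∃ λ q → det (λ a b → pencil δ N (+ 1) y (suc a) (punchIn (suc j) b)) ≡ y * q
  rec (suc n) N j = column₀-divides y (λ a → N (suc a) zero) (λ a b → pencil δ N (+ 1) y (suc a) (punchIn (suc j) b)) (λ a → lem₀ y (N (suc a) zero))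
    where
    lem₀ : ∀ y m → + 1 * + 0 + y * m ≡ y * m
    lem₀ = solve-∀
  S = sumFin (λ j → - sgn j * (N zero (suc j) * proj₁ (rec n N j)))
  lem : ∀ y s m q → s * ((+ 1 * + 0 + y * m) * (y * q)) ≡ y * y * (s * (m * q))
  lem = solve-∀
  lem₂ : ∀ y a t q S → + 1 * ((+ 1 * + 1 + y * a) * (+ 1 + y * t + y * y * q)) + y * y * S
    ≡ + 1 + y * (a + t) + y * y * (a * t + q + y * a * q + S)
  lem₂ = solve-∀

-- Comparing the first-order expansions at y = m + 1 shows the difference of the traces to be
-- divisible by m + 1, for every m.
cosp-trace : ∀ {n} {M N : Fin n → Row n} → Cosp M N → trace M ≡ trace N
cosp-trace {M = M} {N} h = ℤₚ.i-j≡0⇒i≡j (trace M) (trace N) (multiple-of-all (trace M - trace N) go)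
  where
  go : ∀ m → ∃ λ r → trace M - trace N ≡ + suc m * r
  go m = q′ - q , ℤₚ.*-cancelˡ-≡ y (trace M - trace N) (y * (q′ - q)) (lem y (trace M) (trace N) q q′
    (trans (sym (proj₂ (det-first-order M y))) (trans (det-eq h (+ 1) y) (proj₂ (det-first-order N y)))))
    where
    y = + suc m
    q = proj₁ (det-first-order M y)
    q′ = proj₁ (det-first-order N y)
    lem : ∀ y a b q q′ → + 1 + y * a + y * y * q ≡ + 1 + y * b + y * y * q′ → y * (a - b) ≡ y * (y * (q′ - q))
    lem y a b q q′ e = trans (lem₁ y a b q) (trans (cong (λ z → z - + 1 - y * b - y * y * q) e) (lem₂ y b q q′))
      where
      lem₁ : ∀ y a b q → y * (a - b) ≡ + 1 + y * a + y * y * q - + 1 - y * b - y * y * q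
      lem₁ = solve-∀
      lem₂ : ∀ y b q q′ → + 1 + y * b + y * y * q′ - + 1 - y * b - y * y * q ≡ y * (y * (q′ - q))
      lem₂ = solve-∀

det-mod : ∀ {n} (A B : Fin n → Row n) t → ∃ λ q → det (pencil A B (+ 1) t) ≡ det A + t * q
det-mod {n} A B t = q , trans (e (+ 1) t) (trans eq (cong (_+ t * q) (trans (sym (e (+ 1) (+ 0)))
    (det-cong (λ i j → lem (A i j) (B i j))))))
  where
  c = proj₁ (det-pencil A B)
  e = proj₂ (det-pencil A B)
  lem : ∀ a b → + 1 * a + + 0 * b ≡ a
  lem = solve-∀
  hom-mod : ∀ n c t → ∃ λ q → hom n c (+ 1) t ≡ hom n c (+ 1) (+ 0) + t * q
  hom-mod zero c t = + 0 , lem₀ (c zero) t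
    where
    lem₀ : ∀ c t → c ≡ c + t * + 0
    lem₀ = solve-∀
  hom-mod (suc n) c t = c zero * t ^ n + q , trans (cong (λ h → c zero * (t * t ^ n) + + 1 * h) eq)
    (lem₁ (c zero) t (t ^ n) ((+ 0) ^ n) (hom n (c ∘ suc) (+ 1) (+ 0)) q)
    where
    q = proj₁ (hom-mod n (c ∘ suc) t)
    eq = proj₂ (hom-mod n (c ∘ suc) t)
    lem₁ : ∀ c t p z h q → c * (t * p) + + 1 * (h + t * q) ≡ c * (+ 0 * z) + + 1 * h + t * (c * p + q)
    lem₁ = solve-∀
  q = proj₁ (hom-mod n c t)
  eq = proj₂ (hom-mod n c t)

trace-⊗-comm : ∀ {n} (X Y : Fin n → Row n) → trace (X ⊗ Y) ≡ trace (Y ⊗ X)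
trace-⊗-comm X Y = trans (sum-swap (λ i j → X i j * Y j i)) (sum-cong (λ j → sum-cong (λ i → ℤₚ.*-comm (X i j) (Y j i))))

trace-⊗-linear : ∀ {n} s (X Y Z : Fin n → Row n) →
  trace ((λ i j → s * X i j + Y i j) ⊗ Z) ≡ s * trace (X ⊗ Z) + trace (Y ⊗ Z)
trace-⊗-linear s X Y Z = trans
  (sum-cong (λ i → trans (sum-cong (λ j → lem s (X i j) (Y i j) (Z j i)))
    (trans (sum-+ (λ j → s * (X i j * Z j i)) (λ j → Y i j * Z j i))
      (cong (_+ (Y ⊗ Z) i i) (sum-*ˡ s (λ j → X i j * Z j i))))))
  (trans (sum-+ (λ i → s * (X ⊗ Z) i i) (λ i → (Y ⊗ Z) i i)) (cong (_+ trace (Y ⊗ Z)) (sum-*ˡ s (λ i → (X ⊗ Z) i i))))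
  where
  lem : ∀ s x y z → (s * x + y) * z ≡ s * (x * z) + y * z
  lem = solve-∀

trace-δ⊗ : ∀ {n} (Z : Fin n → Row n) → trace (δ ⊗ Z) ≡ trace Z
trace-δ⊗ Z = sum-cong (λ i → δ-⊗ Z i i)

trace-⊗δ : ∀ {n} (Z : Fin n → Row n) → trace (Z ⊗ δ) ≡ trace Z
trace-⊗δ Z = trans (trace-⊗-comm Z δ) (trace-δ⊗ Z)

trace-⊗-linearʳ : ∀ {n} s (X Y Z : Fin n → Row n) →
  trace (Z ⊗ (λ i j → s * X i j + Y i j)) ≡ s * trace (Z ⊗ X) + trace (Z ⊗ Y)
trace-⊗-linearʳ s X Y Z = trans (trace-⊗-comm Z (λ i j → s * X i j + Y i j)) (trans (trace-⊗-linear s X Y Z)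
  (cong₂ (λ a b → s * a + b) (trace-⊗-comm X Z) (trace-⊗-comm Y Z)))

-- The cube is reached from fourth powers: squaring twice preserves cospectrality, and so does adding the identity.
cosp-trace³ : ∀ {n} {M N : Fin n → Row n} → Cosp M N → trace ((M ⊗ M) ⊗ M) ≡ trace ((N ⊗ N) ⊗ N)
cosp-trace³ {n} {M} {N} h = ℤₚ.*-cancelˡ-≡ (+ 4) (trace ((M ⊗ M) ⊗ M)) (trace ((N ⊗ N) ⊗ N))
  (lem (t₄ M) (t₃ M) (t₂ M) (trace M) (t₃ N)
    (trans (sym (expand M)) (trans (cosp-trace (cosp-square (cosp-square (cosp-shift h))))
      (trans (expand N) (sym (cong₂ (λ a b → a + + 4 * t₃ N + b) (cosp-trace (cosp-square (cosp-square h)))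
        (cong₂ (λ a b → + 6 * a + + 4 * b + + n) (cosp-trace (cosp-square h)) (cosp-trace h))))))))
  where
  open ≡-Reasoning
  t₂ t₃ t₄ : (Fin n → Row n) → ℤ
  t₂ M = trace (M ⊗ M)
  t₃ M = trace ((M ⊗ M) ⊗ M)
  t₄ M = trace ((M ⊗ M) ⊗ (M ⊗ M))
  lem : ∀ a b c d b′ → a + + 4 * b + (+ 6 * c + + 4 * d + + n) ≡ a + + 4 * b′ + (+ 6 * c + + 4 * d + + n) → + 4 * b ≡ + 4 * b′
  lem a b c d b′ e = trans (lem₁ a b r) (trans (cong (λ x → x - a - r) e) (sym (lem₁ a b′ r)))
    where
    r = + 6 * c + + 4 * d + + n
    lem₁ : ∀ a b r → + 4 * b ≡ a + + 4 * b + r - a - r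
    lem₁ = solve-∀
  trace-δ : trace (δ {n}) ≡ + n
  trace-δ = trans (sum-cong {n} δ-refl) (trans (sum-const n (+ 1)) (ℤₚ.*-identityʳ (+ n)))
  expand : ∀ M → t₄ (λ i j → δ i j + M i j) ≡ t₄ M + + 4 * t₃ M + (+ 6 * t₂ M + + 4 * trace M + + n)
  expand M = begin
    trace ((M₁ ⊗ M₁) ⊗ (M₁ ⊗ M₁))
      ≡⟨ sum-cong (λ i → sum-cong (λ j → cong₂ _*_ (sq i j) (sq j i))) ⟩
    trace (S ⊗ S)
      ≡⟨ trans (trace-⊗-linear (+ 1) M₂ K S) (cong₂ (λ a b → + 1 * a + b)
           (trans (trace-⊗-linearʳ (+ 1) M₂ K M₂) (cong (λ b → + 1 * t₄ M + b) (trans (trace-⊗-linearʳ (+ 2) M δ M₂) (cong (_+_ (+ 2 * t₃ M)) (trace-⊗δ M₂)))))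
           (trans (trace-⊗-linear (+ 2) M δ S) (cong₂ (λ a b → + 2 * a + b)
             (trans (trace-⊗-linearʳ (+ 1) M₂ K M) (cong₂ (λ a b → + 1 * a + b) (trace-⊗-comm M M₂)
               (trans (trace-⊗-linearʳ (+ 2) M δ M) (cong (_+_ (+ 2 * t₂ M)) (trace-⊗δ M)))))
             (trans (trace-⊗-linearʳ (+ 1) M₂ K δ) (cong₂ (λ a b → + 1 * a + b) (trace-δ⊗ M₂)
               (trans (trace-⊗-linearʳ (+ 2) M δ δ) (cong₂ (λ a b → + 2 * a + b) (trace-δ⊗ M) (trans (trace-δ⊗ {n} δ) trace-δ)))))))) ⟩
    + 1 * (+ 1 * t₄ M + (+ 2 * t₃ M + t₂ M)) + (+ 2 * (+ 1 * t₃ M + (+ 2 * t₂ M + trace M)) + (+ 1 * t₂ M + (+ 2 * trace M + + n)))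
      ≡⟨ lem₂ (t₄ M) (t₃ M) (t₂ M) (trace M) (+ n) ⟩
    t₄ M + + 4 * t₃ M + (+ 6 * t₂ M + + 4 * trace M + + n) ∎
    where
    M₁ M₂ K S : Fin n → Row n
    M₁ i j = δ i j + M i j
    M₂ = M ⊗ M
    K i j = + 2 * M i j + δ i j
    S i j = + 1 * M₂ i j + K i j
    lem₂ : ∀ a b c d e → + 1 * (+ 1 * a + (+ 2 * b + c)) + (+ 2 * (+ 1 * b + (+ 2 * c + d)) + (+ 1 * c + (+ 2 * d + e))) ≡ a + + 4 * b + (+ 6 * c + + 4 * d + e)
    lem₂ = solve-∀
    sq : ∀ i j → (M₁ ⊗ M₁) i j ≡ S i j
    sq i j = begin
      sumFin (λ k → (δ i k + M i k) * (δ k j + M k j))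
        ≡⟨ sum-cong (λ k → lem₃ (δ i k) (M i k) (δ k j) (M k j)) ⟩
      sumFin (λ k → δ i k * (δ k j + M k j) + (M i k * δ k j + M i k * M k j))
        ≡⟨ trans (sum-+ (λ k → δ i k * (δ k j + M k j)) (λ k → M i k * δ k j + M i k * M k j))
             (cong₂ _+_ (sum-δ i (λ k → δ k j + M k j)) (trans (sum-+ (λ k → M i k * δ k j) (λ k → M i k * M k j)) (cong (_+ M₂ i j) (sum-δʳ j (M i))))) ⟩
      δ i j + M i j + (M i j + M₂ i j)
        ≡⟨ lem₄ (δ i j) (M i j) (M₂ i j) ⟩
      S i j ∎
      where
      lem₃ : ∀ d m e k → (d + m) * (e + k) ≡ d * (e + k) + (m * e + m * k)
      lem₃ = solve-∀
      lem₄ : ∀ d m s → d + m + (m + s) ≡ + 1 * s + (+ 2 * m + d)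
      lem₄ = solve-∀

-- The tree number as linear coefficient of the characteristic polynomial

record ZeroSums {n} (L : Fin n → Row n) : Set where
  field
    rows    : ∀ i → sumFin (L i) ≡ + 0
    columns : ∀ j → sumFin (λ i → L i j) ≡ + 0

-- The singular `L` with 1 added in the corner. For a Laplacian its determinant is the number of
-- spanning trees, as in the matrix-tree theorem, but the size of the matrix is kept.
pinned : ∀ {n} → (Fin (suc n) → Row (suc n)) → Fin (suc n) → Row (suc n)
pinned L i j = L i j + δ zero i * δ zero j

pinned-column-sum : ∀ {n} {L : Fin (suc n) → Row (suc n)} → ZeroSums L → ∀ c → sumFin (λ i → pinned L i c) ≡ δ zero c
pinned-column-sum {n} {L} zs c = trans (sum-+ (λ i → L i c) (λ i → δ zero i * δ zero c))
  (trans (cong₂ _+_ (ZeroSums.columns zs c) (sum-δ {suc n} zero (λ _ → δ zero c))) (ℤₚ.+-identityˡ (δ zero c)))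

det-upd-ones : ∀ {n} (M : Fin n → Row n) i → det (upd M i (λ c → sumFin (λ j → M j c))) ≡ det M
det-upd-ones M i = trans (det-upd-cong M i {λ c → sumFin (λ j → M j c)} (λ c → sum-cong (λ j → sym (ℤₚ.*-identityˡ (M j c)))))
  (trans (det-upd-rows M i (λ _ → + 1)) (ℤₚ.*-identityˡ (det M)))

-- Adding all other rows to row 0 turns it into `δ zero`, because the columns of `L` sum to zero.
det-pinned : ∀ {n} {L : Fin (suc n) → Row (suc n)} → ZeroSums L → det (pinned L) ≡ det (upd L zero (δ zero))
det-pinned {n} {L} zs = trans (sym (det-upd-ones (pinned L) zero))
  (trans (det-upd-cong (pinned L) zero (pinned-column-sum zs))
    (det-cong {suc n} {upd (pinned L) zero (δ zero)} {upd L zero (δ zero)} (λ { zero c → refl ; (suc i) c → lem (L (suc i) c) (δ zero c) })))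
  where
  lem : ∀ l d → l + + 0 * d ≡ l
  lem = solve-∀

-- Right multiplication by Q = I + 1wᵀ with w = 1 - `δ zero` turns the row `δ zero` into the row of
-- ones and fixes the other rows, whose entries sum to zero. By the rank-one formula `det Q` is 1 +
-- Σ w = n + 1.
det-ones-row : ∀ {n} {L : Fin (suc n) → Row (suc n)} → ZeroSums L →
  det (upd L zero (λ _ → + 1)) ≡ + suc n * det (upd L zero (δ zero))
det-ones-row {n} {L} zs = begin
  det (upd L zero (λ _ → + 1))
    ≡⟨ det-cong (λ i j → sym (product i j)) ⟩
  det (upd L zero (δ zero) ⊗ Q)
    ≡⟨ det-⊗ (upd L zero (δ zero)) Q ⟩
  κ * det Q
    ≡⟨ cong (κ *_) det-Q ⟩
  κ * + suc n
    ≡⟨ ℤₚ.*-comm κ (+ suc n) ⟩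
  + suc n * κ ∎
  where
  open ≡-Reasoning
  κ = det (upd L zero (δ zero))
  w : Row (suc n)
  w c = + 1 - δ zero c
  Q : Fin (suc n) → Row (suc n)
  Q i c = + 1 * w c + δ i c
  det-Q : det Q ≡ + suc n
  det-Q = trans (det-rank-one δ (λ _ → + 1) w) (trans
    (cong₂ _+_ (det-δ (suc n)) (trans (sum-cong (λ i → trans (ℤₚ.*-identityˡ _) (det-δ-upd w i)))
      (trans (sum-minus (λ _ → + 1) (δ {suc n} zero)) (cong₂ _-_ (sum-const (suc n) (+ 1)) (sum-δ1 {suc n} zero)))))
    (lem (+ suc n)))
    where
    lem : ∀ m → + 1 + (m * + 1 - + 1) ≡ m
    lem = solve-∀
  product : ∀ i j → (upd L zero (δ zero) ⊗ Q) i j ≡ upd L zero (λ _ → + 1) i j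
  product zero j = trans (sum-δ zero (λ k → Q k j)) (lem (δ zero j))
    where
    lem : ∀ d → + 1 * (+ 1 - d) + d ≡ + 1
    lem = solve-∀
  product (suc i) j = trans (sum-cong (λ k → lem (L (suc i) k) (w j) (δ k j)))
    (trans (sum-+ (λ k → L (suc i) k * w j) (λ k → L (suc i) k * δ k j))
      (trans (cong₂ _+_ (trans (sum-*ʳ (w j) (L (suc i))) (cong (_* w j) (ZeroSums.rows zs (suc i)))) (sum-δʳ j (L (suc i))))
        (lem₂ (w j) (L (suc i) j))))
    where
    lem : ∀ l w d → l * (+ 1 * w + d) ≡ l * w + l * d
    lem = solve-∀
    lem₂ : ∀ w l → + 0 * w + l ≡ l
    lem₂ = solve-∀

-- All columns of tI + L sum to t, so row 0 may be replaced by the constant row t. The factor t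
-- comes out, and what remains is congruent modulo t to the determinant with a row of ones.
linear-coefficient : ∀ {n} {L : Fin (suc n) → Row (suc n)} → ZeroSums L → ∀ t →
  ∃ λ q → det (pencil δ L t (+ 1)) ≡ t * (+ suc n * det (pinned L) + t * q)
linear-coefficient {n} {L} zs t = q , (begin
  det P
    ≡⟨ sym (det-upd-ones P zero) ⟩
  det (upd P zero (λ c → sumFin (λ j → P j c)))
    -- The constant row is written as a one-term linear combination so that `det-upd-sum` extracts
    -- its factor.
    ≡⟨ det-upd-cong P zero {w = λ c → sumFin {1} (λ _ → t * + 1)} (λ c → trans (col c) (lem t)) ⟩
  det (upd P zero (λ c → sumFin {1} (λ _ → t * + 1)))
    ≡⟨ det-upd-sum {l = 1} P zero (λ _ → t) (λ _ _ → + 1) ⟩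
  t * det (upd P zero (λ _ → + 1)) + + 0
    ≡⟨ ℤₚ.+-identityʳ (t * det (upd P zero (λ _ → + 1))) ⟩
  t * det (upd P zero (λ _ → + 1))
    ≡⟨ cong (t *_) (trans (det-cong {suc n} {upd P zero (λ _ → + 1)} {pencil (upd L zero (λ _ → + 1)) (upd δ zero (λ _ → + 0)) (+ 1) t} (λ { zero c → lem₁ t ; (suc i) c → lem₂ t (δ (suc i) c) (L (suc i) c) })) (proj₂ dm)) ⟩
  t * (det (upd L zero (λ _ → + 1)) + t * q)
    ≡⟨ cong (λ d → t * (d + t * q)) (trans (det-ones-row zs) (cong (+ suc n *_) (sym (det-pinned zs)))) ⟩
  t * (+ suc n * det (pinned L) + t * q) ∎)
  where
  open ≡-Reasoning
  P = pencil δ L t (+ 1)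
  dm = det-mod (upd L zero (λ _ → + 1)) (upd δ zero (λ _ → + 0)) t
  q = proj₁ dm
  lem : ∀ t → t ≡ t * + 1 + + 0
  lem = solve-∀
  lem₁ : ∀ t → + 1 ≡ + 1 * + 1 + t * + 0
  lem₁ = solve-∀
  lem₂ : ∀ t d l → t * d + + 1 * l ≡ + 1 * l + t * d
  lem₂ = solve-∀
  lem₃ : ∀ t l → t * + 1 + + 1 * l ≡ t + l
  lem₃ = solve-∀
  col : ∀ c → sumFin (λ j → P j c) ≡ t
  col c = trans (sum-+ (λ j → t * δ j c) (λ j → + 1 * L j c))
    (trans (cong₂ _+_ (sum-δʳ c (λ _ → t)) (trans (sum-*ˡ (+ 1) (λ j → L j c)) (cong (+ 1 *_) (ZeroSums.columns zs c))))
      (ℤₚ.+-identityʳ t))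

cosp-pinned : ∀ {n} {L L′ : Fin (suc n) → Row (suc n)} → ZeroSums L → ZeroSums L′ → Cosp L L′ →
  det (pinned L) ≡ det (pinned L′)
cosp-pinned {n} {L} {L′} zs zs′ h = ℤₚ.*-cancelˡ-≡ N κ κ′ (ℤₚ.i-j≡0⇒i≡j (N * κ) (N * κ′)
  (multiple-of-all (N * κ - N * κ′) go))
  where
  N = + suc n
  κ = det (pinned L)
  κ′ = det (pinned L′)
  go : ∀ m → ∃ λ r → N * κ - N * κ′ ≡ + suc m * r
  go m = q′ - q , lem (N * κ) (N * κ′) t q q′ (ℤₚ.*-cancelˡ-≡ t (N * κ + t * q) (N * κ′ + t * q′)
      (trans (sym (proj₂ (linear-coefficient zs t))) (trans (det-eq h t (+ 1)) (proj₂ (linear-coefficient zs′ t)))))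
    where
    t = + suc m
    q = proj₁ (linear-coefficient zs t)
    q′ = proj₁ (linear-coefficient zs′ t)
    lem : ∀ a b t q q′ → a + t * q ≡ b + t * q′ → a - b ≡ t * (q′ - q)
    lem a b t q q′ e = trans (lem₁ a b (t * q)) (trans (cong (λ z → z - t * q - b) e) (lem₂ b t q q′))
      where
      lem₁ : ∀ a b x → a - b ≡ a + x - x - b
      lem₁ = solve-∀
      lem₂ : ∀ b t q q′ → b + t * q′ - t * q - b ≡ t * (q′ - q)
      lem₂ = solve-∀

-- The Laplacian of a graph

A : ∀ {n} → Graph n → Fin n → Row n
A G i j = b2ℤ (adj G i j)

A-sym : ∀ {n} (G : Graph n) i j → A G i j ≡ A G j i
A-sym G i j = cong b2ℤ (adj-sym G i j)

A-irrefl : ∀ {n} (G : Graph n) i → A G i i ≡ + 0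
A-irrefl G i = cong b2ℤ (irrefl G i)

b2ℤ-idem : ∀ b → b2ℤ b * b2ℤ b ≡ b2ℤ b
b2ℤ-idem true = refl
b2ℤ-idem false = refl

b2ℤ-nonneg : ∀ b → + 0 ≤ b2ℤ b
b2ℤ-nonneg true = +≤+ z≤n
b2ℤ-nonneg false = +≤+ z≤n

degree-nonneg : ∀ {n} (G : Graph n) i → + 0 ≤ degree G i
degree-nonneg G i = sum-nonneg (λ j → b2ℤ-nonneg (adj G i j))

closedWalks₃ : ∀ {n} → Graph n → ℤ
closedWalks₃ G = trace ((A G ⊗ A G) ⊗ A G)

L-entry : ∀ {n} (G : Graph n) i j → laplacian G i j ≡ degree G i * δ i j - A G i j
L-entry G i j = cong (_- A G i j) (δ-if i j (degree G i))

L-sym : ∀ {n} (G : Graph n) i j → laplacian G i j ≡ laplacian G j i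
L-sym G i j = trans (L-entry G i j) (trans (cong₂ _-_
    (trans (ℤₚ.*-comm (degree G i) (δ i j)) (trans (δ-subst i j (degree G))
      (trans (cong (_* degree G j) (δ-sym i j)) (ℤₚ.*-comm (δ j i) (degree G j)))))
    (A-sym G i j)) (sym (L-entry G j i)))

L-apply : ∀ {n} (G : Graph n) (f : Fin n → ℤ) i → sumFin (λ j → laplacian G i j * f j) ≡ sumFin (λ j → A G i j * (f i - f j))
L-apply G f i = begin
  sumFin (λ j → laplacian G i j * f j)
    ≡⟨ sum-cong (λ j → trans (cong (_* f j) (L-entry G i j)) (lem (degree G i) (δ i j) (A G i j) (f j))) ⟩
  sumFin (λ j → δ i j * (degree G i * f j) - A G i j * f j)
    ≡⟨ sum-minus (λ j → δ i j * (degree G i * f j)) (λ j → A G i j * f j) ⟩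
  sumFin (λ j → δ i j * (degree G i * f j)) - sumFin (λ j → A G i j * f j)
    ≡⟨ cong (_- sumFin (λ j → A G i j * f j)) (trans (sum-δ i (λ j → degree G i * f j)) (sym (sum-*ʳ (f i) (A G i)))) ⟩
  sumFin (λ j → A G i j * f i) - sumFin (λ j → A G i j * f j)
    ≡⟨ sym (sum-minus (λ j → A G i j * f i) (λ j → A G i j * f j)) ⟩
  sumFin (λ j → A G i j * f i - A G i j * f j)
    ≡⟨ sum-cong (λ j → sym (lem₂ (A G i j) (f i) (f j))) ⟩
  sumFin (λ j → A G i j * (f i - f j)) ∎
  where
  open ≡-Reasoning
  lem : ∀ d e a f → (d * e - a) * f ≡ e * (d * f) - a * f
  lem = solve-∀
  lem₂ : ∀ a x y → a * (x - y) ≡ a * x - a * y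
  lem₂ = solve-∀

L-ZeroSums : ∀ {n} (G : Graph n) → ZeroSums (laplacian G)
L-ZeroSums {n} G = record { rows = rows ; columns = λ j → trans (sum-cong (λ i → L-sym G i j)) (rows j) }
  where
  rows : ∀ i → sumFin (laplacian G i) ≡ + 0
  rows i = trans (sum-cong (λ j → sym (ℤₚ.*-identityʳ (laplacian G i j))))
    (trans (L-apply G (λ _ → + 1) i) (sum-zero (λ j → ℤₚ.*-zeroʳ (A G i j))))

charPoly-pencil : ∀ {n} (G : Graph n) x → charPolyL G x ≡ det (pencil δ (laplacian G) x (- + 1))
charPoly-pencil G x = det-cong (λ i j → trans (cong (_- laplacian G i j) (δ-if i j x)) (lem (x * δ i j) (laplacian G i j)))
  where
  lem : ∀ a b → a - b ≡ a + - + 1 * b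
  lem = solve-∀

charPoly-cosp : ∀ {n} (G H : Graph n) → (∀ x → charPolyL G x ≡ charPolyL H x) → Cosp (laplacian G) (laplacian H)
charPoly-cosp G H h = cosp-from-squares (laplacian G) (laplacian H)
  (λ t → trans (sym (charPoly-pencil G (square t))) (trans (h (square t)) (charPoly-pencil H (square t))))

trees : ∀ {n} → Graph (suc n) → ℤ
trees G = det (pinned (laplacian G))

module Traces {n} (G : Graph n) where
  private
    L = laplacian G
    d = degree G
    a = A G
    a² = A G ⊗ A G
  open ≡-Reasoning

  trace-L : trace L ≡ sumFin d
  trace-L = sum-cong (λ i → trans (L-entry G i i) (trans (cong₂ (λ x y → d i * x - y) (δ-refl i) (A-irrefl G i)) (lem (d i))))
    where
    lem : ∀ d → d * + 1 - + 0 ≡ d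
    lem = solve-∀

  a²-diag : ∀ i → a² i i ≡ d i
  a²-diag i = sum-cong (λ k → trans (cong (a i k *_) (A-sym G k i)) (b2ℤ-idem (adj G i k)))

  L²-entry : ∀ i j → (L ⊗ L) i j ≡ d i * d i * δ i j - (d i + d j) * a i j + a² i j
  L²-entry i j = begin
    sumFin (λ k → L i k * L k j)
      ≡⟨ sum-cong (λ k → trans (cong₂ _*_ (L-entry G i k) (L-entry G k j)) (lem (d i) (δ i k) (a i k) (d k) (δ k j) (a k j))) ⟩
    sumFin (λ k → δ i k * (d i * (d k * δ k j - a k j)) + (- (a i k * d k) * δ k j + a i k * a k j))
      ≡⟨ trans (sum-+ (λ k → δ i k * (d i * (d k * δ k j - a k j))) (λ k → - (a i k * d k) * δ k j + a i k * a k j))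
           (cong₂ _+_ (sum-δ i (λ k → d i * (d k * δ k j - a k j)))
             (trans (sum-+ (λ k → - (a i k * d k) * δ k j) (λ k → a i k * a k j)) (cong (_+ a² i j) (sum-δʳ j (λ k → - (a i k * d k)))))) ⟩
    d i * (d i * δ i j - a i j) + (- (a i j * d j) + a² i j)
      ≡⟨ lem₂ (d i) (δ i j) (a i j) (d j) (a² i j) ⟩
    d i * d i * δ i j - (d i + d j) * a i j + a² i j ∎
    where
    lem : ∀ d e a d′ e′ a′ → (d * e - a) * (d′ * e′ - a′) ≡ e * (d * (d′ * e′ - a′)) + (- (a * d′) * e′ + a * a′)
    lem = solve-∀
    lem₂ : ∀ d e a d′ s → d * (d * e - a) + (- (a * d′) + s) ≡ d * d * e - (d + d′) * a + s
    lem₂ = solve-∀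

  trace-L² : trace (L ⊗ L) ≡ sumFin (λ i → d i * d i) + sumFin d
  trace-L² = trans (sum-cong (λ i → trans (L²-entry i i)
      (trans (cong₂ (λ x y → d i * d i * x - (d i + d i) * y + a² i i) (δ-refl i) (A-irrefl G i))
        (trans (cong (_+_ (d i * d i * + 1 - (d i + d i) * + 0)) (a²-diag i)) (lem (d i))))))
    (sum-+ (λ i → d i * d i) d)
    where
    lem : ∀ d → d * d * + 1 - (d + d) * + 0 + d ≡ d * d + d
    lem = solve-∀

  -- Expansion of tr (D - A)³, where D is the degree matrix: the terms with a single `A` vanish by
  -- irreflexivity, and each of the three arrangements of D and two factors `A` has trace Σ d².
  trace-L³ : trace ((L ⊗ L) ⊗ L) ≡ sumFin (λ i → d i * d i * d i) + + 3 * sumFin (λ i → d i * d i) - closedWalks₃ G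
  trace-L³ = begin
    sumFin (λ i → sumFin (λ j → (L ⊗ L) i j * L j i))
      ≡⟨ sum-cong (λ i → trans (sum-cong (λ j → trans (cong₂ _*_ (L²-entry i j) (L-entry G j i))
           (lem (d i) (δ i j) (d j) (a i j) (a² i j) (δ j i) (a j i) (A-sym G j i) (δ-sym j i) (b2ℤ-idem (adj G i j)))))
           (row i)) ⟩
    sumFin (λ i → (d i * d i * d i + (d i * d i + d i * d i)) + (sumFin (λ j → a i j * d j) - ((a² ⊗ a) i i)))
      ≡⟨ trans (sum-+ (λ i → d i * d i * d i + (d i * d i + d i * d i)) (λ i → sumFin (λ j → a i j * d j) - (a² ⊗ a) i i))
           (cong₂ _+_ (trans (sum-+ (λ i → d i * d i * d i) (λ i → d i * d i + d i * d i)) (cong (_+_ (sumFin (λ i → d i * d i * d i))) (sum-+ (λ i → d i * d i) (λ i → d i * d i))))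
             (trans (sum-minus (λ i → sumFin (λ j → a i j * d j)) (λ i → (a² ⊗ a) i i)) (cong (_- closedWalks₃ G) swap))) ⟩
    S₃ + (S₂ + S₂) + (S₂ - closedWalks₃ G)
      ≡⟨ lem₂ S₃ S₂ (closedWalks₃ G) ⟩
    S₃ + + 3 * S₂ - closedWalks₃ G ∎
    where
    S₃ = sumFin (λ i → d i * d i * d i)
    S₂ = sumFin (λ i → d i * d i)
    lem₂ : ∀ x y w → x + (y + y) + (y - w) ≡ x + + 3 * y - w
    lem₂ = solve-∀
    lem : ∀ d e d′ a s e′ a′ → a′ ≡ a → e′ ≡ e → a * a ≡ a →
      (d * d * e - (d + d′) * a + s) * (d′ * e′ - a′) ≡
      e * (d * d * d′ * e - d * d * a - (d + d′) * a * d′ + s * d′) + ((d * a + a * d′) - s * a′)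
    lem d e d′ a s .e .a refl refl h = trans (lem₃ d e d′ a s) (cong (λ x → e * (d * d * d′ * e - d * d * a - (d + d′) * a * d′ + s * d′) + ((d + d′) * x - s * a)) h ∙ lem₄ d e d′ a s)
      where
      infixl 5 _∙_
      _∙_ : ∀ {x y z : ℤ} → x ≡ y → y ≡ z → x ≡ z
      _∙_ = trans
      lem₃ : ∀ d e d′ a s → (d * d * e - (d + d′) * a + s) * (d′ * e - a) ≡
        e * (d * d * d′ * e - d * d * a - (d + d′) * a * d′ + s * d′) + ((d + d′) * (a * a) - s * a)
      lem₃ = solve-∀
      lem₄ : ∀ d e d′ a s → e * (d * d * d′ * e - d * d * a - (d + d′) * a * d′ + s * d′) + ((d + d′) * a - s * a) ≡
        e * (d * d * d′ * e - d * d * a - (d + d′) * a * d′ + s * d′) + ((d * a + a * d′) - s * a)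
      lem₄ = solve-∀
    row : ∀ i → sumFin (λ j → δ i j * (d i * d i * d j * δ i j - d i * d i * a i j - (d i + d j) * a i j * d j + a² i j * d j) + ((d i * a i j + a i j * d j) - a² i j * a j i))
      ≡ (d i * d i * d i + (d i * d i + d i * d i)) + (sumFin (λ j → a i j * d j) - ((a² ⊗ a) i i))
    row i = trans (sum-+ (λ j → δ i j * F j) (λ j → (d i * a i j + a i j * d j) - a² i j * a j i))
      (trans (cong₂ _+_ (trans (sum-δ i F) (trans (cong₂ (λ x y → d i * d i * d i * x - d i * d i * y - (d i + d i) * y * d i + a² i i * d i) (δ-refl i) (A-irrefl G i))
              (trans (cong (λ x → d i * d i * d i * + 1 - d i * d i * + 0 - (d i + d i) * + 0 * d i + x * d i) (a²-diag i)) (lem₅ (d i)))))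
          (trans (sum-minus (λ j → d i * a i j + a i j * d j) (λ j → a² i j * a j i))
            (cong (_- (a² ⊗ a) i i) (trans (sum-+ (λ j → d i * a i j) (λ j → a i j * d j)) (cong (_+ sumFin (λ j → a i j * d j)) (sum-*ˡ (d i) (a i)))))))
        (lem₆ (d i * d i * d i) (d i * d i) (sumFin (λ j → a i j * d j)) ((a² ⊗ a) i i)))
      where
      F : Fin n → ℤ
      F j = d i * d i * d j * δ i j - d i * d i * a i j - (d i + d j) * a i j * d j + a² i j * d j
      lem₅ : ∀ d → d * d * d * + 1 - d * d * + 0 - (d + d) * + 0 * d + d * d ≡ d * d * d + d * d
      lem₅ = solve-∀
      lem₆ : ∀ c x y w → c + x + ((x + y) - w) ≡ (c + (x + x)) + (y - w)
      lem₆ = solve-∀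
    swap : sumFin (λ i → sumFin (λ j → a i j * d j)) ≡ S₂
    swap = trans (sum-swap (λ i j → a i j * d j)) (sum-cong (λ j → trans (sum-cong (λ i → cong (_* d j) (A-sym G i j))) (sum-*ʳ (d j) (a j))))

module _ {n} {G H : Graph n} (h : Cosp (laplacian G) (laplacian H)) where
  private
    module G = Traces G
    module H = Traces H

  cosp-Σd : sumFin (degree G) ≡ sumFin (degree H)
  cosp-Σd = trans (sym G.trace-L) (trans (cosp-trace h) H.trace-L)

  cosp-Σd² : sumFin (λ i → degree G i * degree G i) ≡ sumFin (λ i → degree H i * degree H i)
  cosp-Σd² = +-cancelʳ (sumFin (λ i → degree G i * degree G i)) (sumFin (λ i → degree H i * degree H i)) (sumFin (degree H))
    (trans (cong (_+_ (sumFin (λ i → degree G i * degree G i))) (sym cosp-Σd))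
      (trans (sym G.trace-L²) (trans (cosp-trace (cosp-square h)) H.trace-L²)))

  cosp-Σd³ : sumFin (λ i → degree G i * degree G i * degree G i) - closedWalks₃ G ≡
    sumFin (λ i → degree H i * degree H i * degree H i) - closedWalks₃ H
  cosp-Σd³ = lem (sumFin (λ i → degree G i * degree G i * degree G i)) (closedWalks₃ G) (sumFin (λ i → degree G i * degree G i))
      (sumFin (λ i → degree H i * degree H i * degree H i)) (closedWalks₃ H) (sumFin (λ i → degree H i * degree H i))
      cosp-Σd² (trans (sym G.trace-L³) (trans (cosp-trace³ h) H.trace-L³))
    where
    lem : ∀ c w s c′ w′ s′ → s ≡ s′ → c + + 3 * s - w ≡ c′ + + 3 * s′ - w′ → c - w ≡ c′ - w′
    lem c w s c′ w′ .s refl e = trans (lem₁ c w s) (trans (cong (_- + 3 * s) e) (sym (lem₁ c′ w′ s)))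
      where
      lem₁ : ∀ c w s → c - w ≡ c + + 3 * s - w - + 3 * s
      lem₁ = solve-∀

cosp-trees : ∀ {n} {G H : Graph (suc n)} → Cosp (laplacian G) (laplacian H) → trees G ≡ trees H
cosp-trees {G = G} {H} h = cosp-pinned (L-ZeroSums G) (L-ZeroSums H) h

-- Cofactors and connectedness

pinned-sym : ∀ {n} (G : Graph (suc n)) i j → pinned (laplacian G) i j ≡ pinned (laplacian G) j i
pinned-sym G i j = cong₂ _+_ (L-sym G i j) (ℤₚ.*-comm (δ zero i) (δ zero j))

cofactor : ∀ {n} → (Fin n → Row n) → Fin n → Row n
cofactor M i c = det (upd M i (δ c))

cofactor-inverse : ∀ {n} (M : Fin n → Row n) c j → sumFin (λ i → cofactor M i c * M i j) ≡ det M * δ c j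
cofactor-inverse M c j = cramer M (δ c) j

det-kernel : ∀ {n} (M : Fin n → Row n) (f : Fin n → ℤ) → (∀ i → sumFin (λ j → M i j * f j) ≡ + 0) → ∀ c → det M * f c ≡ + 0
det-kernel M f h c = begin
  det M * f c
    ≡⟨ sym (trans (sum-cong (λ j → lem (det M) (δ c j) (f j))) (sum-δ c (λ j → det M * f j))) ⟩
  sumFin (λ j → det M * δ c j * f j)
    ≡⟨ sum-cong (λ j → trans (cong (_* f j) (sym (cofactor-inverse M c j))) (sym (sum-*ʳ (f j) (λ i → cofactor M i c * M i j)))) ⟩
  sumFin (λ j → sumFin (λ i → cofactor M i c * M i j * f j))
    ≡⟨ sum-swap (λ j i → cofactor M i c * M i j * f j) ⟩
  sumFin (λ i → sumFin (λ j → cofactor M i c * M i j * f j))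
    ≡⟨ sum-zero (λ i → trans (sum-cong (λ j → ℤₚ.*-assoc (cofactor M i c) (M i j) (f j)))
         (trans (sum-*ˡ (cofactor M i c) (λ j → M i j * f j)) (trans (cong (cofactor M i c *_) (h i)) (ℤₚ.*-zeroʳ (cofactor M i c))))) ⟩
  + 0 ∎
  where
  open ≡-Reasoning
  lem : ∀ d e f → d * e * f ≡ e * (d * f)
  lem = solve-∀

Connected : ∀ {n} → Graph n → Set
Connected {n} G = (S : Fin n → Bool) → (∀ i j → S i ≡ true → adj G i j ≡ true → S j ≡ true) → ∀ {i} → S i ≡ true → ∀ j → S j ≡ true

-- The indicator of `S`, shifted to vanish at vertex 0, is constant along edges. So it lies in the
-- kernel of the pinned Laplacian and must be zero, which makes the indicator itself constant.
trees≢0⇒connected : ∀ {n} (G : Graph (suc n)) → trees G ≢ + 0 → Connected G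
trees≢0⇒connected {n} G T≢0 S closed {i} Si j = S-const j
  where
  g : Fin (suc n) → ℤ
  g j = b2ℤ (S j)
  f : Fin (suc n) → ℤ
  f j = g j - g zero
  edge : ∀ i j → A G i j * (f i - f j) ≡ + 0
  edge i j with adj G i j in eq
  ... | false = ℤₚ.*-zeroˡ (f i - f j)
  ... | true = trans (cong (λ b → + 1 * (b2ℤ b - g zero - (g j - g zero))) same) (lem (g j) (g zero))
    where
    lem : ∀ x z → + 1 * (x - z - (x - z)) ≡ + 0
    lem = solve-∀
    same : S i ≡ S j
    same with S i in ei | S j in ej
    ... | true | true = refl
    ... | false | false = refl
    ... | true | false = trans (sym (closed i j ei eq)) ej
    ... | false | true = trans (sym ei) (closed j i ej (trans (sym (adj-sym G i j)) eq))
  kernel : ∀ i → sumFin (λ j → pinned (laplacian G) i j * f j) ≡ + 0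
  kernel i = trans (sum-cong (λ j → lem (laplacian G i j) (δ zero i) (δ zero j) (f j)))
    (trans (sum-+ (λ j → laplacian G i j * f j) (λ j → δ zero j * (δ zero i * f j)))
      (trans (cong₂ _+_ (trans (L-apply G f i) (sum-zero (edge i)))
        (trans (sum-δ zero (λ j → δ zero i * f j)) (trans (cong (δ zero i *_) (ℤₚ.+-inverseʳ (g zero))) (ℤₚ.*-zeroʳ (δ zero i)))))
        refl))
    where
    lem : ∀ l a b f → (l + a * b) * f ≡ l * f + b * (a * f)
    lem = solve-∀
  f-zero : ∀ j → f j ≡ + 0
  f-zero j = *-nonzero T≢0 (det-kernel (pinned (laplacian G)) f kernel j)
  b2ℤ-inj : ∀ {a b} → b2ℤ a ≡ b2ℤ b → a ≡ b
  b2ℤ-inj {true} {true} e = refl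
  b2ℤ-inj {false} {false} e = refl
  S-const : ∀ j → S j ≡ true
  S-const j = trans (b2ℤ-inj (trans (ℤₚ.i-j≡0⇒i≡j (g j) (g zero) (f-zero j)) (sym (ℤₚ.i-j≡0⇒i≡j (g i) (g zero) (f-zero i))))) Si

-- Integral circulations

+-nonneg : ∀ {a b} → + 0 ≤ a → + 0 ≤ b → + 0 ≤ a + b
+-nonneg p q = ℤₚ.+-mono-≤ p q

*-nonneg : ∀ {a b} → + 0 ≤ a → + 0 ≤ b → + 0 ≤ a * b
*-nonneg {+ m} {+ n} _ _ = subst (+ 0 ≤_) (ℤₚ.pos-* m n) (+≤+ z≤n)

square-nonneg : ∀ a → + 0 ≤ a * a
square-nonneg (+ n) = *-nonneg {+ n} {+ n} (+≤+ z≤n) (+≤+ z≤n)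
square-nonneg (-[1+ n ]) = +≤+ z≤n

square≥1 : ∀ {a} → a ≢ + 0 → + 1 ≤ a * a
square≥1 {+ zero}  ne = ⊥-elim (ne refl)
square≥1 {+ suc n} ne = +≤+ (s≤s z≤n)
square≥1 { -[1+ n ]} ne = +≤+ (s≤s z≤n)

-- Inequalities are refuted by certificates: a combination of nonnegative quantities that the ring
-- solver identifies with a negative constant.
nonneg-absurd : ∀ {x} k → + 0 ≤ x → x ≡ -[1+ k ] → ⊥
nonneg-absurd k h refl with h
... | ()

diff-nonneg : ∀ {a b} → a ≤ b → + 0 ≤ b - a
diff-nonneg = ℤₚ.i≤j⇒0≤j-i

<⇒1≤diff : ∀ {a b} → a < b → + 0 ≤ b - a - + 1
<⇒1≤diff {a} {b} h = subst (+ 0 ≤_) (lem a b) (diff-nonneg (ℤₚ.i<j⇒suc[i]≤j h))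
  where
  lem : ∀ a b → b - (+ 1 + a) ≡ b - a - + 1
  lem = solve-∀

TriangleFree : ∀ {n} → Graph n → Set
TriangleFree G = ∀ x y z → adj G x y ≡ true → adj G y z ≡ true → adj G z x ≡ true → ⊥

true≢false : true ≢ false
true≢false ()

A-true : ∀ {n} (G : Graph n) {i j} → adj G i j ≡ true → A G i j ≡ + 1
A-true G e = cong b2ℤ e

adj-≢ : ∀ {n} (G : Graph n) {i j} → adj G i j ≡ true → i ≢ j
adj-≢ G {i} e refl = true≢false (trans (sym e) (irrefl G i))

adj-flip : ∀ {n} (G : Graph n) {i j} → adj G i j ≡ true → adj G j i ≡ true
adj-flip G {i} {j} e = trans (adj-sym G j i) e

sum-two : ∀ {n} (f : Fin n → ℤ) {p q} → p ≢ q → (∀ r → p ≢ r → q ≢ r → f r ≡ + 0) → sumFin f ≡ f p + f q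
sum-two f {p} {q} ne h = trans (sum-upd f p) (cong (_+_ (f p)) (trans (sum-upd g q)
    (trans (cong₂ _+_ (upd-other f (+ 0) ne) (sum-zero rest)) (ℤₚ.+-identityʳ (f q)))))
  where
  g = upd f p (+ 0)
  rest : ∀ r → upd g q (+ 0) r ≡ + 0
  rest r with q ≟ r | p ≟ r
  ... | yes refl | _ = upd-same g q (+ 0)
  ... | no qr | yes refl = trans (upd-other g (+ 0) qr) (upd-same f p (+ 0))
  ... | no qr | no pr = trans (upd-other g (+ 0) qr) (trans (upd-other f (+ 0) pr) (h r pr qr))

sum-zero-another : ∀ {n} (f : Fin n → ℤ) → sumFin f ≡ + 0 → ∀ {p} → f p ≢ + 0 → ∃ λ q → (p ≢ q) × (f q ≢ + 0)
sum-zero-another f e {p} ne = q , p≢q , λ z → gq (trans (upd-other f (+ 0) p≢q) z)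
  where
  g = upd f p (+ 0)
  found = sum-nonzero g (λ z → ne (trans (sym (trans (cong (_+_ (f p)) z) (ℤₚ.+-identityʳ (f p)))) (trans (sym (sum-upd f p)) e)))
  q = proj₁ found
  gq = proj₂ found
  p≢q : p ≢ q
  p≢q pq = gq (trans (cong g (sym pq)) (upd-same f p (+ 0)))

-- `T` times a Green function: column `c` of `C` is a potential whose current carries `T` units from
-- `c` to vertex 0. The circulations are derived from this equation, without reference to
-- determinants.
record Green {n} (H : Graph (suc n)) : Set where
  field
    T   : ℤ
    C   : Fin (suc n) → Row (suc n)
    L-C : ∀ j c → sumFin (λ i → A H j i * (C j c - C i c)) ≡ T * (δ c j - δ zero j)

module _ {n} (H : Graph (suc n)) where
  private
    L = laplacian H
    B = pinned L
    C = cofactor B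
    a = A H
    T = trees H
  open ≡-Reasoning

  C-inverse : ∀ j c → sumFin (λ i → B j i * C i c) ≡ T * δ c j
  C-inverse j c = trans (sum-cong (λ i → trans (ℤₚ.*-comm (B j i) (C i c)) (cong (C i c *_) (pinned-sym H j i))))
    (cofactor-inverse B c j)

  -- Sum `C-inverse` over the rows: the column sums of the pinned matrix are `δ zero`.
  C-row₀ : ∀ c → C zero c ≡ T
  C-row₀ c = begin
    C zero c
      ≡⟨ sym (sum-δ zero (λ i → C i c)) ⟩
    sumFin (λ i → δ zero i * C i c)
      ≡⟨ sum-cong (λ i → trans (cong (_* C i c) (sym (pinned-column-sum (L-ZeroSums H) i))) (sym (sum-*ʳ (C i c) (λ j → B j i)))) ⟩
    sumFin (λ i → sumFin (λ j → B j i * C i c))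
      ≡⟨ sum-swap (λ i j → B j i * C i c) ⟩
    sumFin (λ j → sumFin (λ i → B j i * C i c))
      ≡⟨ sum-cong (λ j → C-inverse j c) ⟩
    sumFin (λ j → T * δ c j)
      ≡⟨ trans (sum-*ˡ T (δ c)) (trans (cong (T *_) (sum-δ1 c)) (ℤₚ.*-identityʳ T)) ⟩
    T ∎

  L-cofactor : ∀ j c → sumFin (λ i → a j i * (C j c - C i c)) ≡ T * (δ c j - δ zero j)
  L-cofactor j c = trans (sym (L-apply H (λ i → C i c) j)) (lem₁ (sumFin (λ i → L j i * C i c)) (δ zero j) T (δ c j) (begin
    sumFin (λ i → L j i * C i c) + δ zero j * T
      ≡⟨ cong (_+_ (sumFin (λ i → L j i * C i c))) (trans (cong (δ zero j *_) (sym (C-row₀ c))) (sym (sum-δ zero (λ i → δ zero j * C i c)))) ⟩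
    sumFin (λ i → L j i * C i c) + sumFin (λ i → δ zero i * (δ zero j * C i c))
      ≡⟨ sym (sum-+ (λ i → L j i * C i c) (λ i → δ zero i * (δ zero j * C i c))) ⟩
    sumFin (λ i → L j i * C i c + δ zero i * (δ zero j * C i c))
      ≡⟨ sum-cong (λ i → lem₂ (L j i) (C i c) (δ zero i) (δ zero j)) ⟩
    sumFin (λ i → B j i * C i c)
      ≡⟨ C-inverse j c ⟩
    T * δ c j ∎))
    where
    lem₂ : ∀ l c e d → l * c + e * (d * c) ≡ (l + d * e) * c
    lem₂ = solve-∀
    lem₁ : ∀ s d t e → s + d * t ≡ t * e → s ≡ t * (e - d)
    lem₁ s d t e h = trans (lem₃ s d t) (trans (cong (_- d * t) h) (lem₄ t e d))
      where
      lem₃ : ∀ s d t → s ≡ s + d * t - d * t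
      lem₃ = solve-∀
      lem₄ : ∀ t e d → t * e - d * t ≡ t * (e - d)
      lem₄ = solve-∀

  green : Green H
  green = record { T = T ; C = C ; L-C = L-cofactor }

  -- The product of Cᵀ, the symmetric pinned matrix and C is evaluated from either side; each way
  -- gives `T` times an entry of `C`.
  cofactor-sym : T ≢ + 0 → ∀ i j → C i j ≡ C j i
  cofactor-sym T≢0 i j = ℤₚ.i-j≡0⇒i≡j (C i j) (C j i) (*-nonzero T≢0 (trans (lem T (C i j) (C j i)) (ℤₚ.i≡j⇒i-j≡0 (begin
    T * C i j
      ≡⟨ sym (trans (sum-cong (λ l → lem₂ T (δ i l) (C l j))) (sum-δ i (λ l → T * C l j))) ⟩
    sumFin (λ l → T * δ i l * C l j)
      ≡⟨ sum-cong (λ l → trans (cong (_* C l j) (sym (cofactor-inverse B i l))) (sym (sum-*ʳ (C l j) (λ k → C k i * B k l)))) ⟩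
    sumFin (λ l → sumFin (λ k → C k i * B k l * C l j))
      ≡⟨ sum-swap (λ l k → C k i * B k l * C l j) ⟩
    sumFin (λ k → sumFin (λ l → C k i * B k l * C l j))
      ≡⟨ sum-cong (λ k → trans (sum-cong (λ l → ℤₚ.*-assoc (C k i) (B k l) (C l j))) (trans (sum-*ˡ (C k i) (λ l → B k l * C l j)) (cong (C k i *_) (C-inverse k j)))) ⟩
    sumFin (λ k → C k i * (T * δ j k))
      ≡⟨ trans (sum-cong (λ k → lem₃ (C k i) T (δ j k))) (sum-δ j (λ k → T * C k i)) ⟩
    T * C j i ∎))))
    where
    lem : ∀ t x y → t * (x - y) ≡ t * x - t * y
    lem = solve-∀
    lem₂ : ∀ t d c → t * d * c ≡ d * (t * c)
    lem₂ = solve-∀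
    lem₃ : ∀ c t d → c * (t * d) ≡ d * (t * c)
    lem₃ = solve-∀

-- For an edge uv, `flow u v` is T times the orthogonal projection of the edge onto the cycle space:
-- it is an integral circulation, and `res u v` counts the spanning trees avoiding uv.
module Circulation {n} {H : Graph (suc n)} (G : Green H) where
  open Green G public
  private
    V = Fin (suc n)
    a = A H
  open ≡-Reasoning

  -- The potential that drives `T` units of current from `u` to `v`; the contributions at vertex 0
  -- cancel in the difference.
  pot : V → V → V → ℤ
  pot u v i = C i u - C i v

  flow : V → V → V → V → ℤ
  flow u v x y = T * (δ u x * δ v y - δ v x * δ u y) - a x y * (pot u v x - pot u v y)

  res : V → V → ℤ
  res u v = T - (pot u v u - pot u v v)

  flow-conserved : ∀ u v x → sumFin (flow u v x) ≡ + 0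
  flow-conserved u v x = begin
    sumFin (flow u v x)
      ≡⟨ sum-cong (λ y → lem T (δ u x) (δ v y) (δ v x) (δ u y) (a x y) (C x u) (C x v) (C y u) (C y v)) ⟩
    sumFin (λ y → δ v y * (T * δ u x) - δ u y * (T * δ v x) - (a x y * (C x u - C y u) - a x y * (C x v - C y v)))
      ≡⟨ trans (sum-minus (λ y → δ v y * (T * δ u x) - δ u y * (T * δ v x)) (λ y → a x y * (C x u - C y u) - a x y * (C x v - C y v)))
           (cong₂ _-_ (sum-minus (λ y → δ v y * (T * δ u x)) (λ y → δ u y * (T * δ v x)))
             (sum-minus (λ y → a x y * (C x u - C y u)) (λ y → a x y * (C x v - C y v)))) ⟩
    sumFin (λ y → δ v y * (T * δ u x)) - sumFin (λ y → δ u y * (T * δ v x)) -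
      (sumFin (λ y → a x y * (C x u - C y u)) - sumFin (λ y → a x y * (C x v - C y v)))
      ≡⟨ cong₂ _-_ (cong₂ _-_ (sum-δ v (λ _ → T * δ u x)) (sum-δ u (λ _ → T * δ v x))) (cong₂ _-_ (L-C x u) (L-C x v)) ⟩
    T * δ u x - T * δ v x - (T * (δ u x - δ zero x) - T * (δ v x - δ zero x))
      ≡⟨ lem₂ T (δ u x) (δ v x) (δ zero x) ⟩
    + 0 ∎
    where
    lem : ∀ t ux vy vx uy a xu xv yu yv →
      t * (ux * vy - vx * uy) - a * (xu - xv - (yu - yv)) ≡ vy * (t * ux) - uy * (t * vx) - (a * (xu - yu) - a * (xv - yv))
    lem = solve-∀
    lem₂ : ∀ t p q z → t * p - t * q - (t * (p - z) - t * (q - z)) ≡ + 0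
    lem₂ = solve-∀

  flow-anti : ∀ u v x y → flow u v y x ≡ - flow u v x y
  flow-anti u v x y = trans (cong (λ e → T * (δ u y * δ v x - δ v y * δ u x) - e * (pot u v y - pot u v x)) (A-sym H y x))
    (lem T (δ u x) (δ v y) (δ v x) (δ u y) (a x y) (pot u v x) (pot u v y))
    where
    lem : ∀ t ux vy vx uy a p q → t * (uy * vx - vy * ux) - a * (q - p) ≡ - (t * (ux * vy - vx * uy) - a * (p - q))
    lem = solve-∀

  flow-nonadjacent : ∀ {u v} → adj H u v ≡ true → ∀ {x y} → adj H x y ≡ false → flow u v x y ≡ + 0
  flow-nonadjacent {u} {v} uv {x} {y} e = trans (cong₂ (λ p q → T * p - q * (pot u v x - pot u v y)) (ends (u ≟ x) (v ≟ y) (v ≟ x) (u ≟ y)) (cong b2ℤ e))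
      (lem T (pot u v x - pot u v y))
    where
    lem : ∀ t p → t * + 0 - + 0 * p ≡ + 0
    lem = solve-∀
    product : ∀ {u v x y : V} → adj H u v ≡ true → adj H x y ≡ false → Dec (u ≡ x) → Dec (v ≡ y) → δ u x * δ v y ≡ + 0
    product uv e (yes refl) (yes refl) = ⊥-elim (true≢false (trans (sym uv) e))
    product {u} {v} {x} {y} uv e (no ne) _ = trans (cong (_* δ v y) (δ-≢ ne)) (ℤₚ.*-zeroˡ (δ v y))
    product {u} {v} {x} {y} uv e (yes _) (no ne) = trans (cong (δ u x *_) (δ-≢ ne)) (ℤₚ.*-zeroʳ (δ u x))
    ends : Dec (u ≡ x) → Dec (v ≡ y) → Dec (v ≡ x) → Dec (u ≡ y) → δ u x * δ v y - δ v x * δ u y ≡ + 0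
    ends p q r s = cong₂ _-_ (product uv e p q) (product (adj-flip H uv) e r s)

  flow-adjacent : ∀ {u v} → adj H u v ≡ true → ∀ {x y} → flow u v x y ≢ + 0 → adj H x y ≡ true
  flow-adjacent {u} {v} uv {x} {y} ne = go (adj H x y) refl
    where
    go : ∀ b → adj H x y ≡ b → adj H x y ≡ true
    go true e = e
    go false e = ⊥-elim (ne (flow-nonadjacent uv e))

  flow-self : ∀ {u v} → adj H u v ≡ true → flow u v u v ≡ res u v
  flow-self {u} {v} uv = trans
    (cong₂ (λ p q → T * p - q * (pot u v u - pot u v v))
      (cong₂ _-_ (cong₂ _*_ (δ-refl u) (δ-refl v)) (cong₂ _*_ (δ-≢ (λ e → adj-≢ H uv (sym e))) (δ-≢ (adj-≢ H uv))))
      (A-true H uv))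
    (lem T (pot u v u - pot u v v))
    where
    lem : ∀ t p → t * (+ 1 * + 1 - + 0 * + 0) - + 1 * p ≡ t - p
    lem = solve-∀

  -- A circulation is orthogonal to potential differences, so its square norm reduces to `T` times
  -- its value on uv. The 2 accounts for both orientations of each edge.
  flow-norm : ∀ {u v} → adj H u v ≡ true →
    sumFin (λ x → sumFin (λ y → flow u v x y * flow u v x y)) ≡ + 2 * (T * res u v)
  flow-norm {u} {v} uv = begin
    sumFin (λ x → sumFin (λ y → φ x y * φ x y))
      ≡⟨ sum-cong (λ x → sum-cong (λ y → trans (φ-edge x y) (lem T (δ u x) (δ v y) (δ v x) (δ u y) (φ x y) (p x) (p y)))) ⟩
    sumFin (λ x → sumFin (λ y → (δ v y * (T * δ u x * φ x y) - δ u y * (T * δ v x * φ x y)) - (p x * φ x y - p y * φ x y)))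
      ≡⟨ sum-cong (λ x → trans (sum-minus (λ y → δ v y * (T * δ u x * φ x y) - δ u y * (T * δ v x * φ x y)) (λ y → p x * φ x y - p y * φ x y))
           (cong₂ _-_ (trans (sum-minus (λ y → δ v y * (T * δ u x * φ x y)) (λ y → δ u y * (T * δ v x * φ x y)))
               (cong₂ _-_ (trans (sum-δ v (λ y → T * δ u x * φ x y)) (lem₂ T (δ u x) (φ x v))) (trans (sum-δ u (λ y → T * δ v x * φ x y)) (lem₂ T (δ v x) (φ x u)))))
             (trans (sum-minus (λ y → p x * φ x y) (λ y → p y * φ x y)) (cong (_- sumFin (λ y → p y * φ x y))
               (trans (sum-*ˡ (p x) (φ x)) (trans (cong (p x *_) (flow-conserved u v x)) (ℤₚ.*-zeroʳ (p x)))))))) ⟩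
    sumFin (λ x → (δ u x * (T * φ x v) - δ v x * (T * φ x u)) - (+ 0 - sumFin (λ y → p y * φ x y)))
      ≡⟨ trans (sum-minus (λ x → δ u x * (T * φ x v) - δ v x * (T * φ x u)) (λ x → + 0 - sumFin (λ y → p y * φ x y)))
           (cong₂ _-_ (trans (sum-minus (λ x → δ u x * (T * φ x v)) (λ x → δ v x * (T * φ x u))) (cong₂ _-_ (sum-δ u (λ x → T * φ x v)) (sum-δ v (λ x → T * φ x u))))
             (trans (sum-minus (λ _ → + 0) (λ x → sumFin (λ y → p y * φ x y))) (cong₂ _-_ (sum-0 (suc n)) columns))) ⟩
    (T * φ u v - T * φ v u) - (+ 0 - + 0)
      ≡⟨ cong₂ (λ s t → (T * s - T * t) - (+ 0 - + 0)) (flow-self uv) (trans (flow-anti u v u v) (cong -_ (flow-self uv))) ⟩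
    (T * res u v - T * - res u v) - (+ 0 - + 0)
      ≡⟨ lem₃ T (res u v) ⟩
    + 2 * (T * res u v) ∎
    where
    φ = flow u v
    p = pot u v
    lem : ∀ t ux vy vx uy f p q → t * (ux * vy - vx * uy) * f - f * (p - q) ≡ (vy * (t * ux * f) - uy * (t * vx * f)) - (p * f - q * f)
    lem = solve-∀
    lem₂ : ∀ t d f → t * d * f ≡ d * (t * f)
    lem₂ = solve-∀
    lem₃ : ∀ t r → (t * r - t * - r) - (+ 0 - + 0) ≡ + 2 * (t * r)
    lem₃ = solve-∀
    φ-edge : ∀ x y → φ x y * φ x y ≡ T * (δ u x * δ v y - δ v x * δ u y) * φ x y - φ x y * (p x - p y)
    φ-edge x y = go (adj H x y) refl
      where
      lem₄ : ∀ t p f → f ≡ t - + 1 * p → f * f ≡ t * f - f * p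
      lem₄ t p f e = trans (cong (_* f) e) (lem₅ t p f)
        where
        lem₅ : ∀ t p f → (t - + 1 * p) * f ≡ t * f - f * p
        lem₅ = solve-∀
      lem₆ : ∀ t p → + 0 * + 0 ≡ t * + 0 - + 0 * p
      lem₆ = solve-∀
      go : ∀ b → adj H x y ≡ b → φ x y * φ x y ≡ T * (δ u x * δ v y - δ v x * δ u y) * φ x y - φ x y * (p x - p y)
      go true e = lem₄ (T * (δ u x * δ v y - δ v x * δ u y)) (p x - p y) (φ x y)
        (cong (λ q → T * (δ u x * δ v y - δ v x * δ u y) - q * (p x - p y)) (A-true H e))
      go false e = trans (cong (λ f → f * f) z) (trans (lem₆ (T * (δ u x * δ v y - δ v x * δ u y)) (p x - p y))
          (cong (λ f → T * (δ u x * δ v y - δ v x * δ u y) * f - f * (p x - p y)) (sym z)))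
        where z = flow-nonadjacent uv e
    columns : sumFin (λ x → sumFin (λ y → p y * φ x y)) ≡ + 0
    columns = trans (sum-swap (λ x y → p y * φ x y)) (sum-zero (λ y → trans (sum-*ˡ (p y) (λ x → φ x y))
      (trans (cong (p y *_) (trans (sum-cong (λ x → flow-anti u v y x)) (trans (sum-neg (φ y)) (cong -_ (flow-conserved u v y))))) (ℤₚ.*-zeroʳ (p y)))))

  -- Foster's theorem, that effective resistances over all edges sum to one less than the number of
  -- vertices, multiplied by `T` and counted in both orientations.
  res-total : sumFin (λ u → sumFin (λ v → a u v * res u v)) ≡ T * sumFin (degree H) - + 2 * (T * + n)
  res-total = begin
    sumFin (λ u → sumFin (λ v → a u v * res u v))
      ≡⟨ sum-cong (λ u → trans (sum-cong (λ v → lem (a u v) T (C u u) (C u v) (C v u) (C v v)))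
           (trans (sum-minus (λ v → T * a u v) (λ v → a u v * (C u u - C v u) + a u v * (C v v - C u v)))
             (cong₂ _-_ (sum-*ˡ T (a u)) (sum-+ (λ v → a u v * (C u u - C v u)) (λ v → a u v * (C v v - C u v)))))) ⟩
    sumFin (λ u → T * degree H u - (X u + sumFin (λ v → a u v * (C v v - C u v))))
      ≡⟨ trans (sum-minus (λ u → T * degree H u) (λ u → X u + sumFin (λ v → a u v * (C v v - C u v))))
           (cong₂ _-_ (sum-*ˡ T (degree H)) (sum-+ X (λ u → sumFin (λ v → a u v * (C v v - C u v))))) ⟩
    T * sumFin (degree H) - (sumFin X + sumFin (λ u → sumFin (λ v → a u v * (C v v - C u v))))
      ≡⟨ cong (λ s → T * sumFin (degree H) - (sumFin X + s)) (trans (sum-swap (λ u v → a u v * (C v v - C u v)))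
           (sum-cong (λ v → sum-cong (λ u → cong (_* (C v v - C u v)) (A-sym H u v))))) ⟩
    T * sumFin (degree H) - (sumFin X + sumFin X)
      ≡⟨ cong (λ s → T * sumFin (degree H) - (s + s)) X-sum ⟩
    T * sumFin (degree H) - (T * + n + T * + n)
      ≡⟨ lem₂ (T * sumFin (degree H)) (T * + n) ⟩
    T * sumFin (degree H) - + 2 * (T * + n) ∎
    where
    X : V → ℤ
    X u = sumFin (λ v → a u v * (C u u - C v u))
    lem : ∀ a t uu uv vu vv → a * (t - (uu - uv - (vu - vv))) ≡ t * a - (a * (uu - vu) + a * (vv - uv))
    lem = solve-∀
    lem₂ : ∀ s x → s - (x + x) ≡ s - + 2 * x
    lem₂ = solve-∀
    lem₃ : ∀ m → + 1 + m - + 1 ≡ m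
    lem₃ = solve-∀
    X-sum : sumFin X ≡ T * + n
    X-sum = trans (sum-cong (λ u → trans (L-C u u) (cong (λ e → T * (e - δ zero u)) (δ-refl u))))
      (trans (sum-*ˡ T (λ u → + 1 - δ {suc n} zero u)) (cong (T *_) (trans (sum-minus (λ _ → + 1) (δ {suc n} zero))
        (trans (cong₂ _-_ (trans (sum-const (suc n) (+ 1)) (ℤₚ.*-identityʳ (+ suc n))) (sum-δ1 {suc n} zero)) (lem₃ (+ n))))))

  flow-another : ∀ u v {x q} → flow u v x q ≢ + 0 → ∃ λ q′ → (q ≢ q′) × (flow u v x q′ ≢ + 0)
  flow-another u v {x} ne = sum-zero-another (flow u v x) (flow-conserved u v x) ne

  flow-anti-≢ : ∀ u v {x y} → flow u v x y ≢ + 0 → flow u v y x ≢ + 0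
  flow-anti-≢ u v {x} {y} ne e = ne (trans (flow-anti u v y x) (cong -_ e))

  energy : V → V → V → ℤ
  energy u v x = sumFin (λ y → flow u v x y * flow u v x y)

  energy-nonneg : ∀ u v x → + 0 ≤ energy u v x
  energy-nonneg u v x = sum-nonneg (λ y → square-nonneg (flow u v x y))

  energy-two : ∀ u v x {p q} → p ≢ q → flow u v x p * flow u v x p + flow u v x q * flow u v x q ≤ energy u v x
  energy-two u v x ne = sum≥2 (λ y → square-nonneg (flow u v x y)) ne

  energy≥2 : ∀ u v {x p} → flow u v x p ≢ + 0 → + 2 ≤ energy u v x
  energy≥2 u v {x} ne = ℤₚ.≤-trans (ℤₚ.+-mono-≤ (square≥1 ne) (square≥1 (proj₂ (proj₂ other)))) (energy-two u v x (proj₁ (proj₂ other)))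
    where other = flow-another u v ne

  -- Around an edge uv of the support: a path x, u, v, y on four distinct vertices whose outer edges
  -- carry flow too. These four vertices suffice for the norm estimates.
  record Square (u v : V) : Set where
    field
      {x y}  : V
      ux-flow : flow u v u x ≢ + 0
      vy-flow : flow u v v y ≢ + 0
      v≢x : v ≢ x
      u≢y : u ≢ y
      u≢v : u ≢ v
      u≢x : u ≢ x
      v≢y : v ≢ y
      x≢y : x ≢ y

  -- Conservation at `u` and at `v` supplies a second flow edge at each; if their far ends
  -- coincided, they would close a triangle with uv.
  square-around : TriangleFree H → ∀ {u v} → adj H u v ≡ true → res u v ≢ + 0 → Square u v
  square-around tf {u} {v} uv r≢0 = record
    { ux-flow = proj₂ (proj₂ X) ; vy-flow = proj₂ (proj₂ Y) ; v≢x = proj₁ (proj₂ X) ; u≢y = proj₁ (proj₂ Y)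
    ; u≢v = adj-≢ H uv ; u≢x = adj-≢ H ux ; v≢y = adj-≢ H vy
    ; x≢y = λ e → tf u v (proj₁ Y) uv vy (subst (λ z → adj H z u ≡ true) e (adj-flip H ux)) }
    where
    uv-flow : flow u v u v ≢ + 0
    uv-flow e = r≢0 (trans (sym (flow-self uv)) e)
    X = flow-another u v uv-flow
    Y = flow-another u v (flow-anti-≢ u v uv-flow)
    ux = flow-adjacent uv (proj₂ (proj₂ X))
    vy = flow-adjacent uv (proj₂ (proj₂ Y))

  res-edge : sumFin (λ u → sumFin (λ v → a u v * res u v)) ≢ + 0 → ∃ λ u → ∃ λ v → (adj H u v ≡ true) × (res u v ≢ + 0)
  res-edge ne = u , v , go (adj H u v) refl (proj₂ V₁)
    where
    U = sum-nonzero (λ u → sumFin (λ v → a u v * res u v)) ne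
    u = proj₁ U
    V₁ = sum-nonzero (λ v → a u v * res u v) (proj₂ U)
    v = proj₁ V₁
    go : ∀ b → adj H u v ≡ b → a u v * res u v ≢ + 0 → (adj H u v ≡ true) × (res u v ≢ + 0)
    go true e h = e , λ z → h (trans (cong (a u v *_) z) (ℤₚ.*-zeroʳ (a u v)))
    go false e h = ⊥-elim (h (trans (cong (λ b → b2ℤ b * res u v) e) (ℤₚ.*-zeroˡ (res u v))))

  square-energy : ∀ {u v} → adj H u v ≡ true → (sq : Square u v) →
    energy u v u + (energy u v v + (energy u v (Square.x sq) + energy u v (Square.y sq))) ≤ + 2 * (T * res u v)
  square-energy {u} {v} uv sq = subst (energy u v u + (energy u v v + (energy u v x + energy u v y)) ≤_) (flow-norm uv) (sum≥4 (energy-nonneg u v) u≢v u≢x u≢y v≢x v≢y x≢y)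
    where open Square sq

  flow-self² : ∀ {u v} → adj H u v ≡ true → flow u v u v * flow u v u v ≡ res u v * res u v
  flow-self² uv = cong (λ r → r * r) (flow-self uv)

  flow-back² : ∀ {u v} → adj H u v ≡ true → flow u v v u * flow u v v u ≡ res u v * res u v
  flow-back² {u} {v} uv = trans (cong (λ r → r * r) (trans (flow-anti u v u v) (cong -_ (flow-self uv)))) (lem (res u v))
    where
    lem : ∀ r → - r * - r ≡ r * r
    lem = solve-∀

  -- With as many edges as vertices, Foster's sum is 2T > 0, so some edge has ρ = `res` nonzero. The
  -- four vertices around it contribute at least 2(ρ² + 1) + 2 + 2 to the norm 2Tρ. Thus ρ² + 3 ≤
  -- Tρ, which fails for T ≤ 3.
  unicyclic-trees≥4 : TriangleFree H → sumFin (degree H) ≡ + 2 * + suc n → + 0 < T → + 4 ≤ T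
  unicyclic-trees≥4 tf Σd T>0 = go (+ 4 ℤₚ.≤? T)
    where
    total : sumFin (λ u → sumFin (λ v → a u v * res u v)) ≢ + 0
    total e = ℤₚ.<-irrefl (sym (*-nonzero {+ 2} {T} (λ ()) (trans (sym sum≡2T) e))) T>0
      where
      lem : ∀ t n → t * (+ 2 * (+ 1 + n)) - + 2 * (t * n) ≡ + 2 * t
      lem = solve-∀
      sum≡2T : sumFin (λ u → sumFin (λ v → a u v * res u v)) ≡ + 2 * T
      sum≡2T = trans res-total (trans (cong (λ s → T * s - + 2 * (T * + n)) Σd) (lem T (+ n)))
    E = res-edge total
    u = proj₁ E
    v = proj₁ (proj₂ E)
    uv = proj₁ (proj₂ (proj₂ E))
    ρ = res u v
    sq = square-around tf uv (proj₂ (proj₂ (proj₂ E)))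
    open Square sq
    bound : ρ * ρ + + 1 + (ρ * ρ + + 1 + (+ 2 + + 2)) ≤ + 2 * (T * ρ)
    bound = ℤₚ.≤-trans (ℤₚ.+-mono-≤
        (ℤₚ.≤-trans (ℤₚ.+-mono-≤ (ℤₚ.≤-reflexive (sym (flow-self² uv))) (square≥1 ux-flow)) (energy-two u v u v≢x))
        (ℤₚ.+-mono-≤ (ℤₚ.≤-trans (ℤₚ.+-mono-≤ (ℤₚ.≤-reflexive (sym (flow-back² uv))) (square≥1 vy-flow)) (energy-two u v v u≢y))
          (ℤₚ.+-mono-≤ (energy≥2 u v (flow-anti-≢ u v ux-flow)) (energy≥2 u v (flow-anti-≢ u v vy-flow)))))
      (square-energy uv sq)
    ρ≥0 : + 0 ≤ ρ
    ρ≥0 = pos (+ 0 ℤₚ.≤? ρ)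
      where
      lem : ∀ t r → + 2 * ((t - + 0 - + 1) * (+ 0 - r - + 1)) + (+ 2 * (t - + 0 - + 1) + (+ 2 * (+ 0 - r - + 1) + (+ 2 * (r * r) + (+ 2 * (t * r) - (r * r + + 1 + (r * r + + 1 + (+ 2 + + 2))))))) ≡ -[1+ 7 ]
      lem = solve-∀
      pos : Dec (+ 0 ≤ ρ) → + 0 ≤ ρ
      pos (yes p) = p
      pos (no np) = ⊥-elim (nonneg-absurd 7 (+-nonneg (*-nonneg {+ 2} (+≤+ z≤n) (*-nonneg t≥ r<)) (+-nonneg (*-nonneg {+ 2} (+≤+ z≤n) t≥)
          (+-nonneg (*-nonneg {+ 2} (+≤+ z≤n) r<) (+-nonneg (*-nonneg {+ 2} (+≤+ z≤n) (square-nonneg ρ)) (diff-nonneg bound))))) (lem T ρ))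
        where
        r< = <⇒1≤diff (ℤₚ.≰⇒> np)
        t≥ = <⇒1≤diff T>0
    go : Dec (+ 4 ≤ T) → + 4 ≤ T
    go (yes p) = p
    -- The first summand replaces T by 3; the square comes from 4(ρ² - 3ρ + 3) = (2ρ - 3)² + 3.
    go (no np) = ⊥-elim (nonneg-absurd 2 (+-nonneg (*-nonneg {+ 4} (+≤+ z≤n) (*-nonneg (<⇒1≤diff (ℤₚ.≰⇒> np)) ρ≥0))
        (+-nonneg (*-nonneg {+ 2} (+≤+ z≤n) (diff-nonneg bound)) (square-nonneg (+ 2 * ρ - + 3)))) (lem T ρ))
      where
      lem : ∀ t r → + 4 * ((+ 4 - t - + 1) * r) + (+ 2 * (+ 2 * (t * r) - (r * r + + 1 + (r * r + + 1 + (+ 2 + + 2)))) + (+ 2 * r - + 3) * (+ 2 * r - + 3)) ≡ -[1+ 2 ]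
      lem = solve-∀

  -- `C-sym` makes the projection self-adjoint. `res≥4` is supplied by the unicyclic bound for H
  -- minus an edge: an edge is either a bridge or avoided by at least four spanning trees.
  module Bicyclic (tf : TriangleFree H)
    (C-sym : ∀ i j → C i j ≡ C j i)
    (res≥4 : ∀ {u v} → adj H u v ≡ true → res u v ≡ + 0 ⊎ + 4 ≤ res u v) where

    flow-sym : ∀ {u v x y} → adj H u v ≡ true → adj H x y ≡ true → flow u v x y ≡ flow x y u v
    flow-sym {u} {v} {x} {y} uv xy = trans
      (cong₂ (λ p q → T * p - q * (pot u v x - pot u v y))
        (cong₂ _-_ (cong₂ _*_ (δ-sym u x) (δ-sym v y)) (trans (ℤₚ.*-comm (δ v x) (δ u y)) (cong₂ _*_ (δ-sym u y) (δ-sym v x))))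
        (trans (A-true H xy) (sym (A-true H uv))))
      (cong (λ p → T * (δ x u * δ y v - δ y u * δ x v) - a u v * p)
        (trans (cong₂ _-_ (cong₂ _-_ (C-sym x u) (C-sym x v)) (cong₂ _-_ (C-sym y u) (C-sym y v))) (lem (C u x) (C v x) (C u y) (C v y))))
      where
      lem : ∀ ux vx uy vy → ux - vx - (uy - vy) ≡ ux - uy - (vx - vy)
      lem = solve-∀

    res-nonneg : ∀ {u v} → adj H u v ≡ true → + 0 ≤ res u v
    res-nonneg uv = go (res≥4 uv)
      where
      go : _ → _
      go (inj₁ e) = ℤₚ.≤-reflexive (sym e)
      go (inj₂ p) = ℤₚ.≤-trans (+≤+ z≤n) p

    res≢0⇒≥4 : ∀ {u v} → adj H u v ≡ true → res u v ≢ + 0 → + 4 ≤ res u v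
    res≢0⇒≥4 uv ne = go (res≥4 uv)
      where
      go : _ → _
      go (inj₁ e) = ⊥-elim (ne e)
      go (inj₂ p) = p

    -- If `res x y` were 0, the projection of xy would have norm 0 and vanish; by self-adjointness
    -- the projection of uv would then vanish on xy.
    flow≢0⇒res≢0 : ∀ {u v x y} → adj H u v ≡ true → flow u v x y ≢ + 0 → res x y ≢ + 0
    flow≢0⇒res≢0 {u} {v} {x} {y} uv ne z = ne (trans (flow-sym uv xy) flow-zero)
      where
      xy = flow-adjacent uv ne
      norm-zero : sumFin (energy x y) ≡ + 0
      norm-zero = trans (flow-norm xy) (trans (cong (λ r → + 2 * (T * r)) z) (lem T))
        where
        lem : ∀ t → + 2 * (t * + 0) ≡ + 0
        lem = solve-∀
      square-zero : flow x y u v * flow x y u v ≡ + 0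
      square-zero = sum-nonneg-zero (λ q → square-nonneg (flow x y u q)) (sum-nonneg-zero (energy-nonneg x y) norm-zero u) v
      flow-zero : flow x y u v ≡ + 0
      flow-zero = go (flow x y u v ℤₚ.≟ + 0)
        where
        go : Dec (flow x y u v ≡ + 0) → flow x y u v ≡ + 0
        go (yes e) = e
        go (no f) = *-nonzero f square-zero

    weight : V → ℤ
    weight p = sumFin (λ q → a p q * res p q)

    term-nonneg : ∀ p q → + 0 ≤ a p q * res p q
    term-nonneg p q = go (adj H p q) refl
      where
      go : ∀ b → adj H p q ≡ b → + 0 ≤ a p q * res p q
      go true e = *-nonneg (b2ℤ-nonneg (adj H p q)) (res-nonneg e)
      go false e = ℤₚ.≤-reflexive (sym (trans (cong (λ b → b2ℤ b * res p q) e) (ℤₚ.*-zeroˡ (res p q))))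

    term≥4 : ∀ {p q} → adj H p q ≡ true → res p q ≢ + 0 → + 4 ≤ a p q * res p q
    term≥4 {p} {q} pq ne = subst (+ 4 ≤_) (sym (trans (cong (_* res p q) (A-true H pq)) (ℤₚ.*-identityˡ (res p q)))) (res≢0⇒≥4 pq ne)

    -- By conservation a vertex of the support lies on two flow edges, each with `res` at least 4.
    touched : ∀ {u v p q} → adj H u v ≡ true → flow u v p q ≢ + 0 → + 8 ≤ weight p
    touched {u} {v} {p} {q} uv ne = ℤₚ.≤-trans (ℤₚ.+-mono-≤ (term≥4 pq (flow≢0⇒res≢0 uv ne)) (term≥4 (flow-adjacent uv (proj₂ (proj₂ other))) (flow≢0⇒res≢0 uv (proj₂ (proj₂ other)))))
        (sum≥2 (term-nonneg p) (proj₁ (proj₂ other)))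
      where
      pq = flow-adjacent uv ne
      other = flow-another u v ne

    -- Five vertices of weight 8 would exceed 36, so the support has only the vertices u, v, x, y.
    -- Without triangles the flow at u then uses only uv and ux, and at v only vu and vy, all with
    -- square ρ². Hence 6ρ² ≤ 2 · 9 · ρ, contrary to ρ ≥ 4.
    no-edge : T ≡ + 9 → sumFin weight ≡ + 36 → ∀ {u v} → adj H u v ≡ true → res u v ≢ + 0 → ⊥
    no-edge T9 total {u} {v} uv r≢0 = finish (res u v) T (res≢0⇒≥4 uv r≢0) T9 bound
      where
      finish : ∀ r t → + 4 ≤ r → t ≡ + 9 → r * r + r * r + (r * r + r * r + (r * r + r * r)) ≤ + 2 * (t * r) → ⊥
      -- The coefficients 6, 30 and 24 are those of 6r² - 18r expanded in powers of r - 4.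
      finish r .(+ 9) r≥4 refl bd = nonneg-absurd 23 (+-nonneg (*-nonneg {+ 6} (+≤+ z≤n) (square-nonneg (r - + 4)))
          (+-nonneg (*-nonneg {+ 30} (+≤+ z≤n) (diff-nonneg r≥4)) (diff-nonneg bd))) (lem r)
        where
        lem : ∀ r → + 6 * ((r - + 4) * (r - + 4)) + (+ 30 * (r - + 4) + (+ 2 * (+ 9 * r) - (r * r + r * r + (r * r + r * r + (r * r + r * r))))) ≡ -[1+ 23 ]
        lem = solve-∀
      ρ² = res u v * res u v
      sq = square-around tf uv r≢0
      open Square sq
      uv-flow : flow u v u v ≢ + 0
      uv-flow e = r≢0 (trans (sym (flow-self uv)) e)
      weight-nonneg : ∀ p → + 0 ≤ weight p
      weight-nonneg p = sum-nonneg (term-nonneg p)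
      no-fifth : ∀ {p q} → flow u v p q ≢ + 0 → u ≢ p → v ≢ p → x ≢ p → y ≢ p → ⊥
      no-fifth ne up vp xp yp = absurd (ℤₚ.≤-trans
          (ℤₚ.+-mono-≤ (touched uv uv-flow) (ℤₚ.+-mono-≤ (touched uv (flow-anti-≢ u v uv-flow)) (ℤₚ.+-mono-≤ (touched uv (flow-anti-≢ u v ux-flow)) (ℤₚ.+-mono-≤ (touched uv (flow-anti-≢ u v vy-flow)) (touched uv ne)))))
          (subst (weight u + (weight v + (weight x + (weight y + weight _))) ≤_) total
            (sum≥5 weight-nonneg u≢v u≢x u≢y up v≢x v≢y vp x≢y xp yp)))
        where
        absurd : + 40 ≤ + 36 → ⊥
        absurd (+≤+ le) = ℕₚ.<⇒≱ (ℕₚ.m≤m+n 37 3) le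
      ux = flow-adjacent uv ux-flow
      vy = flow-adjacent uv vy-flow
      row-u : ∀ p → v ≢ p → x ≢ p → flow u v u p ≡ + 0
      row-u p vp xp = go (flow u v u p ℤₚ.≟ + 0)
        where
        go : Dec (flow u v u p ≡ + 0) → flow u v u p ≡ + 0
        go (yes e) = e
        -- The vertex `p` differs from `y` as well, since u, v, y would otherwise form a triangle.
        go (no ne) = ⊥-elim (no-fifth (flow-anti-≢ u v ne) (adj-≢ H up) vp xp
            (λ e → tf u v y uv vy (subst (λ z → adj H z u ≡ true) (sym e) (adj-flip H up))))
          where up = flow-adjacent uv ne
      row-v : ∀ p → u ≢ p → y ≢ p → flow u v v p ≡ + 0
      row-v p up yp = go (flow u v v p ℤₚ.≟ + 0)
        where
        go : Dec (flow u v v p ≡ + 0) → flow u v v p ≡ + 0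
        go (yes e) = e
        go (no ne) = ⊥-elim (no-fifth (flow-anti-≢ u v ne) up (adj-≢ H vp)
            (λ e → tf u v x uv (subst (λ z → adj H v z ≡ true) (sym e) vp) (adj-flip H ux)) yp)
          where vp = flow-adjacent uv ne
      opposite : ∀ p q → p + q ≡ + 0 → q * q ≡ p * p
      opposite p q e = trans (lem₁ p q) (trans (cong (λ s → p * p + s * (q - p)) e) (lem₂ p q))
        where
        lem₁ : ∀ p q → q * q ≡ p * p + (p + q) * (q - p)
        lem₁ = solve-∀
        lem₂ : ∀ p q → p * p + + 0 * (q - p) ≡ p * p
        lem₂ = solve-∀
      ux² : flow u v u x * flow u v u x ≡ ρ²
      ux² = trans (opposite (flow u v u v) (flow u v u x) row) (flow-self² uv)
        where
        row : flow u v u v + flow u v u x ≡ + 0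
        row = trans (sym (sum-two (flow u v u) v≢x row-u)) (flow-conserved u v u)
      vy² : flow u v v y * flow u v v y ≡ ρ²
      vy² = trans (opposite (flow u v v u) (flow u v v y) row) (flow-back² uv)
        where
        row : flow u v v u + flow u v v y ≡ + 0
        row = trans (sym (sum-two (flow u v v) u≢y row-v)) (flow-conserved u v v)
      neg² : ∀ p q → flow u v q p * flow u v q p ≡ flow u v p q * flow u v p q
      neg² p q = trans (cong (λ r → r * r) (flow-anti u v p q)) (lem₁ (flow u v p q))
        where
        lem₁ : ∀ r → - r * - r ≡ r * r
        lem₁ = solve-∀
      one : ∀ p q → flow u v p q * flow u v p q ≡ ρ² → ρ² ≤ energy u v q
      one p q e = subst (_≤ energy u v q) (trans (neg² p q) e) (sum≥1 (λ z → square-nonneg (flow u v q z)) p)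
      two : ∀ p {q r} → q ≢ r → flow u v p q * flow u v p q ≡ ρ² → flow u v p r * flow u v p r ≡ ρ² → ρ² + ρ² ≤ energy u v p
      two p ne e e′ = subst (_≤ energy u v p) (cong₂ _+_ e e′) (energy-two u v p ne)
      combine : ∀ r {a b c d t} → r + r ≤ a → r + r ≤ b → r ≤ c → r ≤ d → a + (b + (c + d)) ≤ t → r + r + (r + r + (r + r)) ≤ t
      combine r p q s t le = ℤₚ.≤-trans (ℤₚ.+-mono-≤ p (ℤₚ.+-mono-≤ q (ℤₚ.+-mono-≤ s t))) le
      bound : ρ² + ρ² + (ρ² + ρ² + (ρ² + ρ²)) ≤ + 2 * (T * res u v)
      bound = combine ρ² (two u v≢x (flow-self² uv) ux²) (two v u≢y (flow-back² uv) vy²) (one u x ux²) (one v y vy²) (square-energy uv sq)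

    contradiction-9 : T ≡ + 9 → sumFin weight ≡ + 36 → ⊥
    contradiction-9 T9 total = no-edge T9 total (proj₁ (proj₂ (proj₂ E))) (proj₂ (proj₂ (proj₂ E)))
      where
      E = res-edge (λ e → case (trans (sym total) e))
        where
        case : + 36 ≡ + 0 → ⊥
        case ()

-- Deleting an edge

removed : ∀ {n} → Fin n → Fin n → Fin n → Fin n → Bool
removed u v x y = (⌊ u ≟ x ⌋ ∧ ⌊ v ≟ y ⌋) ∨ (⌊ v ≟ x ⌋ ∧ ⌊ u ≟ y ⌋)

delete : ∀ {n} → Graph n → Fin n → Fin n → Graph n
delete H u v = record
  { adj = λ x y → adj H x y ∧ not (removed u v x y)
  ; sym = λ x y → cong₂ (λ p q → p ∧ not q) (adj-sym H x y) (flip x y)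
  ; irrefl = λ x → cong (_∧ not (removed u v x x)) (irrefl H x)
  }
  where
  flip : ∀ x y → removed u v x y ≡ removed u v y x
  flip x y = trans (Boolₚ.∨-comm (⌊ u ≟ x ⌋ ∧ ⌊ v ≟ y ⌋) (⌊ v ≟ x ⌋ ∧ ⌊ u ≟ y ⌋))
    (cong₂ _∨_ (Boolₚ.∧-comm ⌊ v ≟ x ⌋ ⌊ u ≟ y ⌋) (Boolₚ.∧-comm ⌊ u ≟ x ⌋ ⌊ v ≟ y ⌋))

delete-adj : ∀ {n} (H : Graph n) u v {x y} → adj (delete H u v) x y ≡ true → adj H x y ≡ true
delete-adj H u v {x} {y} e with adj H x y
... | true = refl

delete-triangleFree : ∀ {n} (H : Graph n) u v → TriangleFree H → TriangleFree (delete H u v)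
delete-triangleFree H u v tf x y z p q r = tf x y z (delete-adj H u v p) (delete-adj H u v q) (delete-adj H u v r)

module Deletion {n} (H : Graph n) {u v : Fin n} (uv : adj H u v ≡ true) where
  private
    H′ = delete H u v
    u≢v = adj-≢ H uv

  A-delete : ∀ x y → A H′ x y ≡ A H x y - (δ u x * δ v y + δ v x * δ u y)
  A-delete x y with u ≟ x | v ≟ y | v ≟ x | u ≟ y
  ... | yes refl | _        | yes refl | _ = ⊥-elim (u≢v refl)
  ... | yes refl | yes refl | no vx    | uy? rewrite uv | δ-refl u | δ-refl v | δ-≢ vx = lem (δ u v)
    where
    lem : ∀ d → + 0 ≡ + 1 - (+ 1 * + 1 + + 0 * d)
    lem = solve-∀
  ... | yes refl | no vy    | no vx    | uy? rewrite δ-≢ vy | δ-≢ vx | Boolₚ.∧-identityʳ (adj H u y) = lem (A H u y) (δ u u) (δ u y)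
    where
    lem : ∀ a p q → a ≡ a - (p * + 0 + + 0 * q)
    lem = solve-∀
  ... | no ux    | _        | yes refl | yes refl rewrite adj-flip H uv | δ-refl u | δ-refl v | δ-≢ ux = lem (δ v u)
    where
    lem : ∀ d → + 0 ≡ + 1 - (+ 0 * d + + 1 * + 1)
    lem = solve-∀
  ... | no ux    | _        | yes refl | no uy rewrite δ-≢ ux | δ-≢ uy | Boolₚ.∧-identityʳ (adj H v y) = lem (A H v y) (δ v y) (δ v v)
    where
    lem : ∀ a p q → a ≡ a - (+ 0 * p + q * + 0)
    lem = solve-∀
  ... | no ux    | _        | no vx    | _ rewrite δ-≢ ux | δ-≢ vx | Boolₚ.∧-identityʳ (adj H x y) = lem (A H x y) (δ v y) (δ u y)
    where
    lem : ∀ a p q → a ≡ a - (+ 0 * p + + 0 * q)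
    lem = solve-∀

  degree-delete : ∀ x → degree H′ x ≡ degree H x - (δ u x + δ v x)
  degree-delete x = trans (sum-cong (A-delete x))
    (trans (sum-minus (A H x) (λ y → δ u x * δ v y + δ v x * δ u y))
      (cong (_-_ (degree H x)) (trans (sum-+ (λ y → δ u x * δ v y) (λ y → δ v x * δ u y))
        (cong₂ _+_ (trans (sum-*ˡ (δ u x) (δ v)) (trans (cong (δ u x *_) (sum-δ1 v)) (ℤₚ.*-identityʳ (δ u x))))
          (trans (sum-*ˡ (δ v x) (δ u)) (trans (cong (δ v x *_) (sum-δ1 u)) (ℤₚ.*-identityʳ (δ v x))))))))

  Σdegree-delete : sumFin (degree H′) ≡ sumFin (degree H) - + 2
  Σdegree-delete = trans (sum-cong degree-delete) (trans (sum-minus (degree H) (λ x → δ u x + δ v x))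
    (cong (_-_ (sumFin (degree H))) (trans (sum-+ (δ u) (δ v)) (cong₂ _+_ (sum-δ1 u) (sum-δ1 v)))))

  L-delete : ∀ x y → laplacian H′ x y ≡ - (δ u x - δ v x) * (δ u y - δ v y) + laplacian H x y
  L-delete x y = trans (L-entry H′ x y) (trans (cong₂ (λ d a → d * δ x y - a) (degree-delete x) (A-delete x y))
    (trans (lem (degree H x) (δ u x) (δ v x) (δ x y) (A H x y) (δ v y) (δ u y))
      (trans (cong₂ (λ p q → degree H x * δ x y - A H x y - p - q + δ u x * δ v y + δ v x * δ u y) (shift u) (shift v))
        (trans (lem₂ (degree H x * δ x y) (A H x y) (δ u x) (δ v x) (δ u y) (δ v y)) (cong (_+_ (- (δ u x - δ v x) * (δ u y - δ v y))) (sym (L-entry H x y)))))))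
    where
    shift : ∀ w → δ w x * δ x y ≡ δ w x * δ w y
    shift w = sym (δ-subst w x (λ z → δ z y))
    lem : ∀ d ux vx xy a vy uy → (d - (ux + vx)) * xy - (a - (ux * vy + vx * uy)) ≡
      d * xy - a - ux * xy - vx * xy + ux * vy + vx * uy
    lem = solve-∀
    lem₂ : ∀ dx a ux vx uy vy → dx - a - ux * uy - vx * vy + ux * vy + vx * uy ≡ - (ux - vx) * (uy - vy) + (dx - a)
    lem₂ = solve-∀

-- Deletion subtracts the rank-one matrix bbᵀ with b = δ u - δ v, so the tree number drops by the
-- potential difference across uv. This is what makes `res` a tree number to which the unicyclic
-- bound can be applied.
trees-delete : ∀ {n} (H : Graph (suc n)) {u v} → adj H u v ≡ true → trees (delete H u v) ≡ Circulation.res (green H) u v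
trees-delete H {u} {v} uv = begin
  det (pinned (laplacian (delete H u v)))
    ≡⟨ det-cong (λ i j → trans (cong (_+ δ zero i * δ zero j) (L-delete i j))
         (ℤₚ.+-assoc (- b i * b j) (laplacian H i j) (δ zero i * δ zero j))) ⟩
  det (λ i j → - b i * b j + B i j)
    ≡⟨ det-rank-one B (λ i → - b i) b ⟩
  det B + sumFin (λ i → - b i * det (upd B i b))
    ≡⟨ cong (_+_ (det B)) (trans (sum-cong (λ i → trans (cong (- b i *_) (pot≡ i)) (lem (δ u i) (δ v i) (P i))))
         (trans (sum-minus (λ i → δ v i * P i) (λ i → δ u i * P i)) (cong₂ _-_ (sum-δ v P) (sum-δ u P)))) ⟩
  det B + (P v - P u)
    ≡⟨ lem₂ (det B) (P u) (P v) ⟩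
  det B - (P u - P v) ∎
  where
  open ≡-Reasoning
  open Deletion H uv
  B = pinned (laplacian H)
  b : Row _
  b i = δ u i - δ v i
  P = Circulation.pot (green H) u v
  lem : ∀ p q r → - (p - q) * r ≡ q * r - p * r
  lem = solve-∀
  lem₂ : ∀ d p q → d + (q - p) ≡ d - (p - q)
  lem₂ = solve-∀
  lem₃ : ∀ p q → p - q ≡ - + 1 * q + p
  lem₃ = solve-∀
  pot≡ : ∀ i → det (upd B i b) ≡ P i
  pot≡ i = trans (det-upd-cong B i (λ c → lem₃ (δ u c) (δ v c)))
    (trans (det-upd-linear B i (- + 1) (δ v) (δ u)) (sym (lem₃ (cofactor B i u) (cofactor B i v))))

unicyclic-trees≢3 : ∀ {n} (H : Graph (suc n)) → TriangleFree H → sumFin (degree H) ≡ + 2 * + suc n → trees H ≢ + 3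
unicyclic-trees≢3 H tf Σd T3 = absurd (subst (+ 4 ≤_) T3 (Circulation.unicyclic-trees≥4 (green H) tf Σd (subst (+ 0 <_) (sym T3) (+<+ (s≤s z≤n)))))
  where
  absurd : + 4 ≤ + 3 → ⊥
  absurd (+≤+ (s≤s (s≤s (s≤s ()))))

-- Deleting uv leaves as many edges as vertices and `res u v` spanning trees, so if that number is
-- not 0, the unicyclic bound makes it at least 4. Foster's sum is 9(2(n + 1) + 2) - 18n = 36.
bicyclic-trees≢9 : ∀ {n} (H : Graph (suc n)) → TriangleFree H → sumFin (degree H) ≡ + 2 * + suc n + + 2 → trees H ≢ + 9
bicyclic-trees≢9 {n} H tf Σd T9 = Circulation.Bicyclic.contradiction-9 (green H) tf (cofactor-sym H (λ z → nine (trans (sym T9) z))) res≥4 T9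
    (trans res-total (trans (cong₂ (λ t s → t * s - + 2 * (t * + n)) T9 Σd) (lem (+ n))))
  where
  open Circulation (green H)
  nine : + 9 ≡ + 0 → ⊥
  nine ()
  lem : ∀ n → + 9 * (+ 2 * (+ 1 + n) + + 2) - + 2 * (+ 9 * n) ≡ + 36
  lem = solve-∀
  res≥4 : ∀ {u v} → adj H u v ≡ true → res u v ≡ + 0 ⊎ + 4 ≤ res u v
  res≥4 {u} {v} uv = go (res u v ℤₚ.≟ + 0)
    where
    lem₁ : ∀ s → s + + 2 - + 2 ≡ s
    lem₁ = solve-∀
    nonneg : + 0 ≤ res u v
    nonneg = ℤₚ.*-cancelˡ-≤-pos (+ 0) (res u v) (+ 18) (subst (+ 0 ≤_)
      (trans (flow-norm uv) (trans (cong (λ t → + 2 * (t * res u v)) T9) (sym (ℤₚ.*-assoc (+ 2) (+ 9) (res u v))))) (sum-nonneg (energy-nonneg u v)))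
    go : Dec (res u v ≡ + 0) → res u v ≡ + 0 ⊎ + 4 ≤ res u v
    go (yes e) = inj₁ e
    go (no ne) = inj₂ (subst (+ 4 ≤_) (trees-delete H uv) (Circulation.unicyclic-trees≥4 (green (delete H u v)) (delete-triangleFree H u v tf)
      (trans (Deletion.Σdegree-delete H uv) (trans (cong (_- + 2) Σd) (lem₁ (+ 2 * + suc n))))
      (subst (+ 0 <_) (sym (trees-delete H uv)) (ℤₚ.≤∧≢⇒< nonneg (λ z → ne (sym z))))))

-- Adding a vertex

sum-snoc : ∀ {N} (f : Fin (suc N) → ℤ) → sumFin f ≡ sumFin (λ i → f (inject₁ i)) + f (fromℕ N)
sum-snoc {zero} f = trans (ℤₚ.+-identityʳ (f zero)) (sym (ℤₚ.+-identityˡ (f zero)))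
sum-snoc {suc N} f = trans (cong (_+_ (f zero)) (sum-snoc (f ∘ suc))) (sym (ℤₚ.+-assoc (f zero) (sumFin (λ i → f (suc (inject₁ i)))) (f (fromℕ (suc N)))))

Σ< : ℕ → (ℕ → ℤ) → ℤ
Σ< N f = sumFin {N} (λ i → f (toℕ i))

Σ<-suc : ∀ N f → Σ< (suc N) f ≡ Σ< N f + f N
Σ<-suc N f = trans (sum-snoc {N} (λ i → f (toℕ i)))
  (cong₂ _+_ (sum-cong {N} (λ i → cong f (Finₚ.toℕ-inject₁ i))) (cong f (Finₚ.toℕ-fromℕ N)))

Σ<-cong : ∀ N {f g : ℕ → ℤ} → (∀ i → i ℕ.< N → f i ≡ g i) → Σ< N f ≡ Σ< N g
Σ<-cong N h = sum-cong (λ i → h (toℕ i) (Finₚ.toℕ<n i))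

δℕ : ℕ → ℕ → ℤ
δℕ i j = b2ℤ (i ≡ᵇ j)

δℕ-refl : ∀ i → δℕ i i ≡ + 1
δℕ-refl zero = refl
δℕ-refl (suc i) = δℕ-refl i

≡ᵇ-≢ : ∀ {i j} → i ≢ j → (i ≡ᵇ j) ≡ false
≡ᵇ-≢ {zero}  {zero}  ne = ⊥-elim (ne refl)
≡ᵇ-≢ {zero}  {suc j} ne = refl
≡ᵇ-≢ {suc i} {zero}  ne = refl
≡ᵇ-≢ {suc i} {suc j} ne = ≡ᵇ-≢ (λ e → ne (cong suc e))

≡ᵇ-refl : ∀ i → (i ≡ᵇ i) ≡ true
≡ᵇ-refl zero = refl
≡ᵇ-refl (suc i) = ≡ᵇ-refl i

δℕ-≢ : ∀ {i j} → i ≢ j → δℕ i j ≡ + 0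
δℕ-≢ ne = cong b2ℤ (≡ᵇ-≢ ne)

δℕ-toℕ : ∀ {n} (i j : Fin n) → δ i j ≡ δℕ (toℕ i) (toℕ j)
δℕ-toℕ zero zero = refl
δℕ-toℕ zero (suc j) = refl
δℕ-toℕ (suc i) zero = refl
δℕ-toℕ (suc i) (suc j) = δℕ-toℕ i j

Σ<-δ : ∀ N p (f : ℕ → ℤ) → p ℕ.< N → Σ< N (λ j → δℕ p j * f j) ≡ f p
Σ<-δ N p f p<N = trans (sum-cong {N} (λ j → cong (_* f (toℕ j)) (trans (cong (λ q → δℕ q (toℕ j)) (sym (Finₚ.toℕ-fromℕ< p<N))) (sym (δℕ-toℕ p̂ j)))))
    (trans (sum-δ p̂ (λ j → f (toℕ j))) (cong f (Finₚ.toℕ-fromℕ< p<N)))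
  where p̂ = fromℕ< p<N

Σ<-δ1 : ∀ N p → p ℕ.< N → Σ< N (δℕ p) ≡ + 1
Σ<-δ1 N p p<N = trans (sum-cong {N} (λ j → sym (ℤₚ.*-identityʳ (δℕ p (toℕ j))))) (Σ<-δ N p (λ _ → + 1) p<N)

-- Indexing by ℕ lets one function serve all orders while vertices are added; the order `N` is
-- carried as a separate bound.
Weights : Set
Weights = ℕ → ℕ → ℤ

deg : Weights → ℕ → ℕ → ℤ
deg a N i = Σ< N (a i)

walks : Weights → ℕ → ℤ
walks a N = Σ< N (λ i → Σ< N (λ j → Σ< N (λ k → a i k * a k j) * a j i))

-- The pinned Laplacian of the first `N` vertices, with entries addressed by ℕ.
K : Weights → ℕ → ℕ → ℕ → ℤ
K a N i j = deg a N i * δℕ i j - a i j + δℕ 0 i * δℕ 0 j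

treesℕ : Weights → ℕ → ℤ
treesℕ a N = det {N} (λ i j → K a N (toℕ i) (toℕ j))

record Extends (a a′ : Weights) (N : ℕ) (r : ℕ → ℤ) : Set where
  field
    old    : ∀ i j → i ℕ.< N → j ℕ.< N → a′ i j ≡ a i j
    row    : ∀ j → j ℕ.< N → a′ N j ≡ r j
    column : ∀ j → j ℕ.< N → a′ j N ≡ r j
    corner : a′ N N ≡ + 0

module Extension {a a′ N r} (ext : Extends a a′ N r) where
  open Extends ext
  open ≡-Reasoning

  deg-old : ∀ i → i ℕ.< N → deg a′ (suc N) i ≡ deg a N i + r i
  deg-old i i<N = trans (Σ<-suc N (a′ i)) (cong₂ _+_ (Σ<-cong N (λ j j<N → old i j i<N j<N)) (column i i<N))

  deg-new : deg a′ (suc N) N ≡ Σ< N r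
  deg-new = trans (Σ<-suc N (a′ N)) (trans (cong₂ _+_ (Σ<-cong N row) corner) (ℤₚ.+-identityʳ (Σ< N r)))

  Σ-deg : ∀ (g : ℤ → ℤ) → Σ< (suc N) (λ i → g (deg a′ (suc N) i)) ≡ Σ< N (λ i → g (deg a N i + r i)) + g (Σ< N r)
  Σ-deg g = trans (Σ<-suc N (λ i → g (deg a′ (suc N) i))) (cong₂ _+_ (Σ<-cong N (λ i i<N → cong g (deg-old i i<N))) (cong g deg-new))

  K-old : ∀ i j → i ℕ.< N → j ℕ.< N → K a′ (suc N) i j ≡ K a N i j + r i * δℕ i j
  K-old i j i<N j<N = trans (cong₂ (λ d w → d * δℕ i j - w + δℕ 0 i * δℕ 0 j) (deg-old i i<N) (old i j i<N j<N))
    (lem (deg a N i) (r i) (δℕ i j) (a i j) (δℕ 0 i * δℕ 0 j))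
    where
    lem : ∀ d r e a z → (d + r) * e - a + z ≡ d * e - a + z + r * e
    lem = solve-∀

  K-column : ∀ i → i ℕ.< N → K a′ (suc N) i N ≡ - r i
  K-column i i<N = trans (cong₂ (λ e w → deg a′ (suc N) i * e - w + δℕ 0 i * δℕ 0 N) (δℕ-≢ (ℕₚ.<⇒≢ i<N)) (column i i<N))
    (trans (cong (λ z → deg a′ (suc N) i * + 0 - r i + δℕ 0 i * z) (δℕ-≢ (ℕₚ.<⇒≢ (ℕₚ.≤-<-trans z≤n i<N))))
      (lem (deg a′ (suc N) i) (r i) (δℕ 0 i)))
    where
    lem : ∀ d r z → d * + 0 - r + z * + 0 ≡ - r
    lem = solve-∀

  K-row : ∀ j → j ℕ.< N → K a′ (suc N) N j ≡ - r j
  K-row j j<N = trans (cong₂ (λ e w → deg a′ (suc N) N * e - w + δℕ 0 N * δℕ 0 j) (δℕ-≢ (λ e → ℕₚ.<⇒≢ j<N (sym e))) (row j j<N))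
    (trans (cong (λ z → deg a′ (suc N) N * + 0 - r j + z * δℕ 0 j) (δℕ-≢ (ℕₚ.<⇒≢ (ℕₚ.≤-<-trans z≤n j<N))))
      (lem (deg a′ (suc N) N) (r j) (δℕ 0 j)))
    where
    lem : ∀ d r z → d * + 0 - r + + 0 * z ≡ - r
    lem = solve-∀

  K-corner : 0 ℕ.< N → K a′ (suc N) N N ≡ Σ< N r
  K-corner 0<N = trans (cong₂ (λ d e → d * e - a′ N N + δℕ 0 N * δℕ 0 N) deg-new (δℕ-refl N))
    (trans (cong₂ (λ w z → Σ< N r * + 1 - w + z * z) corner (δℕ-≢ (ℕₚ.<⇒≢ 0<N))) (lem (Σ< N r)))
    where
    lem : ∀ s → s * + 1 - + 0 + + 0 * + 0 ≡ s
    lem = solve-∀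

  -- A closed 3-walk through the new vertex visits it exactly once, because `corner` is 0, and at
  -- one of three positions.
  walks-new : walks a′ (suc N) ≡ walks a N + + 3 * Σ< N (λ i → r i * Σ< N (λ j → a i j * r j))
  walks-new = begin
    Σ< (suc N) (λ i → Σ< (suc N) (λ j → P′ i j * a′ j i))
      ≡⟨ Σ<-suc N (λ i → Σ< (suc N) (λ j → P′ i j * a′ j i)) ⟩
    Σ< N (λ i → Σ< (suc N) (λ j → P′ i j * a′ j i)) + Σ< (suc N) (λ j → P′ N j * a′ j N)
      ≡⟨ cong₂ _+_ (trans (Σ<-cong N inner) (trans (sum-+ {N} (λ i → Σ< N (λ j → P (toℕ i) j * a j (toℕ i)) + Σ< N (λ j → r (toℕ i) * (a j (toℕ i) * r j))) (λ i → r (toℕ i) * Q (toℕ i)))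
             (cong (_+ X) (sum-+ {N} (λ i → Σ< N (λ j → P (toℕ i) j * a j (toℕ i))) (λ i → Σ< N (λ j → r (toℕ i) * (a j (toℕ i) * r j)))))))
           last ⟩
    walks a N + Σ< N (λ i → Σ< N (λ j → r i * (a j i * r j))) + X + X
      ≡⟨ cong (λ z → walks a N + z + X + X) (trans (sum-swap {N} {N} (λ i j → r (toℕ i) * (a (toℕ j) (toℕ i) * r (toℕ j))))
           (Σ<-cong N (λ j _ → trans (Σ<-cong N (λ i _ → lem₂ (r i) (a j i) (r j))) (sum-*ˡ {N} (r j) (λ i → a j (toℕ i) * r (toℕ i)))))) ⟩
    walks a N + X + X + X
      ≡⟨ lem₃ (walks a N) X ⟩
    walks a N + + 3 * X ∎
    where
    P P′ : ℕ → ℕ → ℤ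
    P i j = Σ< N (λ k → a i k * a k j)
    P′ i j = Σ< (suc N) (λ k → a′ i k * a′ k j)
    Q : ℕ → ℤ
    Q i = Σ< N (λ j → a i j * r j)
    X = Σ< N (λ i → r i * Q i)
    lem₂ : ∀ x y z → x * (y * z) ≡ z * (y * x)
    lem₂ = solve-∀
    lem₃ : ∀ w x → w + x + x + x ≡ w + + 3 * x
    lem₃ = solve-∀
    P-old : ∀ i j → i ℕ.< N → j ℕ.< N → P′ i j ≡ P i j + r i * r j
    P-old i j i<N j<N = trans (Σ<-suc N (λ k → a′ i k * a′ k j)) (cong₂ _+_
      (Σ<-cong N (λ k k<N → cong₂ _*_ (old i k i<N k<N) (old k j k<N j<N))) (cong₂ _*_ (column i i<N) (row j j<N)))
    P-col : ∀ i → i ℕ.< N → P′ i N ≡ Q i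
    P-col i i<N = trans (Σ<-suc N (λ k → a′ i k * a′ k N)) (trans (cong₂ _+_
      (Σ<-cong N (λ k k<N → cong₂ _*_ (old i k i<N k<N) (column k k<N))) (trans (cong (a′ i N *_) corner) (ℤₚ.*-zeroʳ (a′ i N)))) (ℤₚ.+-identityʳ (Q i)))
    P-row : ∀ j → j ℕ.< N → P′ N j ≡ Σ< N (λ k → r k * a k j)
    P-row j j<N = trans (Σ<-suc N (λ k → a′ N k * a′ k j)) (trans (cong₂ _+_
      (Σ<-cong N (λ k k<N → cong₂ _*_ (row k k<N) (old k j k<N j<N))) (trans (cong (_* a′ N j) corner) (ℤₚ.*-zeroˡ (a′ N j)))) (ℤₚ.+-identityʳ (Σ< N (λ k → r k * a k j))))
    inner : ∀ i → i ℕ.< N → Σ< (suc N) (λ j → P′ i j * a′ j i) ≡ Σ< N (λ j → P i j * a j i) + Σ< N (λ j → r i * (a j i * r j)) + r i * Q i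
    inner i i<N = trans (Σ<-suc N (λ j → P′ i j * a′ j i)) (cong₂ _+_
      (trans (Σ<-cong N (λ j j<N → trans (cong₂ _*_ (P-old i j i<N j<N) (old j i j<N i<N)) (lem (P i j) (r i) (r j) (a j i))))
        (sum-+ {N} (λ j → P i (toℕ j) * a (toℕ j) i) (λ j → r i * (a (toℕ j) i * r (toℕ j)))))
      (trans (cong₂ _*_ (P-col i i<N) (row i i<N)) (ℤₚ.*-comm (Q i) (r i))))
      where
      lem : ∀ p x y z → (p + x * y) * z ≡ p * z + x * (z * y)
      lem = solve-∀
    last : Σ< (suc N) (λ j → P′ N j * a′ j N) ≡ X
    last = begin
      Σ< (suc N) (λ j → P′ N j * a′ j N)
        ≡⟨ Σ<-suc N (λ j → P′ N j * a′ j N) ⟩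
      Σ< N (λ j → P′ N j * a′ j N) + P′ N N * a′ N N
        ≡⟨ cong₂ _+_ (Σ<-cong N (λ j j<N → trans (cong₂ _*_ (P-row j j<N) (column j j<N)) (sym (sum-*ʳ {N} (r j) (λ k → r (toℕ k) * a (toℕ k) j)))))
             (trans (cong (P′ N N *_) corner) (ℤₚ.*-zeroʳ (P′ N N))) ⟩
      Σ< N (λ j → Σ< N (λ k → r k * a k j * r j)) + + 0
        ≡⟨ ℤₚ.+-identityʳ (Σ< N (λ j → Σ< N (λ k → r k * a k j * r j))) ⟩
      Σ< N (λ j → Σ< N (λ k → r k * a k j * r j))
        ≡⟨ sum-swap {N} {N} (λ j k → r (toℕ k) * a (toℕ k) (toℕ j) * r (toℕ j)) ⟩
      Σ< N (λ k → Σ< N (λ j → r k * a k j * r j))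
        ≡⟨ Σ<-cong N (λ k _ → trans (Σ<-cong N (λ j _ → ℤₚ.*-assoc (r k) (a k j) (r j))) (sum-*ˡ {N} (r k) (λ j → a k (toℕ j) * r (toℕ j)))) ⟩
      X ∎

-- Tree numbers after attaching a leaf or a triangle

sgn-inject₁ : ∀ {n} (j : Fin n) → sgn (inject₁ j) ≡ sgn j
sgn-inject₁ zero = refl
sgn-inject₁ (suc j) = cong -_ (sgn-inject₁ j)

punchIn-inject₁ : ∀ {n} (j : Fin (suc n)) (b : Fin n) → punchIn (inject₁ j) (inject₁ b) ≡ inject₁ (punchIn j b)
punchIn-inject₁ zero b = refl
punchIn-inject₁ (suc j) zero = refl
punchIn-inject₁ (suc j) (suc b) = cong suc (punchIn-inject₁ j b)

punchIn-fromℕ : ∀ n (j : Fin (suc n)) → punchIn (inject₁ j) (fromℕ n) ≡ fromℕ (suc n)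
punchIn-fromℕ n zero = refl
punchIn-fromℕ (suc n) (suc j) = cong suc (punchIn-fromℕ n j)

det-last-column : ∀ N (M : Fin (suc N) → Row (suc N)) → (∀ i → M (inject₁ i) (fromℕ N) ≡ + 0) →
  det M ≡ M (fromℕ N) (fromℕ N) * det (λ i j → M (inject₁ i) (inject₁ j))
det-last-column zero M h = trans (det-expand M) (lem (M zero zero))
  where
  lem : ∀ m → + 1 * (m * + 1) + + 0 ≡ m * + 1
  lem = solve-∀
det-last-column (suc N) M h = begin
  det M
    ≡⟨ det-expand M ⟩
  sumFin (λ j → sgn j * (M zero j * minor j))
    ≡⟨ sum-snoc (λ j → sgn j * (M zero j * minor j)) ⟩
  sumFin (λ j → sgn (inject₁ j) * (M zero (inject₁ j) * minor (inject₁ j))) + sgn last * (M zero last * minor last)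
    ≡⟨ cong₂ _+_ (sum-cong (λ j → trans (cong₂ (λ s d → s * (M zero (inject₁ j) * d)) (sgn-inject₁ j) (rec j))
           (lem₁ (sgn j) (M zero (inject₁ j)) c (minor′ j))))
         (trans (cong (λ m → sgn last * (m * minor last)) (h zero)) (lem₂ (sgn last) (minor last))) ⟩
  sumFin (λ j → c * (sgn j * (M zero (inject₁ j) * minor′ j))) + + 0
    ≡⟨ trans (ℤₚ.+-identityʳ (sumFin (λ j → c * (sgn j * (M zero (inject₁ j) * minor′ j))))) (sum-*ˡ c (λ j → sgn j * (M zero (inject₁ j) * minor′ j))) ⟩
  c * sumFin (λ j → sgn j * (M zero (inject₁ j) * minor′ j))
    ≡⟨ cong (c *_) (sym (det-expand (λ i j → M (inject₁ i) (inject₁ j)))) ⟩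
  c * det (λ i j → M (inject₁ i) (inject₁ j)) ∎
  where
  open ≡-Reasoning
  last = fromℕ (suc N)
  c = M last last
  minor : Fin (suc (suc N)) → ℤ
  minor j = det (λ x y → M (suc x) (punchIn j y))
  minor′ : Fin (suc N) → ℤ
  minor′ j = det (λ x y → M (suc (inject₁ x)) (inject₁ (punchIn j y)))
  rec : ∀ j → minor (inject₁ j) ≡ c * minor′ j
  rec j = trans (det-last-column N (λ x y → M (suc x) (punchIn (inject₁ j) y))
      (λ i → trans (cong (M (suc (inject₁ i))) (punchIn-fromℕ N j)) (h (suc i))))
    (cong₂ _*_ (cong (M last) (punchIn-fromℕ N j)) (det-cong (λ x y → cong (M (suc (inject₁ x))) (punchIn-inject₁ j y))))
  lem₁ : ∀ s m c d → s * (m * (c * d)) ≡ c * (s * (m * d))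
  lem₁ = solve-∀
  lem₂ : ∀ s d → s * (+ 0 * d) ≡ + 0
  lem₂ = solve-∀

det-combine : ∀ {n} (M : Fin n → Row n) {i j} → i ≢ j → ∀ s t → det (upd M i (λ c → s * M i c + (t * M j c + + 0))) ≡ s * det M
det-combine M {i} {j} ne s t = trans (det-upd-sum {l = 2} M i (s ▹ (λ _ → t)) (M i ▹ (λ _ → M j)))
  (trans (cong₂ (λ x y → s * x + (t * y + + 0)) (det-upd-id M i) (det-upd-row M ne)) (lem s t (det M)))
  where
  lem : ∀ s t d → s * d + (t * + 0 + + 0) ≡ s * d
  lem = solve-∀

-- Adding the row of the leaf to the row of its neighbour `p` clears the last column and at the same
-- time undoes the increase in the degree of `p`.
module LeafTrees {a a′ N p} (ext : Extends a a′ N (δℕ p)) (p<N : p ℕ.< N) where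
  open Extension ext

  private
    M : Fin (suc N) → Row (suc N)
    M i j = K a′ (suc N) (toℕ i) (toℕ j)
    p̂ = fromℕ< p<N
    p̂-toℕ : toℕ p̂ ≡ p
    p̂-toℕ = Finₚ.toℕ-fromℕ< p<N
    last = fromℕ N
    last≢ : ∀ i → inject₁ i ≢ last
    last≢ i e = Finₚ.fromℕ≢inject₁ (sym e)
    M-old : ∀ i j → M (inject₁ i) (inject₁ j) ≡ K a N (toℕ i) (toℕ j) + δ p̂ i * δ i j
    M-old i j = trans (cong₂ (K a′ (suc N)) (Finₚ.toℕ-inject₁ i) (Finₚ.toℕ-inject₁ j)) (trans (K-old (toℕ i) (toℕ j) (Finₚ.toℕ<n i) (Finₚ.toℕ<n j))
      (cong (_+_ (K a N (toℕ i) (toℕ j))) (cong₂ _*_ (trans (cong (λ q → δℕ q (toℕ i)) (sym p̂-toℕ)) (sym (δℕ-toℕ p̂ i))) (sym (δℕ-toℕ i j)))))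
    M-col : ∀ i → M (inject₁ i) last ≡ - δ p̂ i
    M-col i = trans (cong₂ (K a′ (suc N)) (Finₚ.toℕ-inject₁ i) (Finₚ.toℕ-fromℕ N)) (trans (K-column (toℕ i) (Finₚ.toℕ<n i))
      (cong -_ (trans (cong (λ q → δℕ q (toℕ i)) (sym p̂-toℕ)) (sym (δℕ-toℕ p̂ i)))))
    M-row : ∀ i → M last (inject₁ i) ≡ - δ p̂ i
    M-row i = trans (cong₂ (K a′ (suc N)) (Finₚ.toℕ-fromℕ N) (Finₚ.toℕ-inject₁ i)) (trans (K-row (toℕ i) (Finₚ.toℕ<n i))
      (cong -_ (trans (cong (λ q → δℕ q (toℕ i)) (sym p̂-toℕ)) (sym (δℕ-toℕ p̂ i)))))
    M-corner : M last last ≡ + 1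
    M-corner = trans (cong₂ (K a′ (suc N)) (Finₚ.toℕ-fromℕ N) (Finₚ.toℕ-fromℕ N)) (trans (K-corner (ℕₚ.≤-<-trans z≤n p<N)) (Σ<-δ1 N p p<N))
    X : Fin (suc N) → Row (suc N)
    X = upd M (inject₁ p̂) (λ c → + 1 * M (inject₁ p̂) c + (+ 1 * M last c + + 0))
    X-same : ∀ c → X (inject₁ p̂) c ≡ M (inject₁ p̂) c + M last c
    X-same c = trans (cong (λ r → r c) (upd-same M (inject₁ p̂) _)) (lem (M (inject₁ p̂) c) (M last c))
      where
      lem : ∀ x y → + 1 * x + (+ 1 * y + + 0) ≡ x + y
      lem = solve-∀
    X-other : ∀ {i} → inject₁ p̂ ≢ i → ∀ c → X i c ≡ M i c
    X-other ne c = cong (λ r → r c) (upd-other M _ ne)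
    X-col : ∀ i → X (inject₁ i) last ≡ + 0
    X-col i with p̂ ≟ i
    ... | yes refl = trans (X-same last) (trans (cong₂ _+_ (trans (M-col p̂) (cong -_ (δ-refl p̂))) M-corner) refl)
    ... | no ne = trans (X-other (λ e → ne (Finₚ.inject₁-injective e)) last) (trans (M-col i) (cong -_ (δ-≢ ne)))
    X-old : ∀ i j → X (inject₁ i) (inject₁ j) ≡ K a N (toℕ i) (toℕ j)
    X-old i j with p̂ ≟ i
    ... | yes refl = trans (X-same (inject₁ j)) (trans (cong₂ _+_ (trans (M-old p̂ j) (cong (λ d → K a N (toℕ p̂) (toℕ j) + d * δ p̂ j) (δ-refl p̂))) (M-row j)) (lem (K a N (toℕ p̂) (toℕ j)) (δ p̂ j)))
      where
      lem : ∀ k d → k + + 1 * d + - d ≡ k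
      lem = solve-∀
    ... | no ne = trans (X-other (λ e → ne (Finₚ.inject₁-injective e)) (inject₁ j)) (trans (M-old i j) (trans (cong (λ d → K a N (toℕ i) (toℕ j) + d * δ i j) (δ-≢ ne)) (lem (K a N (toℕ i) (toℕ j)) (δ i j))))
      where
      lem : ∀ k d → k + + 0 * d ≡ k
      lem = solve-∀

  leaf-trees : treesℕ a′ (suc N) ≡ treesℕ a N
  leaf-trees = trans (sym (trans (det-combine M (last≢ p̂) (+ 1) (+ 1)) (ℤₚ.*-identityˡ (det M))))
    (trans (det-last-column N X X-col) (trans (cong₂ _*_ (trans (X-other (last≢ p̂) last) M-corner) (det-cong X-old)) (ℤₚ.*-identityˡ (treesℕ a N))))

inject₁-or-last : ∀ {N} (i : Fin (suc N)) → (∃ λ j → i ≡ inject₁ j) ⊎ i ≡ fromℕ N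
inject₁-or-last {zero} zero = inj₂ refl
inject₁-or-last {suc N} zero = inj₁ (zero , refl)
inject₁-or-last {suc N} (suc i) with inject₁-or-last i
... | inj₁ (j , e) = inj₁ (suc j , cong suc e)
... | inj₂ e = inj₂ (cong suc e)

-- The effect of row operations that eliminate the two outer vertices of a triangle. Replacing row u
-- by 2u + v doubles the determinant and thereby avoids fractions.
record Reduced {n} (M : Fin n → Row n) (z u v : Fin n) : Set where
  field
    X        : Fin n → Row n
    det-X    : + 2 * det M ≡ det X
    row-z    : ∀ c → X z c ≡ M z c + M u c + M v c
    row-u    : ∀ c → X u c ≡ + 2 * M u c + M v c
    row-else : ∀ {i} → z ≢ i → u ≢ i → ∀ c → X i c ≡ M i c

abstract
  reduce : ∀ {n} (M : Fin n → Row n) {z u v} → z ≢ u → z ≢ v → u ≢ v → Reduced M z u v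
  reduce {n} M {z} {u} {v} z≢u z≢v u≢v = record
    { X = X₃
    ; det-X = trans (cong (+ 2 *_) (sym (trans (det-combine X₁ z≢v (+ 1) (+ 1)) (trans (ℤₚ.*-identityˡ (det X₁)) (trans (det-combine M z≢u (+ 1) (+ 1)) (ℤₚ.*-identityˡ (det M)))))))
        (sym (det-combine X₂ u≢v (+ 2) (+ 1)))
    ; row-z = λ c → trans (cong (λ r → r c) (trans (upd-other X₂ R₃ (λ e → z≢u (sym e))) (upd-same X₁ z R₂)))
        (trans (cong₂ (λ x y → + 1 * x + (+ 1 * y + + 0)) (cong (λ r → r c) (upd-same M z R₁)) (cong (λ r → r c) (upd-other M R₁ z≢v))) (lem₁ (M z c) (M u c) (M v c)))
    ; row-u = λ c → trans (cong (λ r → r c) (upd-same X₂ u R₃)) (trans (cong₂ (λ x y → + 2 * x + (+ 1 * y + + 0)) (X₂-other z≢u c) (X₂-other z≢v c)) (lem₂ (M u c) (M v c)))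
    ; row-else = λ zi ui c → trans (cong (λ r → r c) (upd-other X₂ R₃ ui)) (X₂-other zi c)
    }
    where
    R₁ R₂ R₃ : Row n
    X₁ X₂ X₃ : Fin n → Row n
    R₁ c = + 1 * M z c + (+ 1 * M u c + + 0)
    X₁ = upd M z R₁
    R₂ c = + 1 * X₁ z c + (+ 1 * X₁ v c + + 0)
    X₂ = upd X₁ z R₂
    R₃ c = + 2 * X₂ u c + (+ 1 * X₂ v c + + 0)
    X₃ = upd X₂ u R₃
    X₂-other : ∀ {i} → z ≢ i → ∀ c → X₂ i c ≡ M i c
    X₂-other ne c = cong (λ r → r c) (trans (upd-other X₁ R₂ ne) (upd-other M R₁ ne))
    lem₁ : ∀ x y w → + 1 * (+ 1 * x + (+ 1 * y + + 0)) + (+ 1 * w + + 0) ≡ x + y + w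
    lem₁ = solve-∀
    lem₂ : ∀ x y → + 2 * x + (+ 1 * y + + 0) ≡ + 2 * x + y
    lem₂ = solve-∀

-- For a triangle on vertex 0 and two new vertices u, v, the operations of `Reduced` clear the
-- columns of v and u above the diagonal, leave the diagonal entries 2 and 2 · 2 - 1 = 3 there, and
-- restore row 0. Cancelling the factor 2 leaves 3.
module TriangleTrees {a a′ a″ N} (ext₁ : Extends a a′ (suc N) (δℕ 0))
  (ext₂ : Extends a′ a″ (suc (suc N)) (λ j → δℕ 0 j + δℕ (suc N) j)) where
  private
    module E₁ = Extension ext₁
    module E₂ = Extension ext₂
    n₀ : ℕ
    n₀ = suc N
    k : ℕ → ℕ → ℤ
    k = K a″ (suc (suc n₀))
    N≢ : ∀ {i} → i ℕ.< n₀ → δℕ n₀ i ≡ + 0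
    N≢ h = δℕ-≢ (λ e → ℕₚ.<⇒≢ h (sym e))
    oo : ∀ i j → i ℕ.< n₀ → j ℕ.< n₀ → k i j ≡ K a n₀ i j + + 2 * (δℕ 0 i * δℕ i j)
    oo i j hi hj = trans (E₂.K-old i j (ℕₚ.m<n⇒m<1+n hi) (ℕₚ.m<n⇒m<1+n hj))
      (trans (cong₂ (λ x y → x + (δℕ 0 i + y) * δℕ i j) (E₁.K-old i j hi hj) (N≢ hi)) (lem (K a n₀ i j) (δℕ 0 i) (δℕ i j)))
      where
      lem : ∀ k d e → k + d * e + (d + + 0) * e ≡ k + + 2 * (d * e)
      lem = solve-∀
    ou : ∀ i → i ℕ.< n₀ → k i n₀ ≡ - δℕ 0 i
    ou i hi = trans (E₂.K-old i n₀ (ℕₚ.m<n⇒m<1+n hi) (ℕₚ.n<1+n n₀))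
      (trans (cong₂ (λ x y → x + (δℕ 0 i + δℕ n₀ i) * y) (E₁.K-column i hi) (δℕ-≢ (ℕₚ.<⇒≢ hi))) (lem (- δℕ 0 i) (δℕ 0 i + δℕ n₀ i)))
      where
      lem : ∀ x y → x + y * + 0 ≡ x
      lem = solve-∀
    ov : ∀ i → i ℕ.< n₀ → k i (suc n₀) ≡ - δℕ 0 i
    ov i hi = trans (E₂.K-column i (ℕₚ.m<n⇒m<1+n hi)) (trans (cong (λ x → - (δℕ 0 i + x)) (N≢ hi)) (cong -_ (ℤₚ.+-identityʳ (δℕ 0 i))))
    uo : ∀ j → j ℕ.< n₀ → k n₀ j ≡ - δℕ 0 j
    uo j hj = trans (E₂.K-old n₀ j (ℕₚ.n<1+n n₀) (ℕₚ.m<n⇒m<1+n hj))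
      (trans (cong₂ (λ x y → x + (δℕ 0 n₀ + δℕ n₀ n₀) * y) (E₁.K-row j hj) (N≢ hj)) (lem (- δℕ 0 j) (δℕ 0 n₀ + δℕ n₀ n₀)))
      where
      lem : ∀ x y → x + y * + 0 ≡ x
      lem = solve-∀
    uu : k n₀ n₀ ≡ + 2
    uu = trans (E₂.K-old n₀ n₀ (ℕₚ.n<1+n n₀) (ℕₚ.n<1+n n₀))
      (trans (cong₂ (λ x y → x + (+ 0 + y) * y) (trans (E₁.K-corner (s≤s z≤n)) (Σ<-δ1 n₀ 0 (s≤s z≤n))) (δℕ-refl n₀)) refl)
    uv : k n₀ (suc n₀) ≡ - + 1
    uv = trans (E₂.K-column n₀ (ℕₚ.n<1+n n₀)) (cong (λ x → - (+ 0 + x)) (δℕ-refl n₀))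
    vo : ∀ j → j ℕ.< n₀ → k (suc n₀) j ≡ - δℕ 0 j
    vo j hj = trans (E₂.K-row j (ℕₚ.m<n⇒m<1+n hj)) (trans (cong (λ x → - (δℕ 0 j + x)) (N≢ hj)) (cong -_ (ℤₚ.+-identityʳ (δℕ 0 j))))
    vu : k (suc n₀) n₀ ≡ - + 1
    vu = trans (E₂.K-row n₀ (ℕₚ.n<1+n n₀)) (cong (λ x → - (+ 0 + x)) (δℕ-refl n₀))
    vv : k (suc n₀) (suc n₀) ≡ + 2
    vv = trans (E₂.K-corner (s≤s z≤n)) (trans (sum-+ {suc n₀} (λ j → δℕ 0 (toℕ j)) (λ j → δℕ n₀ (toℕ j)))
      (cong₂ _+_ (Σ<-δ1 (suc n₀) 0 (s≤s z≤n)) (Σ<-δ1 (suc n₀) n₀ (ℕₚ.n<1+n n₀))))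

    size : ℕ
    size = suc (suc n₀)
    M : Fin size → Row size
    M i j = k (toℕ i) (toℕ j)
    o : Fin n₀ → Fin size
    o i = inject₁ (inject₁ i)
    z u v : Fin size
    z = zero
    u = inject₁ (fromℕ n₀)
    v = fromℕ (suc n₀)
    o-toℕ : ∀ i → toℕ (o i) ≡ toℕ i
    o-toℕ i = trans (Finₚ.toℕ-inject₁ (inject₁ i)) (Finₚ.toℕ-inject₁ i)
    u-toℕ : toℕ u ≡ n₀
    u-toℕ = trans (Finₚ.toℕ-inject₁ (fromℕ n₀)) (Finₚ.toℕ-fromℕ n₀)
    v-toℕ : toℕ v ≡ suc n₀
    v-toℕ = Finₚ.toℕ-fromℕ (suc n₀)
    o≢u : ∀ i → u ≢ o i
    o≢u i e = Finₚ.fromℕ≢inject₁ (Finₚ.inject₁-injective e)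
    u≢v : u ≢ v
    u≢v e = Finₚ.fromℕ≢inject₁ (sym e)
    z≢v : z ≢ v
    z≢v ()
    z≢u : z ≢ u
    z≢u ()
    red : Reduced M z u v
    red = reduce M z≢u z≢v u≢v
    X₃ = Reduced.X red
    X-z = Reduced.row-z red
    X-u = Reduced.row-u red
    X-v : ∀ c → X₃ v c ≡ M v c
    X-v = Reduced.row-else red z≢v u≢v
    X-o : ∀ i c → X₃ (o (suc i)) c ≡ M (o (suc i)) c
    X-o i = Reduced.row-else red (λ ()) (o≢u (suc i))
    M-oo : ∀ i j → M (o i) (o j) ≡ K a n₀ (toℕ i) (toℕ j) + + 2 * (δℕ 0 (toℕ i) * δℕ (toℕ i) (toℕ j))
    M-oo i j = trans (cong₂ k (o-toℕ i) (o-toℕ j)) (oo (toℕ i) (toℕ j) (Finₚ.toℕ<n i) (Finₚ.toℕ<n j))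
    X-col-v : ∀ (i : Fin (suc n₀)) → X₃ (inject₁ i) v ≡ + 0
    X-col-v i with inject₁-or-last i
    ... | inj₁ (zero , refl) = trans (X-z v) (trans (cong₂ _+_ (cong₂ _+_ (trans (cong (k 0) v-toℕ) (ov 0 (s≤s z≤n))) (trans (cong₂ k u-toℕ v-toℕ) uv)) (trans (cong₂ k v-toℕ v-toℕ) vv)) refl)
    ... | inj₁ (suc j , refl) = trans (X-o j v) (trans (cong₂ k (o-toℕ (suc j)) v-toℕ) (ov (toℕ (suc j)) (Finₚ.toℕ<n (suc j))))
    ... | inj₂ refl = trans (X-u v) (trans (cong₂ (λ x y → + 2 * x + y) (trans (cong₂ k u-toℕ v-toℕ) uv) (trans (cong₂ k v-toℕ v-toℕ) vv)) refl)
    X-col-u : ∀ (i : Fin n₀) → X₃ (o i) u ≡ + 0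
    X-col-u zero = trans (X-z u) (trans (cong₂ _+_ (cong₂ _+_ (trans (cong (k 0) u-toℕ) (ou 0 (s≤s z≤n))) (trans (cong₂ k u-toℕ u-toℕ) uu)) (trans (cong₂ k v-toℕ u-toℕ) vu)) refl)
    X-col-u (suc j) = trans (X-o j u) (trans (cong₂ k (o-toℕ (suc j)) u-toℕ) (ou (toℕ (suc j)) (Finₚ.toℕ<n (suc j))))
    X-oo : ∀ (i j : Fin n₀) → X₃ (o i) (o j) ≡ K a n₀ (toℕ i) (toℕ j)
    X-oo zero j = trans (X-z (o j)) (trans (cong₂ _+_ (cong₂ _+_ (M-oo zero j) (trans (cong₂ k u-toℕ (o-toℕ j)) (uo (toℕ j) (Finₚ.toℕ<n j)))) (trans (cong₂ k v-toℕ (o-toℕ j)) (vo (toℕ j) (Finₚ.toℕ<n j))))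
        (lem (K a n₀ 0 (toℕ j)) (δℕ 0 (toℕ j))))
      where
      lem : ∀ k d → k + + 2 * (+ 1 * d) + - d + - d ≡ k
      lem = solve-∀
    X-oo (suc i) j = trans (X-o i (o j)) (trans (M-oo (suc i) j) (lem (K a n₀ (toℕ (suc i)) (toℕ j)) (δℕ (toℕ (suc i)) (toℕ j))))
      where
      lem : ∀ k d → k + + 2 * (+ 0 * d) ≡ k
      lem = solve-∀
    double : + 2 * det M ≡ + 2 * (+ 3 * treesℕ a n₀)
    double = begin
      + 2 * det M
        ≡⟨ Reduced.det-X red ⟩
      det X₃
        ≡⟨ det-last-column (suc n₀) X₃ X-col-v ⟩
      X₃ v v * det (λ i j → X₃ (inject₁ i) (inject₁ j))
        ≡⟨ cong₂ _*_ (trans (X-v v) (trans (cong₂ k v-toℕ v-toℕ) vv)) (trans (det-last-column n₀ (λ i j → X₃ (inject₁ i) (inject₁ j)) X-col-u)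
             (cong₂ _*_ (trans (X-u u) (trans (cong₂ (λ x y → + 2 * x + y) (trans (cong₂ k u-toℕ u-toℕ) uu) (trans (cong₂ k v-toℕ u-toℕ) vu)) refl)) (det-cong X-oo))) ⟩
      + 2 * (+ 3 * treesℕ a n₀) ∎
      where open ≡-Reasoning

  triangle-trees : treesℕ a″ size ≡ + 3 * treesℕ a n₀
  triangle-trees = ℤₚ.*-cancelˡ-≡ (+ 2) (det M) (+ 3 * treesℕ a n₀) double

-- The model graph

Edge : Set
Edge = ℕ × ℕ

match : Edge → ℕ → ℕ → Bool
match (x , y) i j = ((x ≡ᵇ i) ∧ (y ≡ᵇ j)) ∨ ((x ≡ᵇ j) ∧ (y ≡ᵇ i))

edgeIn-∷ : ∀ e es i j → edgeIn (e ∷ es) i j ≡ match e i j ∨ edgeIn es i j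
edgeIn-∷ (x , y) es i j = refl

edgeIn-++ : ∀ es fs i j → edgeIn (es ++ fs) i j ≡ edgeIn es i j ∨ edgeIn fs i j
edgeIn-++ [] fs i j = refl
edgeIn-++ (e ∷ es) fs i j = trans (edgeIn-∷ e (es ++ fs) i j) (trans (cong (match e i j ∨_) (edgeIn-++ es fs i j))
  (trans (sym (Boolₚ.∨-assoc (match e i j) (edgeIn es i j) (edgeIn fs i j))) (cong (_∨ edgeIn fs i j) (sym (edgeIn-∷ e es i j)))))

edgeIn-sym : ∀ es i j → edgeIn es i j ≡ edgeIn es j i
edgeIn-sym [] i j = refl
edgeIn-sym ((x , y) ∷ es) i j = cong₂ _∨_ (Boolₚ.∨-comm ((x ≡ᵇ i) ∧ (y ≡ᵇ j)) ((x ≡ᵇ j) ∧ (y ≡ᵇ i))) (edgeIn-sym es i j)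

-- The strict order of the end points rules out loops, and only the second one has to be compared
-- with `N`.
Bounded : ℕ → Edge → Set
Bounded N (x , y) = x ℕ.< y × y ℕ.< N

bounded-mono : ∀ {N N′} → N ℕ.≤ N′ → ∀ {e} → Bounded N e → Bounded N′ e
bounded-mono le (p , q) = p , ℕₚ.<-≤-trans q le

edgeIn-out : ∀ {N es} → All (Bounded N) es → ∀ {i j} → N ℕ.≤ j → edgeIn es i j ≡ false
edgeIn-out [] le = refl
edgeIn-out {N} {(x , y) ∷ es} ((xy , yN) ∷ bs) {i} {j} le = cong₂ _∨_ (cong₂ _∨_
    (trans (cong ((x ≡ᵇ i) ∧_) (≡ᵇ-≢ (ℕₚ.<⇒≢ (ℕₚ.<-≤-trans yN le)))) (Boolₚ.∧-zeroʳ (x ≡ᵇ i)))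
    (cong (_∧ (y ≡ᵇ i)) (≡ᵇ-≢ (ℕₚ.<⇒≢ (ℕₚ.<-≤-trans (ℕₚ.<-trans xy yN) le)))))
  (edgeIn-out bs le)

edgeIn-irrefl : ∀ {N es} → All (Bounded N) es → ∀ i → edgeIn es i i ≡ false
edgeIn-irrefl [] i = refl
edgeIn-irrefl {N} {(x , y) ∷ es} ((xy , _) ∷ bs) i = cong₂ _∨_ (trans (cong₂ _∨_ (no-loop (x ℕ.≟ i)) (no-loop (x ℕ.≟ i))) refl) (edgeIn-irrefl bs i)
  where
  no-loop : Dec (x ≡ i) → (x ≡ᵇ i) ∧ (y ≡ᵇ i) ≡ false
  no-loop (yes refl) = trans (cong ((x ≡ᵇ x) ∧_) (≡ᵇ-≢ (λ e → ℕₚ.<⇒≢ xy (sym e)))) (Boolₚ.∧-zeroʳ (x ≡ᵇ x))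
  no-loop (no ne) = cong (_∧ (y ≡ᵇ i)) (≡ᵇ-≢ ne)

w : List Edge → Weights
w es i j = b2ℤ (edgeIn es i j)

match-old : ∀ {N p i j} → i ℕ.< N → j ℕ.< N → match (p , N) i j ≡ false
match-old {N} {p} {i} {j} hi hj = cong₂ _∨_
  (trans (cong ((p ≡ᵇ i) ∧_) (≡ᵇ-≢ (λ e → ℕₚ.<⇒≢ hj (sym e)))) (Boolₚ.∧-zeroʳ (p ≡ᵇ i)))
  (trans (cong ((p ≡ᵇ j) ∧_) (≡ᵇ-≢ (λ e → ℕₚ.<⇒≢ hi (sym e)))) (Boolₚ.∧-zeroʳ (p ≡ᵇ j)))

match-column : ∀ {N p} → p ℕ.< N → ∀ i → match (p , N) i N ≡ (p ≡ᵇ i)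
match-column {N} {p} hp i = trans (cong₂ _∨_ (trans (cong ((p ≡ᵇ i) ∧_) (≡ᵇ-refl N)) (Boolₚ.∧-identityʳ (p ≡ᵇ i)))
  (cong (_∧ (N ≡ᵇ i)) (≡ᵇ-≢ (ℕₚ.<⇒≢ hp)))) (Boolₚ.∨-identityʳ (p ≡ᵇ i))

extend-leaf : ∀ {N es p} → All (Bounded N) es → p ℕ.< N → Extends (w es) (w (es ++ (p , N) ∷ [])) N (δℕ p)
extend-leaf {N} {es} {p} bs hp = record
  { old = λ i j hi hj → cong b2ℤ (trans (edgeIn-++ es _ i j) (trans (cong (λ m → edgeIn es i j ∨ (m ∨ false)) (match-old {N} {p} hi hj)) (Boolₚ.∨-identityʳ (edgeIn es i j))))
  ; row = λ j hj → cong b2ℤ (trans (edgeIn-sym (es ++ (p , N) ∷ []) N j) (col j))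
  ; column = λ j hj → cong b2ℤ (col j)
  ; corner = cong b2ℤ (trans (col N) (≡ᵇ-≢ (ℕₚ.<⇒≢ hp)))
  }
  where
  col : ∀ j → edgeIn (es ++ (p , N) ∷ []) j N ≡ (p ≡ᵇ j)
  col j = trans (edgeIn-++ es _ j N) (trans (cong₂ (λ e m → e ∨ (m ∨ false)) (edgeIn-out bs ℕₚ.≤-refl) (match-column hp j)) (Boolₚ.∨-identityʳ (p ≡ᵇ j)))

extend-two : ∀ {N es p q} → All (Bounded N) es → p ℕ.< N → q ℕ.< N → p ≢ q →
  Extends (w es) (w (es ++ (p , N) ∷ (q , N) ∷ [])) N (λ j → δℕ p j + δℕ q j)
extend-two {N} {es} {p} {q} bs hp hq p≢q = record
  { old = λ i j hi hj → cong b2ℤ (trans (edgeIn-++ es _ i j) (trans (cong₂ (λ m m′ → edgeIn es i j ∨ (m ∨ (m′ ∨ false))) (match-old {N} {p} hi hj) (match-old {N} {q} hi hj)) (Boolₚ.∨-identityʳ (edgeIn es i j))))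
  ; row = λ j hj → trans (cong b2ℤ (trans (edgeIn-sym fs N j) (col j))) (split j)
  ; column = λ j hj → trans (cong b2ℤ (col j)) (split j)
  ; corner = trans (cong b2ℤ (trans (col N) (cong₂ _∨_ (≡ᵇ-≢ (ℕₚ.<⇒≢ hp)) (≡ᵇ-≢ (ℕₚ.<⇒≢ hq))))) refl
  }
  where
  fs : List Edge
  fs = es ++ (p , N) ∷ (q , N) ∷ []
  col : ∀ j → edgeIn fs j N ≡ (p ≡ᵇ j) ∨ (q ≡ᵇ j)
  col j = trans (edgeIn-++ es _ j N) (trans (cong₂ (λ e m → e ∨ (m ∨ (match (q , N) j N ∨ false))) (edgeIn-out bs ℕₚ.≤-refl) (match-column hp j))
    (cong ((p ≡ᵇ j) ∨_) (trans (Boolₚ.∨-identityʳ (match (q , N) j N)) (match-column hq j))))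
  split : ∀ j → b2ℤ ((p ≡ᵇ j) ∨ (q ≡ᵇ j)) ≡ δℕ p j + δℕ q j
  split j with p ℕ.≟ j
  ... | no ne rewrite ≡ᵇ-≢ ne = sym (ℤₚ.+-identityˡ (δℕ q j))
  ... | yes refl rewrite ≡ᵇ-refl p | ≡ᵇ-≢ (λ e → p≢q (sym e)) = refl

-- Kept for arbitrary `g`, so that a single invariant covers the order and every degree sum needed
-- later.
Σ-bump : ∀ N (g : ℤ → ℤ) (d : ℕ → ℤ) p → p ℕ.< N →
  Σ< N (λ i → g (d i + δℕ p i)) ≡ Σ< N (λ i → g (d i)) + (g (d p + + 1) - g (d p))
Σ-bump N g d p hp = trans (sum-cong {N} (λ i → bump (toℕ i) (p ℕ.≟ toℕ i)))
  (trans (sum-+ {N} (λ i → g (d (toℕ i))) (λ i → δℕ p (toℕ i) * Δ (toℕ i))) (cong (_+_ (Σ< N (λ i → g (d i)))) (Σ<-δ N p Δ hp)))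
  where
  Δ : ℕ → ℤ
  Δ i = g (d i + + 1) - g (d i)
  lem₁ : ∀ x y → x ≡ y + + 1 * (x - y)
  lem₁ = solve-∀
  lem₂ : ∀ x z → x ≡ x + + 0 * z
  lem₂ = solve-∀
  bump : ∀ i → Dec (p ≡ i) → g (d i + δℕ p i) ≡ g (d i) + δℕ p i * Δ i
  bump i (yes refl) = trans (cong (λ e → g (d i + e)) (δℕ-refl i)) (trans (lem₁ (g (d i + + 1)) (g (d i))) (cong (λ e → g (d i) + e * Δ i) (sym (δℕ-refl i))))
  bump i (no ne) = trans (cong (λ e → g (d i + e)) (δℕ-≢ ne)) (trans (cong g (ℤₚ.+-identityʳ (d i))) (trans (lem₂ (g (d i)) (Δ i)) (cong (λ e → g (d i) + e * Δ i) (sym (δℕ-≢ ne)))))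

-- The center 0 has degree dc, and of the other vertices `twos` have degree 2 and `ones` degree 1.
record Stage (es : List Edge) (N dc ones w₃ t : ℕ) : Set where
  field
    positive : 0 ℕ.< N
    bounded  : All (Bounded N) es
    center   : deg (w es) N 0 ≡ + dc
    twos     : ℕ
    degrees  : ∀ (g : ℤ → ℤ) → Σ< N (λ i → g (deg (w es) N i)) ≡ g (+ dc) + (+ twos * g (+ 2) + + ones * g (+ 1))
    closed₃  : walks (w es) N ≡ + w₃
    trees≡   : treesℕ (w es) N ≡ + t

stage₀ : Stage [] 1 0 0 0 1
stage₀ = record
  { positive = s≤s z≤n ; bounded = [] ; center = refl ; twos = 0
  ; degrees = λ g → lem (g (+ 0)) (g (+ 2)) (g (+ 1)) ; closed₃ = refl ; trees≡ = refl }
  where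
  lem : ∀ a b c → a + + 0 ≡ a + (+ 0 * b + + 0 * c)
  lem = solve-∀

walks-leaf : ∀ {N es p} → All (Bounded N) es → p ℕ.< N → walks (w (es ++ (p , N) ∷ [])) (suc N) ≡ walks (w es) N
walks-leaf {N} {es} {p} bs hp = trans (Extension.walks-new (extend-leaf bs hp)) (trans (cong (λ x → walks (w es) N + + 3 * x)
    (trans (Σ<-δ N p (λ i → Σ< N (λ j → w es i j * δℕ p j)) hp) (trans (Σ<-cong N (λ j _ → ℤₚ.*-comm (w es p j) (δℕ p j)))
      (trans (Σ<-δ N p (w es p) hp) (cong b2ℤ (edgeIn-irrefl bs p))))))
  (ℤₚ.+-identityʳ (walks (w es) N)))

module _ {es N dc ones w₃ t} (S : Stage es N dc ones w₃ t) where
  open Stage S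

  attach-center : Stage (es ++ (0 , N) ∷ []) (suc N) (suc dc) (suc ones) w₃ t
  attach-center = record
    { positive = s≤s z≤n
    ; bounded = Allₚ.++⁺ (All.map (λ {e} → bounded-mono (ℕₚ.n≤1+n N) {e}) bounded) ((positive , ℕₚ.n<1+n N) ∷ [])
    ; center = trans (E.deg-old 0 positive) (trans (cong (_+ + 1) center) (cong +_ (ℕₚ.+-comm dc 1)))
    ; twos = twos
    ; degrees = λ g → trans (E.Σ-deg g) (trans (cong₂ (λ x y → x + g y) (Σ-bump N g (deg (w es) N) 0 positive) (Σ<-δ1 N 0 positive))
        (trans (cong₂ (λ x y → x + y + g (+ 1)) (degrees g) (cong₂ _-_ (cong g (trans (cong (_+ + 1) center) (cong +_ (ℕₚ.+-comm dc 1)))) (cong g center)))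
          (lem (g (+ dc)) (+ twos * g (+ 2)) (+ ones) (g (+ 1)) (g (+ suc dc)))))
    ; closed₃ = trans (walks-leaf bounded positive) closed₃
    ; trees≡ = trans (LeafTrees.leaf-trees (extend-leaf bounded positive) positive) trees≡
    }
    where
    module E = Extension (extend-leaf {p = 0} bounded positive)
    lem : ∀ d a o x d′ → d + (a + o * x) + (d′ - d) + x ≡ d′ + (a + (+ 1 + o) * x)
    lem = solve-∀

  attach-center-last : deg (w (es ++ (0 , N) ∷ [])) (suc N) N ≡ + 1
  attach-center-last = trans (Extension.deg-new (extend-leaf {p = 0} bounded positive)) (Σ<-δ1 N 0 positive)

  -- A triangle is a leaf at the center followed by a vertex joined to the center and to that leaf,
  -- so two one-vertex extensions suffice. The new triangle accounts for six closed 3-walks.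
  attach-triangle : Stage (es ++ (0 , N) ∷ (0 , suc N) ∷ (N , suc N) ∷ []) (2 ℕ.+ N) (2 ℕ.+ dc) ones (6 ℕ.+ w₃) (3 ℕ.* t)
  attach-triangle = subst (λ l → Stage l (2 ℕ.+ N) (2 ℕ.+ dc) ones (6 ℕ.+ w₃) (3 ℕ.* t)) (Listₚ.++-assoc es _ _) (record
    { positive = s≤s z≤n
    ; bounded = Allₚ.++⁺ (All.map (λ {e} → bounded-mono (ℕₚ.n≤1+n (suc N)) {e}) S₁.bounded) ((s≤s z≤n , ℕₚ.n<1+n (suc N)) ∷ (ℕₚ.n<1+n N , ℕₚ.n<1+n (suc N)) ∷ [])
    ; center = trans (E.deg-old 0 (s≤s z≤n)) (trans (cong₂ (λ x y → x + (+ 1 + y)) S₁.center (δℕ-≢ (λ e → 0≢N (sym e)))) (cong +_ (ℕₚ.+-comm (suc dc) 1)))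
    ; twos = 2 ℕ.+ twos
    ; degrees = degrees′
    ; closed₃ = trans E.walks-new (cong₂ (λ x y → x + + 3 * y) S₁.closed₃ cross ∙ cong +_ (ℕₚ.+-comm w₃ 6))
    ; trees≡ = trees′ N positive bounded trees≡
    })
    where
    infixl 5 _∙_
    _∙_ : ∀ {x y z : ℤ} → x ≡ y → y ≡ z → x ≡ z
    _∙_ = trans
    es₁ : List Edge
    es₁ = es ++ (0 , N) ∷ []
    module S₁ = Stage attach-center
    0≢N : 0 ≢ N
    0≢N = ℕₚ.<⇒≢ positive
    ext₂ = extend-two {suc N} {es₁} {0} {N} S₁.bounded (s≤s z≤n) (ℕₚ.n<1+n N) 0≢N
    module E₁ = Extension (extend-leaf {p = 0} bounded positive)
    module E = Extension ext₂
    a₁ = w es₁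
    cross : Σ< (suc N) (λ i → (δℕ 0 i + δℕ N i) * Σ< (suc N) (λ j → a₁ i j * (δℕ 0 j + δℕ N j))) ≡ + 2
    cross = trans (sum-cong {suc N} (λ i → ℤₚ.*-distribʳ-+ (row (toℕ i)) (δℕ 0 (toℕ i)) (δℕ N (toℕ i))))
      (trans (sum-+ {suc N} (λ i → δℕ 0 (toℕ i) * row (toℕ i)) (λ i → δℕ N (toℕ i) * row (toℕ i)))
        (trans (cong₂ _+_ (Σ<-δ (suc N) 0 row (s≤s z≤n)) (Σ<-δ (suc N) N row (ℕₚ.n<1+n N)))
          (trans (cong₂ _+_ (row≡ 0) (row≡ N)) (trans (cong₂ _+_ (cong₂ _+_ (cong b2ℤ (edgeIn-irrefl S₁.bounded 0)) (Ex.column 0 positive)) (cong₂ _+_ (Ex.row 0 positive) Ex.corner)) refl))))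
      where
      module Ex = Extends (extend-leaf {p = 0} bounded positive)
      row : ℕ → ℤ
      row i = Σ< (suc N) (λ j → a₁ i j * (δℕ 0 j + δℕ N j))
      lem : ∀ x y z → x * (y + z) ≡ y * x + z * x
      lem = solve-∀
      row≡ : ∀ i → row i ≡ a₁ i 0 + a₁ i N
      row≡ i = trans (sum-cong {suc N} (λ j → lem (a₁ i (toℕ j)) (δℕ 0 (toℕ j)) (δℕ N (toℕ j))))
        (trans (sum-+ {suc N} (λ j → δℕ 0 (toℕ j) * a₁ i (toℕ j)) (λ j → δℕ N (toℕ j) * a₁ i (toℕ j)))
          (cong₂ _+_ (Σ<-δ (suc N) 0 (a₁ i) (s≤s z≤n)) (Σ<-δ (suc N) N (a₁ i) (ℕₚ.n<1+n N))))
    degrees′ : ∀ (g : ℤ → ℤ) → Σ< (2 ℕ.+ N) (λ i → g (deg (w (es₁ ++ (0 , suc N) ∷ (N , suc N) ∷ [])) (2 ℕ.+ N) i)) ≡ g (+ (2 ℕ.+ dc)) + (+ (2 ℕ.+ twos) * g (+ 2) + + ones * g (+ 1))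
    degrees′ g = begin
      Σ< (2 ℕ.+ N) (λ i → g (deg (w (es₁ ++ (0 , suc N) ∷ (N , suc N) ∷ [])) (2 ℕ.+ N) i))
        ≡⟨ E.Σ-deg g ⟩
      Σ< (suc N) (λ i → g (d₁ i + (δℕ 0 i + δℕ N i))) + g (Σ< (suc N) (λ j → δℕ 0 j + δℕ N j))
        ≡⟨ cong₂ _+_ (sum-cong {suc N} (λ i → cong g (sym (ℤₚ.+-assoc (d₁ (toℕ i)) (δℕ 0 (toℕ i)) (δℕ N (toℕ i))))))
             (cong g (trans (sum-+ {suc N} (λ j → δℕ 0 (toℕ j)) (λ j → δℕ N (toℕ j))) (cong₂ _+_ (Σ<-δ1 (suc N) 0 (s≤s z≤n)) (Σ<-δ1 (suc N) N (ℕₚ.n<1+n N))))) ⟩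
      Σ< (suc N) (λ i → g (d₁ i + δℕ 0 i + δℕ N i)) + g (+ 2)
        ≡⟨ cong (_+ g (+ 2)) (Σ-bump (suc N) g (λ i → d₁ i + δℕ 0 i) N (ℕₚ.n<1+n N)) ⟩
      Σ< (suc N) (λ i → g (d₁ i + δℕ 0 i)) + (g (d₁ N + δℕ 0 N + + 1) - g (d₁ N + δℕ 0 N)) + g (+ 2)
        ≡⟨ cong₂ (λ x y → x + (g (y + + 1) - g y) + g (+ 2)) (Σ-bump (suc N) g d₁ 0 (s≤s z≤n)) (cong₂ _+_ attach-center-last (δℕ-≢ 0≢N)) ⟩
      Σ< (suc N) (λ i → g (d₁ i)) + (g (d₁ 0 + + 1) - g (d₁ 0)) + (g (+ 2) - g (+ 1)) + g (+ 2)
        ≡⟨ cong₂ (λ x y → x + (g (y + + 1) - g y) + (g (+ 2) - g (+ 1)) + g (+ 2)) (S₁.degrees g) S₁.center ⟩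
      g (+ suc dc) + (+ twos * g (+ 2) + + suc ones * g (+ 1)) + (g (+ suc dc + + 1) - g (+ suc dc)) + (g (+ 2) - g (+ 1)) + g (+ 2)
        ≡⟨ cong (λ y → g (+ suc dc) + (+ twos * g (+ 2) + + suc ones * g (+ 1)) + (g y - g (+ suc dc)) + (g (+ 2) - g (+ 1)) + g (+ 2)) (cong +_ (ℕₚ.+-comm (suc dc) 1)) ⟩
      g (+ suc dc) + (+ twos * g (+ 2) + (+ 1 + + ones) * g (+ 1)) + (g (+ (2 ℕ.+ dc)) - g (+ suc dc)) + (g (+ 2) - g (+ 1)) + g (+ 2)
        ≡⟨ lem (g (+ suc dc)) (+ twos) (g (+ 2)) (+ ones) (g (+ 1)) (g (+ (2 ℕ.+ dc))) ⟩
      g (+ (2 ℕ.+ dc)) + ((+ 2 + + twos) * g (+ 2) + + ones * g (+ 1)) ∎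
      where
      open ≡-Reasoning
      d₁ : ℕ → ℤ
      d₁ = deg a₁ (suc N)
      lem : ∀ d c x o y d′ → d + (c * x + (+ 1 + o) * y) + (d′ - d) + (x - y) + x ≡ d′ + ((+ 2 + c) * x + o * y)
      lem = solve-∀
    -- `N` is generalised so that it can be matched as a successor, the form in which
    -- `TriangleTrees` is stated.
    trees′ : ∀ N (pos : 0 ℕ.< N) (bs : All (Bounded N) es) → treesℕ (w es) N ≡ + t →
      treesℕ (w ((es ++ (0 , N) ∷ []) ++ (0 , suc N) ∷ (N , suc N) ∷ [])) (2 ℕ.+ N) ≡ + (3 ℕ.* t)
    trees′ (suc N) pos bs e = trans (TriangleTrees.triangle-trees (extend-leaf bs pos)
      (extend-two {suc (suc N)} {es ++ (0 , suc N) ∷ []} {0} {suc N}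
        (Allₚ.++⁺ (All.map (λ {e} → bounded-mono (ℕₚ.n≤1+n (suc N)) {e}) bs) ((pos , ℕₚ.n<1+n (suc N)) ∷ [])) (s≤s z≤n) (ℕₚ.n<1+n (suc N)) (λ ())))
      (trans (cong (+ 3 *_) e) (sym (ℤₚ.pos-* 3 t)))

module _ {es M dc ones w₃ t} (S : Stage es (suc M) dc ones w₃ t) (0<M : 0 ℕ.< M) (last : deg (w es) (suc M) M ≡ + 1) where
  open Stage S

  attach-last : Stage (es ++ (M , suc M) ∷ []) (2 ℕ.+ M) dc ones w₃ t
  attach-last = record
    { positive = s≤s z≤n
    ; bounded = Allₚ.++⁺ (All.map (λ {e} → bounded-mono (ℕₚ.n≤1+n (suc M)) {e}) bounded) ((ℕₚ.n<1+n M , ℕₚ.n<1+n (suc M)) ∷ [])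
    ; center = trans (E.deg-old 0 positive) (trans (cong₂ _+_ center (δℕ-≢ (λ e → ℕₚ.<⇒≢ 0<M (sym e)))) (ℤₚ.+-identityʳ (+ dc)))
    ; twos = suc twos
    ; degrees = λ g → trans (E.Σ-deg g) (trans (cong₂ (λ x y → x + g y) (Σ-bump (suc M) g (deg (w es) (suc M)) M (ℕₚ.n<1+n M)) (Σ<-δ1 (suc M) M (ℕₚ.n<1+n M)))
        (trans (cong₂ (λ x y → x + (g (y + + 1) - g y) + g (+ 1)) (degrees g) last)
          (lem (g (+ dc)) (+ twos) (g (+ 2)) (+ ones * g (+ 1)) (g (+ 1)))))
    ; closed₃ = trans (walks-leaf bounded (ℕₚ.n<1+n M)) closed₃
    ; trees≡ = trans (LeafTrees.leaf-trees (extend-leaf bounded (ℕₚ.n<1+n M)) (ℕₚ.n<1+n M)) trees≡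
    }
    where
    module E = Extension (extend-leaf {p = M} bounded (ℕₚ.n<1+n M))
    lem : ∀ d c x o y → d + (c * x + o) + (x - y) + y ≡ d + ((+ 1 + c) * x + o)
    lem = solve-∀

  attach-last-last : deg (w (es ++ (M , suc M) ∷ [])) (2 ℕ.+ M) (suc M) ≡ + 1
  attach-last-last = trans (Extension.deg-new (extend-leaf {p = M} bounded (ℕₚ.n<1+n M))) (Σ<-δ1 (suc M) M (ℕₚ.n<1+n M))

stage-triangles : ∀ s → Stage (triEdges s) (1 ℕ.+ 2 ℕ.* s) (2 ℕ.* s) 0 (6 ℕ.* s) (3 ℕ.^ s)
stage-triangles zero = stage₀
stage-triangles (suc s) = subst (λ z → Stage (triEdges (suc s)) (1 ℕ.+ z) z 0 (6 ℕ.* suc s) (3 ℕ.^ suc s)) (sym (ℕₚ.*-suc 2 s))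
  (subst (λ z → Stage (triEdges (suc s)) (3 ℕ.+ 2 ℕ.* s) (2 ℕ.+ 2 ℕ.* s) 0 z (3 ℕ.^ suc s)) (sym (ℕₚ.*-suc 6 s)) (attach-triangle (stage-triangles s)))

-- The current end `M` has degree 1 and is not the center, so each step turns one vertex of degree 1
-- into one of degree 2 and creates a new end: only `twos` changes.
stage-chain : ∀ l {es M dc ones w₃ t} → Stage es (suc M) dc ones w₃ t → 0 ℕ.< M → deg (w es) (suc M) M ≡ + 1 →
  Stage (es ++ chain M (suc M) l) (suc M ℕ.+ l) dc ones w₃ t
stage-chain zero {es} {M} {dc} {ones} {w₃} {t} S 0<M last =
  subst₂ (λ l N → Stage l N dc ones w₃ t) (sym (Listₚ.++-identityʳ es)) (sym (ℕₚ.+-identityʳ (suc M))) S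
stage-chain (suc l) {es} {M} {dc} {ones} {w₃} {t} S 0<M last =
  subst₂ (λ es N → Stage es N dc ones w₃ t) (Listₚ.++-assoc es _ _) (sym (ℕₚ.+-suc (suc M) l))
    (stage-chain l (attach-last S 0<M last) (s≤s z≤n) (attach-last-last S 0<M last))

stage-paths : ∀ ls → All (1 ℕ.≤_) ls → ∀ {es N dc ones w₃ t} → Stage es N dc ones w₃ t →
  Stage (es ++ pathEdges N ls) (N ℕ.+ sumℕ ls) (dc ℕ.+ length ls) (ones ℕ.+ length ls) w₃ t
stage-paths [] [] {es} {N} {dc} {ones} {w₃} {t} S rewrite Listₚ.++-identityʳ es | ℕₚ.+-identityʳ N | ℕₚ.+-identityʳ dc | ℕₚ.+-identityʳ ones = S
stage-paths (suc l ∷ ls) (_ ∷ hs) {es} {N} {dc} {ones} {w₃} {t} S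
  rewrite ℕₚ.+-suc dc (length ls) | ℕₚ.+-suc ones (length ls) | sym (ℕₚ.+-assoc N (suc l) (sumℕ ls)) =
  subst (λ es → Stage es (N ℕ.+ suc l ℕ.+ sumℕ ls) (suc (dc ℕ.+ length ls)) (suc (ones ℕ.+ length ls)) w₃ t) (Listₚ.++-assoc es _ _)
    (stage-paths ls hs (subst₂ (λ es N → Stage es N (suc dc) (suc ones) w₃ t) (Listₚ.++-assoc es _ _) (sym (ℕₚ.+-suc N l))
      (stage-chain l (attach-center S) (Stage.positive S) (attach-center-last S))))

stage-model : ∀ s ls → All (1 ℕ.≤_) ls → Stage (pfEdges s ls) (pfOrder s ls) (2 ℕ.* s ℕ.+ length ls) (length ls) (6 ℕ.* s) (3 ℕ.^ s)
stage-model s ls hs = stage-paths ls hs (stage-triangles s)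

-- Reconstruction

sum-bijection : ∀ {m n} (φ : Fin m → Fin n) (ψ : Fin n → Fin m) → (∀ v → φ (ψ v) ≡ v) → (∀ i → ψ (φ i) ≡ i) →
  ∀ F → sumFin (λ i → F (φ i)) ≡ sumFin F
sum-bijection φ ψ φψ ψφ F = trans (sum-cong (λ i → sym (sum-δ (φ i) F)))
  (trans (sum-swap (λ i v → δ (φ i) v * F v)) (sum-cong (λ v → trans (sum-*ʳ (F v) (λ i → δ (φ i) v))
    (trans (cong (_* F v) (trans (sum-cong (λ i → transpose i v)) (sum-δ1 (ψ v)))) (ℤₚ.*-identityˡ (F v))))))
  where
  transpose : ∀ i v → δ (φ i) v ≡ δ (ψ v) i
  transpose i v with ψ v ≟ i
  ... | yes refl = trans (cong (λ x → δ x v) (φψ v)) (trans (δ-refl v) (sym (δ-refl (ψ v))))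
  ... | no ne = trans (δ-≢ (λ e → ne (trans (cong ψ (sym e)) (ψφ i)))) (sym (δ-≢ ne))

adj-nonzero : ∀ {n} (G : Graph n) {i j} x → A G i j * x ≢ + 0 → adj G i j ≡ true
adj-nonzero G {i} {j} x ne = go (adj G i j) refl
  where
  go : ∀ b → adj G i j ≡ b → adj G i j ≡ true
  go true e = e
  go false e = ⊥-elim (ne (trans (cong (λ b → b2ℤ b * x) e) (ℤₚ.*-zeroˡ x)))

module Structure {n} (H : Graph (suc n)) (connected : Connected H) (c : Fin (suc n))
  (deg≤2 : ∀ v → c ≢ v → degree H v ≤ + 2) where
  private
    V = Fin (suc n)
    a = A H

  neighbours : ∀ {v p q} → c ≢ v → p ≢ q → adj H v p ≡ true → adj H v q ≡ true → ∀ {w} → adj H v w ≡ true → w ≡ p ⊎ w ≡ q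
  neighbours {v} {p} {q} c≢v p≢q vp vq {w} vw = go (w ≟ p) (w ≟ q)
    where
    three : + 3 ≤ + 2 → ⊥
    three (+≤+ (s≤s (s≤s ())))
    go : Dec (w ≡ p) → Dec (w ≡ q) → w ≡ p ⊎ w ≡ q
    go (yes e) _ = inj₁ e
    go (no _) (yes e) = inj₂ e
    go (no wp) (no wq) = ⊥-elim (three (ℤₚ.≤-trans
      (subst (_≤ degree H v) (cong₂ _+_ (A-true H vw) (cong₂ _+_ (A-true H vp) (A-true H vq))) (sum≥3 (λ j → b2ℤ-nonneg (adj H v j)) wp wq p≢q))
      (deg≤2 v c≢v)))

  -- A triangle whose vertices have degree at most 2 is a whole component, and by connectedness that
  -- component contains `c`.
  triangle-center : ∀ {x y z} → adj H x y ≡ true → adj H y z ≡ true → adj H z x ≡ true → c ≢ x → c ≢ y → c ≢ z → ⊥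
  triangle-center {x} {y} {z} xy yz zx cx cy cz = outside (connected S closed {x} (member (inj₁ refl)) c)
    where
    S : V → Bool
    S i = ⌊ x ≟ i ⌋ ∨ (⌊ y ≟ i ⌋ ∨ ⌊ z ≟ i ⌋)
    member : ∀ {i} → x ≡ i ⊎ (y ≡ i ⊎ z ≡ i) → S i ≡ true
    member {i} h with x ≟ i | y ≟ i | z ≟ i
    ... | yes _ | _ | _ = refl
    ... | no _ | yes _ | _ = refl
    ... | no _ | no _ | yes _ = refl
    member (inj₁ e) | no p | no _ | no _ = ⊥-elim (p e)
    member (inj₂ (inj₁ e)) | no _ | no p | no _ = ⊥-elim (p e)
    member (inj₂ (inj₂ e)) | no _ | no _ | no p = ⊥-elim (p e)
    only : ∀ {i} → S i ≡ true → x ≡ i ⊎ (y ≡ i ⊎ z ≡ i)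
    only {i} h with x ≟ i | y ≟ i | z ≟ i
    ... | yes e | _ | _ = inj₁ e
    ... | no _ | yes e | _ = inj₂ (inj₁ e)
    ... | no _ | no _ | yes e = inj₂ (inj₂ e)
    outside : S c ≡ true → ⊥
    outside h with only h
    ... | inj₁ e = cx (sym e)
    ... | inj₂ (inj₁ e) = cy (sym e)
    ... | inj₂ (inj₂ e) = cz (sym e)
    closed : ∀ i j → S i ≡ true → adj H i j ≡ true → S j ≡ true
    closed i j h ij with only {i} h
    ... | inj₁ refl with neighbours cx (adj-≢ H yz) xy (adj-flip H zx) ij
    ...   | inj₁ refl = member (inj₂ (inj₁ refl))
    ...   | inj₂ refl = member (inj₂ (inj₂ refl))
    closed i j h ij | inj₂ (inj₁ refl) with neighbours cy (adj-≢ H zx) yz (adj-flip H xy) ij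
    ...   | inj₁ refl = member (inj₂ (inj₂ refl))
    ...   | inj₂ refl = member (inj₁ refl)
    closed i j h ij | inj₂ (inj₂ refl) with neighbours cz (adj-≢ H xy) zx (adj-flip H yz) ij
    ...   | inj₁ refl = member (inj₁ refl)
    ...   | inj₂ refl = member (inj₂ (inj₁ refl))

  -- The number of triangles through the edge cv (0 if c and v are not adjacent).
  r : V → ℤ
  r v = a c v * sumFin (λ w → a v w * a w c)

  -- Every closed 3-walk runs around a triangle and so meets `c` exactly once, at one of three
  -- positions.
  closedWalks₃≡3Σr : closedWalks₃ H ≡ + 3 * sumFin r
  closedWalks₃≡3Σr = begin
    sumFin (λ i → sumFin (λ j → sumFin (λ k → a i k * a k j) * a j i))
      ≡⟨ sum-cong (λ i → sum-cong (λ j → trans (sym (sum-*ʳ (a j i) (λ k → a i k * a k j))) (sum-cong (λ k → once i j k)))) ⟩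
    sumFin (λ i → sumFin (λ j → sumFin (λ k → δ c i * t i j k + (δ c j * t i j k + δ c k * t i j k))))
      ≡⟨ sum-cong (λ i → sum-cong (λ j → trans (sum-+ (λ k → δ c i * t i j k) (λ k → δ c j * t i j k + δ c k * t i j k))
           (cong₂ _+_ (sum-*ˡ (δ c i) (t i j)) (trans (sum-+ (λ k → δ c j * t i j k) (λ k → δ c k * t i j k)) (cong₂ _+_ (sum-*ˡ (δ c j) (t i j)) (sum-δ c (t i j))))))) ⟩
    sumFin (λ i → sumFin (λ j → δ c i * sumFin (t i j) + (δ c j * sumFin (t i j) + t i j c)))
      ≡⟨ sum-cong (λ i → trans (sum-+ (λ j → δ c i * sumFin (t i j)) (λ j → δ c j * sumFin (t i j) + t i j c))
           (cong₂ _+_ (sum-*ˡ (δ c i) (λ j → sumFin (t i j))) (trans (sum-+ (λ j → δ c j * sumFin (t i j)) (λ j → t i j c)) (cong (_+ sumFin (λ j → t i j c)) (sum-δ c (λ j → sumFin (t i j))))))) ⟩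
    sumFin (λ i → δ c i * sumFin (λ j → sumFin (t i j)) + (sumFin (t i c) + sumFin (λ j → t i j c)))
      ≡⟨ trans (sum-+ (λ i → δ c i * sumFin (λ j → sumFin (t i j))) (λ i → sumFin (t i c) + sumFin (λ j → t i j c)))
           (cong₂ _+_ (sum-δ c (λ i → sumFin (λ j → sumFin (t i j)))) (sum-+ (λ i → sumFin (t i c)) (λ i → sumFin (λ j → t i j c)))) ⟩
    sumFin (λ j → sumFin (t c j)) + (sumFin (λ i → sumFin (t i c)) + sumFin (λ i → sumFin (λ j → t i j c)))
      ≡⟨ cong₂ _+_ (trans (sum-swap (λ j k → t c j k)) (sum-cong (λ k → fold k (λ j → t c j k) (λ j → ℤₚ.*-assoc (a c k) (a k j) (a j c)))))
           (cong₂ _+_ (sum-cong (λ i → fold i (t i c) (λ k → lem₁ (a i k) (a k c) (a c i))))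
             (trans (sum-swap (λ i j → t i j c)) (sum-cong (λ j → fold j (λ i → t i j c) (λ i → lem₂ (a i c) (a c j) (a j i)))))) ⟩
    sumFin r + (sumFin r + sumFin r)
      ≡⟨ lem₃ (sumFin r) ⟩
    + 3 * sumFin r ∎
    where
    open ≡-Reasoning
    t : V → V → V → ℤ
    t i j k = a i k * a k j * a j i
    lem₁ : ∀ x y z → x * y * z ≡ z * (x * y)
    lem₁ = solve-∀
    lem₂ : ∀ x y z → x * y * z ≡ y * (z * x)
    lem₂ = solve-∀
    lem₃ : ∀ x → x + (x + x) ≡ + 3 * x
    lem₃ = solve-∀
    fold : ∀ v (f : V → ℤ) → (∀ w → f w ≡ a c v * (a v w * a w c)) → sumFin f ≡ r v
    fold v f e = trans (sum-cong e) (sum-*ˡ (a c v) (λ w → a v w * a w c))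
    once : ∀ i j k → t i j k ≡ δ c i * t i j k + (δ c j * t i j k + δ c k * t i j k)
    once i j k = go (adj H i k) refl (adj H k j) refl (adj H j i) refl
      where
      Goal : Set
      Goal = t i j k ≡ δ c i * t i j k + (δ c j * t i j k + δ c k * t i j k)
      vanish : t i j k ≡ + 0 → Goal
      vanish e = trans e (trans (lem₄ (δ c i) (δ c j) (δ c k)) (cong (λ x → δ c i * x + (δ c j * x + δ c k * x)) (sym e)))
        where
        lem₄ : ∀ x y z → + 0 ≡ x * + 0 + (y * + 0 + z * + 0)
        lem₄ = solve-∀
      unit : δ c i + (δ c j + δ c k) ≡ + 1 → Goal
      unit e = trans (sym (ℤₚ.*-identityˡ (t i j k))) (trans (cong (_* t i j k) (sym e)) (lem₄ (δ c i) (δ c j) (δ c k) (t i j k)))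
        where
        lem₄ : ∀ x y z t → (x + (y + z)) * t ≡ x * t + (y * t + z * t)
        lem₄ = solve-∀
      at : ∀ {x y} → c ≡ x → x ≢ y → δ c y ≡ + 0
      at e ne = δ-≢ (λ e′ → ne (trans (sym e) e′))
      is : ∀ {x} → c ≡ x → δ c x ≡ + 1
      is refl = δ-refl c
      go : ∀ b₁ → adj H i k ≡ b₁ → ∀ b₂ → adj H k j ≡ b₂ → ∀ b₃ → adj H j i ≡ b₃ → Goal
      go false e _ _ _ _ = vanish (trans (cong (λ b → b2ℤ b * a k j * a j i) e) (lem₄ (a k j) (a j i)))
        where
        lem₄ : ∀ x y → + 0 * x * y ≡ + 0
        lem₄ = solve-∀
      go true _ false e _ _ = vanish (trans (cong (λ b → a i k * b2ℤ b * a j i) e) (lem₄ (a i k) (a j i)))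
        where
        lem₄ : ∀ x y → x * + 0 * y ≡ + 0
        lem₄ = solve-∀
      go true _ true _ false e = vanish (trans (cong (λ b → a i k * a k j * b2ℤ b) e) (ℤₚ.*-zeroʳ (a i k * a k j)))
      go true ik true kj true ji = cases (c ≟ i) (c ≟ j) (c ≟ k)
        where
        i≢k = adj-≢ H ik
        k≢j = adj-≢ H kj
        j≢i = adj-≢ H ji
        cases : Dec (c ≡ i) → Dec (c ≡ j) → Dec (c ≡ k) → Goal
        cases (yes ci) _ _ = unit (cong₂ _+_ (is ci) (cong₂ _+_ (at ci (λ e → j≢i (sym e))) (at ci i≢k)))
        cases (no _) (yes cj) _ = unit (cong₂ _+_ (at cj j≢i) (cong₂ _+_ (is cj) (at cj (λ e → k≢j (sym e)))))
        cases (no _) (no _) (yes ck) = unit (cong₂ _+_ (at ck (λ e → i≢k (sym e))) (cong₂ _+_ (at ck k≢j) (is ck)))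
        cases (no ci) (no cj) (no ck) = ⊥-elim (triangle-center ik kj ji ci ck cj)

  r-center : r c ≡ + 0
  r-center = trans (cong (_* sumFin (λ w → a c w * a w c)) (A-irrefl H c)) (ℤₚ.*-zeroˡ (sumFin (λ w → a c w * a w c)))

  -- Of the at most two neighbours of `v`, one is `c`, which is not adjacent to itself.
  r≤1 : ∀ v → r v ≤ + 1
  r≤1 v = go (adj H c v) refl
    where
    S = sumFin (λ w → a v w * a w c)
    lem₀ : ∀ x y → x * (+ 1 - y) ≡ x - x * y
    lem₀ = solve-∀
    b2ℤ≤1 : ∀ b → + 0 ≤ + 1 - b2ℤ b
    b2ℤ≤1 true = +≤+ z≤n
    b2ℤ≤1 false = +≤+ z≤n
    go : ∀ b → adj H c v ≡ b → r v ≤ + 1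
    go false e = subst (_≤ + 1) (sym (trans (cong (λ b → b2ℤ b * S) e) (ℤₚ.*-zeroˡ S))) (+≤+ z≤n)
    go true e = subst (_≤ + 1) (sym (trans (cong (_* S) (A-true H e)) (ℤₚ.*-identityˡ S))) bound
      where
      others : + 1 ≤ degree H v - S
      others = subst₂ _≤_ (trans (cong₂ (λ x y → x * (+ 1 - y)) (A-true H (adj-flip H e)) (A-irrefl H c)) refl)
        (trans (sum-cong (λ w → lem₀ (a v w) (a w c))) (sum-minus (a v) (λ w → a v w * a w c)))
        (sum≥1 {f = λ w → a v w * (+ 1 - a w c)} (λ w → *-nonneg (b2ℤ-nonneg (adj H v w)) (b2ℤ≤1 (adj H w c))) c)
      lem : ∀ d s → (+ 2 - d) + (d - s - + 1) ≡ + 1 - s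
      lem = solve-∀
      bound : S ≤ + 1
      bound = ℤₚ.0≤i-j⇒j≤i (subst (+ 0 ≤_) (lem (degree H v) S) (+-nonneg (diff-nonneg (deg≤2 v (adj-≢ H e))) (diff-nonneg others)))

  Visited : ℕ → (ℕ → V) → V → Set
  Visited N φ v = ∃ λ j → j ℕ.< N × φ j ≡ v

  visited? : ∀ N φ v → Dec (Visited N φ v)
  visited? N φ v = ℕₚ.anyUpTo? (λ j → φ j ≟ v) N

  visited-mono : ∀ {N N′ φ v} → N ℕ.≤ N′ → Visited N φ v → Visited N′ φ v
  visited-mono le (j , h , e) = j , ℕₚ.<-≤-trans h le , e

  Agree : ℕ → (ℕ → V) → (ℕ → V) → Set
  Agree N φ φ′ = ∀ i → i ℕ.< N → φ′ i ≡ φ i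

  visited-agree : ∀ {N φ φ′ v} → Agree N φ φ′ → Visited N φ v → Visited N φ′ v
  visited-agree ag (j , h , e) = j , h , trans (ag j h) e

  -- A labelling by all of ℕ of which only the values below `N` count, so that it can grow by
  -- `extend` without a change of type.
  record Embedding (N : ℕ) (φ : ℕ → V) : Set where
    field
      positive : 0 ℕ.< N
      at-0     : φ 0 ≡ c
      inj      : ∀ i j → i ℕ.< N → j ℕ.< N → φ i ≡ φ j → i ≡ j
  open Embedding

  ClosedAt : ℕ → (ℕ → V) → ℕ → Set
  ClosedAt N φ i = ∀ w → adj H (φ i) w ≡ true → Visited N φ w

  Closed : ℕ → (ℕ → V) → Set
  Closed N φ = ∀ i → 0 ℕ.< i → i ℕ.< N → ClosedAt N φ i

  Preserves : (ℕ → V) → Edge → Set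
  Preserves φ (x , y) = adj H (φ x) (φ y) ≡ true

  preserves-agree : ∀ {N φ φ′} → Agree N φ φ′ → ∀ {e} → Bounded N e × Preserves φ e → Preserves φ′ e
  preserves-agree ag {x , y} ((xy , yN) , p) = trans (cong₂ (adj H) (ag x (ℕₚ.<-trans xy yN)) (ag y yN)) p

  extend : (ℕ → V) → ℕ → V → ℕ → V
  extend φ N v i with i ℕ.≟ N
  ... | yes _ = v
  ... | no _ = φ i

  extend-new : ∀ φ N v → extend φ N v N ≡ v
  extend-new φ N v with N ℕ.≟ N
  ... | yes _ = refl
  ... | no ne = ⊥-elim (ne refl)

  extend-agree : ∀ φ N v → Agree N φ (extend φ N v)
  extend-agree φ N v i h with i ℕ.≟ N
  ... | yes refl = ⊥-elim (ℕₚ.n≮n i h)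
  ... | no _ = refl

  extend-embedding : ∀ {N φ v} → Embedding N φ → ¬ Visited N φ v → Embedding (suc N) (extend φ N v)
  extend-embedding {N} {φ} {v} E nv = record
    { positive = s≤s z≤n
    ; at-0 = trans (extend-agree φ N v 0 (positive E)) (at-0 E)
    ; inj = λ i j hi hj → go i j (ℕₚ.m<1+n⇒m<n∨m≡n hi) (ℕₚ.m<1+n⇒m<n∨m≡n hj)
    }
    where
    φ′ = extend φ N v
    go : ∀ i j → i ℕ.< N ⊎ i ≡ N → j ℕ.< N ⊎ j ≡ N → φ′ i ≡ φ′ j → i ≡ j
    go i j (inj₁ hi) (inj₁ hj) e = inj E i j hi hj (trans (sym (extend-agree φ N v i hi)) (trans e (extend-agree φ N v j hj)))
    go i j (inj₁ hi) (inj₂ refl) e = ⊥-elim (nv (i , hi , trans (sym (extend-agree φ N v i hi)) (trans e (extend-new φ N v))))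
    go i j (inj₂ refl) (inj₁ hj) e = ⊥-elim (nv (j , hj , trans (sym (extend-agree φ N v j hj)) (trans (sym e) (extend-new φ N v))))
    go i j (inj₂ refl) (inj₂ refl) e = refl

  extend-visited : ∀ {N φ v w} → Visited N φ w → Visited (suc N) (extend φ N v) w
  extend-visited {N} {φ} {v} h = visited-mono (ℕₚ.n≤1+n N) (visited-agree (extend-agree φ N v) h)

  new-visited : ∀ N φ v → Visited (suc N) (extend φ N v) v
  new-visited N φ v = N , ℕₚ.n<1+n N , extend-new φ N v

  extend-closedAt : ∀ {N φ v i} → i ℕ.< N → ClosedAt N φ i → ClosedAt (suc N) (extend φ N v) i
  extend-closedAt {N} {φ} {v} {i} h cl w iw = extend-visited (cl w (trans (cong (λ x → adj H x w) (sym (extend-agree φ N v i h))) iw))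

  embedding-≤ : ∀ {N φ} → Embedding N φ → N ℕ.≤ suc n
  embedding-≤ {N} {φ} E = Finₚ.injective⇒≤ {f = λ (i : Fin N) → φ (toℕ i)}
    (λ {i} {j} e → Finₚ.toℕ-injective (inj E (toℕ i) (toℕ j) (Finₚ.toℕ<n i) (Finₚ.toℕ<n j) e))

  not-center : ∀ {N φ i} → Embedding N φ → 0 ℕ.< i → i ℕ.< N → c ≢ φ i
  not-center E 0<i h e = ℕₚ.<⇒≢ 0<i (inj E 0 _ (positive E) h (trans (at-0 E) e))

  chain-bounded : ∀ l p o → p ℕ.< o → All (Bounded (o ℕ.+ l)) (chain p o l)
  chain-bounded zero p o h = []
  chain-bounded (suc l) p o h = (h , ℕₚ.m<m+n o (s≤s z≤n)) ∷
    subst (λ N → All (Bounded N) (chain o (suc o) l)) (sym (ℕₚ.+-suc o l)) (chain-bounded l o (suc o) (ℕₚ.n<1+n o))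

  record Walk (M : ℕ) (φ : ℕ → V) : Set where
    field
      l         : ℕ
      φ′        : ℕ → V
      embedding : Embedding (suc M ℕ.+ l) φ′
      agree     : Agree (suc M) φ φ′
      edges     : All (Preserves φ′) (chain M (suc M) l)
      closed    : Closed (suc M ℕ.+ l) φ′

  -- Unlabelled neighbours are followed from the current end `M`, which is attached to `p`. When one
  -- is found, it and `p` are all the neighbours of the old end, which thereby becomes closed. Edges
  -- leading back to labelled vertices are not excluded here but by the edge count in `Spanning`.
  -- The fuel is one more than the number of unlabelled vertices.
  walk : ∀ fuel M φ → suc M ℕ.+ fuel ≡ suc (suc n) → Embedding (suc M) φ → 0 ℕ.< M →
    (∀ i → 0 ℕ.< i → i ℕ.< M → ClosedAt (suc M) φ i) →
    ∀ p → p ℕ.< M → adj H (φ M) (φ p) ≡ true → Walk M φ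
  walk zero M φ eq E 0<M cl p hp ap = ⊥-elim (ℕₚ.n≮n (suc n) (ℕₚ.≤-trans (ℕₚ.≤-reflexive (trans (sym eq) (ℕₚ.+-identityʳ (suc M)))) (embedding-≤ E)))
  walk (suc fuel) M φ eq E 0<M cl p hp ap = go (Finₚ.any? (λ w → (adj H (φ M) w Boolₚ.≟ true) ×-dec ¬? (visited? (suc M) φ w)))
    where
    go : Dec (∃ λ w → adj H (φ M) w ≡ true × ¬ Visited (suc M) φ w) → Walk M φ
    go (no none) = record
      { l = 0 ; φ′ = φ ; agree = λ _ _ → refl ; edges = []
      ; embedding = subst (λ N → Embedding N φ) (sym (ℕₚ.+-identityʳ (suc M))) E
      ; closed = subst (λ N → Closed N φ) (sym (ℕₚ.+-identityʳ (suc M))) all-closed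
      }
      where
      all-closed : Closed (suc M) φ
      all-closed i 0<i h = split (ℕₚ.m<1+n⇒m<n∨m≡n h)
        where
        split : i ℕ.< M ⊎ i ≡ M → ClosedAt (suc M) φ i
        split (inj₁ h′) = cl i 0<i h′
        split (inj₂ refl) w iw = decidable-stable (visited? (suc M) φ w) (λ nv → none (w , iw , nv))
    go (yes (w , Mw , nv)) = record
      { l = suc W.l ; φ′ = W.φ′
      ; embedding = subst (λ N → Embedding N W.φ′) (sym (ℕₚ.+-suc (suc M) W.l)) W.embedding
      ; agree = λ i h → trans (W.agree i (ℕₚ.m<n⇒m<1+n h)) (old i h)
      ; edges = trans (cong₂ (adj H) (trans (W.agree M (ℕₚ.m<n⇒m<1+n (ℕₚ.n<1+n M))) (old M (ℕₚ.n<1+n M))) (trans (W.agree (suc M) (ℕₚ.n<1+n (suc M))) new)) Mw ∷ W.edges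
      ; closed = subst (λ N → Closed N W.φ′) (sym (ℕₚ.+-suc (suc M) W.l)) W.closed
      }
      where
      φ₁ = extend φ (suc M) w
      old = extend-agree φ (suc M) w
      new = extend-new φ (suc M) w
      closed₁ : ∀ i → 0 ℕ.< i → i ℕ.< suc M → ClosedAt (2 ℕ.+ M) φ₁ i
      closed₁ i 0<i h = split (ℕₚ.m<1+n⇒m<n∨m≡n h)
        where
        split : i ℕ.< M ⊎ i ≡ M → ClosedAt (2 ℕ.+ M) φ₁ i
        split (inj₁ h′) = extend-closedAt (ℕₚ.m<n⇒m<1+n h′) (cl i 0<i h′)
        split (inj₂ refl) x ix = pick (neighbours (not-center E 0<i h) (λ e → nv (p , ℕₚ.m<n⇒m<1+n hp , e)) ap Mw (trans (cong (λ z → adj H z x) (sym (old i h))) ix))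
          where
          pick : x ≡ φ p ⊎ x ≡ w → Visited (2 ℕ.+ M) φ₁ x
          pick (inj₁ refl) = extend-visited (p , ℕₚ.m<n⇒m<1+n hp , refl)
          pick (inj₂ refl) = new-visited (suc M) φ w
      module W = Walk (walk fuel (suc M) φ₁ (trans (sym (ℕₚ.+-suc (suc M) fuel)) eq) (extend-embedding E nv) (s≤s z≤n) closed₁ M (ℕₚ.n<1+n M)
        (trans (cong₂ (adj H) new (old M (ℕₚ.n<1+n M))) (adj-flip H Mw)))

  record Growth (N : ℕ) (φ : ℕ → V) : Set where
    field
      ls        : List ℕ
      lengths   : All (1 ℕ.≤_) ls
      φ′        : ℕ → V
      embedding : Embedding (N ℕ.+ sumℕ ls) φ′
      agree     : Agree N φ φ′
      edges     : All (Preserves φ′) (pathEdges N ls)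
      closed    : ∀ i → i ℕ.< N ℕ.+ sumℕ ls → ClosedAt (N ℕ.+ sumℕ ls) φ′ i

  -- Each unlabelled neighbour of `c` starts a path with at least one new vertex, so the fuel only
  -- has to bound the number of vertices left.
  grow : ∀ fuel N φ → suc n ℕ.≤ N ℕ.+ fuel → Embedding N φ → Closed N φ → Growth N φ
  grow fuel N φ le E cl = go fuel le (Finₚ.any? (λ w → (adj H c w Boolₚ.≟ true) ×-dec ¬? (visited? N φ w)))
    where
    go : ∀ fuel → suc n ℕ.≤ N ℕ.+ fuel → Dec (∃ λ w → adj H c w ≡ true × ¬ Visited N φ w) → Growth N φ
    go fuel le (no none) = record
      { ls = [] ; lengths = [] ; φ′ = φ ; agree = λ _ _ → refl ; edges = []
      ; embedding = subst (λ N → Embedding N φ) (sym (ℕₚ.+-identityʳ N)) E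
      ; closed = subst (λ N → ∀ i → i ℕ.< N → ClosedAt N φ i) (sym (ℕₚ.+-identityʳ N)) all-closed
      }
      where
      all-closed : ∀ i → i ℕ.< N → ClosedAt N φ i
      all-closed zero h w iw = decidable-stable (visited? N φ w) (λ nv → none (w , trans (cong (λ z → adj H z w) (sym (at-0 E))) iw , nv))
      all-closed (suc i) h = cl (suc i) (s≤s z≤n) h
    go zero le (yes (v , cv , nv)) = ⊥-elim (ℕₚ.<⇒≱ (ℕₚ.≤-trans (embedding-≤ (extend-embedding E nv)) (ℕₚ.≤-trans le (ℕₚ.≤-reflexive (ℕₚ.+-identityʳ N)))) ℕₚ.≤-refl)
    go (suc fuel) le (yes (v , cv , nv)) = record
      { ls = suc W.l ∷ G.ls ; lengths = s≤s z≤n ∷ G.lengths ; φ′ = G.φ′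
      ; embedding = subst (λ N → Embedding N G.φ′) total G.embedding
      ; agree = λ i h → trans (G.agree i (ℕₚ.<-≤-trans h N≤)) (trans (W.agree i (ℕₚ.m<n⇒m<1+n h)) (old i h))
      ; edges = Allₚ.++⁺ (All.map (λ {e} → preserves-agree G.agree {e}) (All.zip (chain-bounded (suc W.l) 0 N (positive E) , first ∷ W.edges))) G.edges
      ; closed = subst (λ N → ∀ i → i ℕ.< N → ClosedAt N G.φ′ i) total G.closed
      }
      where
      φ₁ = extend φ N v
      old = extend-agree φ N v
      new = extend-new φ N v
      E₁ = extend-embedding E nv
      -- The vertices still unlabelled; `walk` wants one unit of fuel more.
      slack = ℕₚ.m≤n⇒∃[o]m+o≡n (embedding-≤ E₁)
      spare : suc N ℕ.+ suc (proj₁ slack) ≡ suc (suc n)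
      spare = trans (ℕₚ.+-suc (suc N) (proj₁ slack)) (cong suc (proj₂ slack))
      module W = Walk (walk (suc (proj₁ slack)) N φ₁ spare E₁ (positive E)
        (λ i 0<i h → extend-closedAt h (cl i 0<i h)) 0 (positive E)
        (trans (cong₂ (adj H) new (trans (old 0 (positive E)) (at-0 E))) (adj-flip H cv)))
      shift : N ℕ.+ suc W.l ≡ suc N ℕ.+ W.l
      shift = ℕₚ.+-suc N W.l
      N≤ : N ℕ.≤ N ℕ.+ suc W.l
      N≤ = ℕₚ.m≤m+n N (suc W.l)
      module G = Growth (grow fuel (N ℕ.+ suc W.l) W.φ′
        (ℕₚ.≤-trans le (ℕₚ.≤-trans (ℕₚ.≤-reflexive (ℕₚ.+-suc N fuel)) (ℕₚ.≤-trans (ℕₚ.+-monoˡ-≤ fuel (ℕₚ.m≤m+n (suc N) W.l)) (ℕₚ.≤-reflexive (cong (ℕ._+ fuel) (sym shift))))))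
        (subst (λ N → Embedding N W.φ′) (sym shift) W.embedding) (subst (λ N → Closed N W.φ′) (sym shift) W.closed))
      total : N ℕ.+ suc W.l ℕ.+ sumℕ G.ls ≡ N ℕ.+ sumℕ (suc W.l ∷ G.ls)
      total = ℕₚ.+-assoc N (suc W.l) (sumℕ G.ls)
      first : adj H (W.φ′ 0) (W.φ′ N) ≡ true
      first = trans (cong₂ (adj H) (trans (W.agree 0 (s≤s z≤n)) (trans (old 0 (positive E)) (at-0 E))) (trans (W.agree N (ℕₚ.n<1+n N)) new)) cv

  r-nonneg : ∀ v → + 0 ≤ r v
  r-nonneg v = *-nonneg (b2ℤ-nonneg (adj H c v)) (sum-nonneg (λ w → *-nonneg (b2ℤ-nonneg (adj H v w)) (b2ℤ-nonneg (adj H w c))))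

  Σr≤visited : ∀ N φ → (∀ v → r v ≢ + 0 → Visited N φ v) → sumFin r ≤ Σ< N (λ i → r (φ i))
  Σr≤visited N φ h = subst (sumFin r ≤_)
      (trans (sum-swap {suc n} {N} (λ v i → δ (φ (toℕ i)) v * r v)) (sum-cong {N} (λ i → sum-δ (φ (toℕ i)) r)))
      (sum-mono (λ v → bound v (r v ℤₚ.≟ + 0)))
    where
    term-nonneg : ∀ v (i : Fin N) → + 0 ≤ δ (φ (toℕ i)) v * r v
    term-nonneg v i with φ (toℕ i) ≟ v
    ... | yes refl rewrite δ-refl (φ (toℕ i)) = *-nonneg {+ 1} (+≤+ z≤n) (r-nonneg (φ (toℕ i)))
    ... | no ne rewrite δ-≢ ne = *-nonneg {+ 0} (+≤+ z≤n) (r-nonneg v)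
    bound : ∀ v → Dec (r v ≡ + 0) → r v ≤ sumFin {N} (λ i → δ (φ (toℕ i)) v * r v)
    bound v (yes e) = subst (_≤ sumFin {N} (λ i → δ (φ (toℕ i)) v * r v)) (sym e) (sum-nonneg (term-nonneg v))
    bound v (no ne) = subst (_≤ sumFin {N} (λ i → δ (φ (toℕ i)) v * r v)) hit (sum≥1 (term-nonneg v) ĵ)
      where
      found = h v ne
      ĵ = fromℕ< (proj₁ (proj₂ found))
      hit : δ (φ (toℕ ĵ)) v * r v ≡ r v
      hit = trans (cong (λ x → δ x v * r v) (trans (cong φ (Finₚ.toℕ-fromℕ< (proj₁ (proj₂ found)))) (proj₂ (proj₂ found))))
        (trans (cong (_* r v) (δ-refl v)) (ℤₚ.*-identityˡ (r v)))

  record Triangles (t : ℕ) : Set where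
    field
      φ         : ℕ → V
      embedding : Embedding (1 ℕ.+ 2 ℕ.* t) φ
      closed    : Closed (1 ℕ.+ 2 ℕ.* t) φ
      edges     : All (Preserves φ) (triEdges t)

  triEdges-bounded : ∀ t → All (Bounded (1 ℕ.+ 2 ℕ.* t)) (triEdges t)
  triEdges-bounded t = Stage.bounded (stage-triangles t)

  -- If every vertex with `r` nonzero were labelled, Σ r would be at most 2t, as `r` is 0 at `c` and
  -- at most 1 elsewhere. So some triangle c, v, w has `v` unlabelled; then `w` is unlabelled too,
  -- since a labelled `w` is closed and would force a label on `v`.
  add-triangle : ∀ {t} → + (2 ℕ.* suc t) ≤ sumFin r → Triangles t → Triangles (suc t)
  add-triangle {t} le T = go (Finₚ.any? (λ v → ¬? (r v ℤₚ.≟ + 0) ×-dec ¬? (visited? N φ v)))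
    where
    open Triangles T
    N = 1 ℕ.+ 2 ℕ.* t
    count : Σ< N (λ i → r (φ i)) ≤ + (2 ℕ.* t)
    count = subst₂ _≤_ (sym (cong₂ _+_ (trans (cong r (at-0 embedding)) r-center) refl)) (trans (ℤₚ.+-identityˡ (+ (2 ℕ.* t) * + 1)) (ℤₚ.*-identityʳ (+ (2 ℕ.* t))))
      (ℤₚ.+-monoʳ-≤ (+ 0) (subst (sumFin {2 ℕ.* t} (λ i → r (φ (suc (toℕ i)))) ≤_) (sum-const (2 ℕ.* t) (+ 1)) (sum-mono {2 ℕ.* t} (λ i → r≤1 (φ (suc (toℕ i)))))))
    absurd : + (2 ℕ.* suc t) ≤ + (2 ℕ.* t) → ⊥
    absurd (+≤+ h) = ℕₚ.<⇒≱ (ℕₚ.*-monoʳ-< 2 (ℕₚ.n<1+n t)) h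
    go : Dec (∃ λ v → r v ≢ + 0 × ¬ Visited N φ v) → Triangles (suc t)
    go (no none) = ⊥-elim (absurd (ℤₚ.≤-trans le (ℤₚ.≤-trans
      (Σr≤visited N φ (λ v ne → decidable-stable (visited? N φ v) (λ nv → none (v , ne , nv)))) count)))
    go (yes (v , rv , nv)) = record
      { φ = φ₂ ; embedding = subst (λ z → Embedding (1 ℕ.+ z) φ₂) (sym (ℕₚ.*-suc 2 t)) E₂
      ; closed = subst (λ z → Closed (1 ℕ.+ z) φ₂) (sym (ℕₚ.*-suc 2 t)) closed₂
      ; edges = Allₚ.++⁺ (All.map (λ {e} → preserves-agree old₂ {e}) (All.zip (triEdges-bounded t , edges)))
          (trans (cong₂ (adj H) φ₂-0 φ₂-N) cv ∷ trans (cong₂ (adj H) φ₂-0 φ₂-N1) (adj-flip H wc) ∷ trans (cong₂ (adj H) φ₂-N φ₂-N1) vw ∷ [])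
      }
      where
      cv = adj-nonzero H (sumFin (λ w → a v w * a w c)) rv
      W = sum-nonzero (λ w → a v w * a w c) (λ e → rv (trans (cong (a c v *_) e) (ℤₚ.*-zeroʳ (a c v))))
      w′ = proj₁ W
      vw : adj H v w′ ≡ true
      vw = adj-nonzero H (a w′ c) (proj₂ W)
      wc : adj H w′ c ≡ true
      wc = adj-nonzero H (a v w′) (λ e → proj₂ W (trans (ℤₚ.*-comm (a v w′) (a w′ c)) e))
      w-new : ¬ Visited N φ w′
      w-new (zero , h , e) = adj-≢ H wc (trans (sym e) (at-0 embedding))
      w-new (suc i , h , e) = nv (closed (suc i) (s≤s z≤n) h v (trans (cong (λ x → adj H x v) e) (adj-flip H vw)))
      φ₁ = extend φ N v
      w-new₁ : ¬ Visited (suc N) φ₁ w′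
      w-new₁ (i , h , e) = split (ℕₚ.m<1+n⇒m<n∨m≡n h)
        where
        split : i ℕ.< N ⊎ i ≡ N → ⊥
        split (inj₁ h′) = w-new (i , h′ , trans (sym (extend-agree φ N v i h′)) e)
        split (inj₂ refl) = adj-≢ H vw (trans (sym (extend-new φ N v)) e)
      φ₂ = extend φ₁ (suc N) w′
      E₁ = extend-embedding embedding nv
      E₂ = extend-embedding E₁ w-new₁
      old₂ : Agree N φ φ₂
      old₂ i h = trans (extend-agree φ₁ (suc N) w′ i (ℕₚ.m<n⇒m<1+n h)) (extend-agree φ N v i h)
      φ₂-0 : φ₂ 0 ≡ c
      φ₂-0 = at-0 E₂
      φ₂-N : φ₂ N ≡ v
      φ₂-N = trans (extend-agree φ₁ (suc N) w′ N (ℕₚ.n<1+n N)) (extend-new φ N v)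
      φ₂-N1 : φ₂ (suc N) ≡ w′
      φ₂-N1 = extend-new φ₁ (suc N) w′
      c-visited : Visited (2 ℕ.+ N) φ₂ c
      c-visited = 0 , s≤s z≤n , φ₂-0
      v-visited : Visited (2 ℕ.+ N) φ₂ v
      v-visited = N , ℕₚ.m<n⇒m<1+n (ℕₚ.n<1+n N) , φ₂-N
      w-visited : Visited (2 ℕ.+ N) φ₂ w′
      w-visited = suc N , ℕₚ.n<1+n (suc N) , φ₂-N1
      closed-v : ∀ x → adj H v x ≡ true → Visited (2 ℕ.+ N) φ₂ x
      closed-v x vx = pick (neighbours (adj-≢ H cv) (λ e → adj-≢ H wc (sym e)) (adj-flip H cv) vw vx)
        where
        pick : x ≡ c ⊎ x ≡ w′ → Visited (2 ℕ.+ N) φ₂ x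
        pick (inj₁ refl) = c-visited
        pick (inj₂ refl) = w-visited
      closed-w : ∀ x → adj H w′ x ≡ true → Visited (2 ℕ.+ N) φ₂ x
      closed-w x wx = pick (neighbours (λ e → adj-≢ H wc (sym e)) (adj-≢ H cv) wc (adj-flip H vw) wx)
        where
        pick : x ≡ c ⊎ x ≡ v → Visited (2 ℕ.+ N) φ₂ x
        pick (inj₁ refl) = c-visited
        pick (inj₂ refl) = v-visited
      closed₂ : Closed (2 ℕ.+ N) φ₂
      closed₂ i 0<i h x ix = split (ℕₚ.m<1+n⇒m<n∨m≡n h)
        where
        split : i ℕ.< suc N ⊎ i ≡ suc N → Visited (2 ℕ.+ N) φ₂ x
        split (inj₂ refl) = closed-w x (trans (cong (λ z → adj H z x) (sym φ₂-N1)) ix)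
        split (inj₁ h′) = split′ (ℕₚ.m<1+n⇒m<n∨m≡n h′)
          where
          split′ : i ℕ.< N ⊎ i ≡ N → Visited (2 ℕ.+ N) φ₂ x
          split′ (inj₂ refl) = closed-v x (trans (cong (λ z → adj H z x) (sym φ₂-N)) ix)
          split′ (inj₁ h″) = extend-visited (extend-visited (closed i 0<i h″ x (trans (cong (λ z → adj H z x) (sym (old₂ i h″))) ix)))

  triangles : ∀ t → + (2 ℕ.* t) ≤ sumFin r → Triangles t
  triangles zero le = record
    { φ = λ _ → c
    ; embedding = record { positive = s≤s z≤n ; at-0 = refl ; inj = λ { zero zero _ _ _ → refl ; (suc i) _ (s≤s ()) ; zero (suc j) _ (s≤s ()) } }
    ; closed = λ { (suc i) _ (s≤s ()) }
    ; edges = []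
    }
  triangles (suc t) le = add-triangle le (triangles t (ℤₚ.≤-trans (+≤+ (ℕₚ.*-monoʳ-≤ 2 (ℕₚ.n≤1+n t))) le))

  -- The set of labelled vertices contains `c` and is closed under adjacency, so connectedness
  -- applies.
  all-visited : ∀ {N φ} → Embedding N φ → (∀ i → i ℕ.< N → ClosedAt N φ i) → ∀ v → Visited N φ v
  all-visited {N} {φ} E cl v = back (connected (λ v → ⌊ visited? N φ v ⌋) closed {c} (fwd (0 , positive E , at-0 E)) v)
    where
    back : ∀ {v} → ⌊ visited? N φ v ⌋ ≡ true → Visited N φ v
    back {v} e with visited? N φ v
    ... | yes p = p
    fwd : ∀ {v} → Visited N φ v → ⌊ visited? N φ v ⌋ ≡ true
    fwd {v} p with visited? N φ v
    ... | yes _ = refl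
    ... | no np = ⊥-elim (np p)
    closed : ∀ i j → ⌊ visited? N φ i ⌋ ≡ true → adj H i j ≡ true → ⌊ visited? N φ j ⌋ ≡ true
    closed i j e ij with back {i} e
    ... | x , h , refl = fwd (cl x h j ij)
  -- The labelled path-friendship graph is a spanning subgraph of `H` with the same degree sum,
  -- hence it is all of `H`. That there are `k` paths is only then read off from the degree of `c`.
  module Spanning (s k : ℕ) (deg-c : degree H c ≡ + (2 ℕ.* s ℕ.+ k)) (Σdeg : sumFin (degree H) ≡ + 2 * (+ n + + s))
    (ls : List ℕ) (lengths : All (1 ℕ.≤_) ls) (φ : ℕ → V) (E : Embedding (pfOrder s ls) φ)
    (index : ∀ v → Visited (pfOrder s ls) φ v) (preserved : All (Preserves φ) (pfEdges s ls))
    (S : Stage (pfEdges s ls) (pfOrder s ls) (2 ℕ.* s ℕ.+ length ls) (length ls) (6 ℕ.* s) (3 ℕ.^ s)) where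
    private
      module S = Stage S
      N = pfOrder s ls
      es = pfEdges s ls
      to : V → Fin N
      to v = fromℕ< (proj₁ (proj₂ (index v)))
      from : Fin N → V
      from i = φ (toℕ i)
      from-to : ∀ v → from (to v) ≡ v
      from-to v = trans (cong φ (Finₚ.toℕ-fromℕ< (proj₁ (proj₂ (index v))))) (proj₂ (proj₂ (index v)))
      from-inj : ∀ {i j} → from i ≡ from j → i ≡ j
      from-inj {i} {j} e = Finₚ.toℕ-injective (inj E (toℕ i) (toℕ j) (Finₚ.toℕ<n i) (Finₚ.toℕ<n j) e)
      to-from : ∀ i → to (from i) ≡ i
      to-from i = from-inj (from-to (from i))
      N≡ : N ≡ suc n
      N≡ = ℕₚ.≤-antisym (embedding-≤ E)
        (Finₚ.injective⇒≤ {f = to} (λ {x} {y} e → trans (sym (from-to x)) (trans (cong from e) (from-to y))))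
      edge-adj : ∀ fs → All (Preserves φ) fs → ∀ i j → edgeIn fs i j ≡ true → adj H (φ i) (φ j) ≡ true
      edge-adj ((x , y) ∷ fs) (p ∷ ps) i j e = go (x ℕ.≟ i) (y ℕ.≟ j) (x ℕ.≟ j) (y ℕ.≟ i)
        where
        rest : match (x , y) i j ≡ false → adj H (φ i) (φ j) ≡ true
        rest m = edge-adj fs ps i j (trans (cong (_∨ edgeIn fs i j) (sym m)) e)
        go : Dec (x ≡ i) → Dec (y ≡ j) → Dec (x ≡ j) → Dec (y ≡ i) → adj H (φ i) (φ j) ≡ true
        go (yes refl) (yes refl) _ _ = p
        go _ _ (yes refl) (yes refl) = adj-flip H p
        go d₁ d₂ d₃ d₄ = other d₁ d₂ d₃ d₄
          where
          half : ∀ {x y i j} → Dec (x ≡ i) → Dec (y ≡ j) → (x ≡ i × y ≡ j) ⊎ ((x ≡ᵇ i) ∧ (y ≡ᵇ j)) ≡ false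
          half (yes p) (yes q) = inj₁ (p , q)
          half {x} {y} {i} {j} (no ne) _ = inj₂ (cong (_∧ (y ≡ᵇ j)) (≡ᵇ-≢ ne))
          half {x} {y} {i} {j} (yes _) (no ne) = inj₂ (trans (cong ((x ≡ᵇ i) ∧_) (≡ᵇ-≢ ne)) (Boolₚ.∧-zeroʳ (x ≡ᵇ i)))
          other : Dec (x ≡ i) → Dec (y ≡ j) → Dec (x ≡ j) → Dec (y ≡ i) → adj H (φ i) (φ j) ≡ true
          other d₁ d₂ d₃ d₄ with half d₁ d₂ | half d₃ d₄
          ... | inj₁ (refl , refl) | _ = p
          ... | inj₂ _ | inj₁ (refl , refl) = adj-flip H p
          ... | inj₂ m | inj₂ m′ = rest (cong₂ _∨_ m m′)
      B : Fin N → Fin N → ℤ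
      B i j = w es (toℕ i) (toℕ j)
      A′ : Fin N → Fin N → ℤ
      A′ i j = a (from i) (from j)
      B≤A : ∀ i j → B i j ≤ A′ i j
      B≤A i j = go (edgeIn es (toℕ i) (toℕ j)) refl
        where
        go : ∀ b → edgeIn es (toℕ i) (toℕ j) ≡ b → B i j ≤ A′ i j
        go true e = ℤₚ.≤-reflexive (trans (cong b2ℤ e) (sym (A-true H (edge-adj es preserved (toℕ i) (toℕ j) e))))
        go false e = subst (_≤ A′ i j) (sym (cong b2ℤ e)) (b2ℤ-nonneg (adj H (from i) (from j)))
      row-A′ : ∀ i → sumFin (A′ i) ≡ degree H (from i)
      row-A′ i = sum-bijection from to from-to to-from (a (from i))
      ΣB : sumFin (λ i → sumFin (B i)) ≡ sumFin (λ i → sumFin (A′ i))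
      ΣB = trans (S.degrees id) (trans (lem (+ (2 ℕ.* s)) (+ length ls) (+ S.twos) (+ n) (+ s)
            (ℤₚ.pos-* 2 s) (order (trans (sym (sum-const N (+ 1))) (S.degrees (λ _ → + 1)))))
          (sym (trans (sum-cong row-A′) (trans (sum-bijection from to from-to to-from (degree H)) Σdeg))))
        where
        order : + N * + 1 ≡ + 1 + (+ S.twos * + 1 + + length ls * + 1) → + n ≡ + S.twos + + length ls
        order e = trans (lem₁ (+ n)) (trans (cong (_- + 1) (trans (sym (trans (ℤₚ.*-identityʳ (+ N)) (cong +_ N≡))) e)) (lem₂ (+ S.twos) (+ length ls)))
          where
          lem₁ : ∀ m → m ≡ + 1 + m - + 1
          lem₁ = solve-∀
          lem₂ : ∀ x y → + 1 + (x * + 1 + y * + 1) - + 1 ≡ x + y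
          lem₂ = solve-∀
        lem : ∀ D l c n s → D ≡ + 2 * s → n ≡ c + l → D + l + (c * + 2 + l * + 1) ≡ + 2 * (n + s)
        lem _ l c _ s refl refl = lem₁ l c s
          where
          lem₁ : ∀ l c s → + 2 * s + l + (c * + 2 + l * + 1) ≡ + 2 * (c + l + s)
          lem₁ = solve-∀
      row≡ : ∀ i → sumFin (B i) ≡ sumFin (A′ i)
      row≡ = sum-eq-pointwise (λ i → sum-mono (B≤A i)) ΣB
      B≡A : ∀ i j → B i j ≡ A′ i j
      B≡A i = sum-eq-pointwise (B≤A i) (row≡ i)
      b2ℤ-inj : ∀ {a b} → b2ℤ a ≡ b2ℤ b → a ≡ b
      b2ℤ-inj {true} {true} e = refl
      b2ℤ-inj {false} {false} e = refl
      length≡ : length ls ≡ k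
      length≡ = ℕₚ.+-cancelˡ-≡ (2 ℕ.* s) (length ls) k (ℤₚ.+-injective
        (trans (sym S.center) (trans (row≡ zero) (trans (row-A′ zero) (trans (cong (degree H) (at-0 E)) deg-c)))))

    spanning-path-friendship : IsPathFriendship s k H
    spanning-path-friendship = ls , length≡ , lengths , mk↔ₛ′ to from to-from from-to ,
      λ i j → b2ℤ-inj (trans (sym (cong₂ a (from-to i) (from-to j))) (sym (B≡A (to i) (to j))))

  path-friendship : ∀ s k → degree H c ≡ + (2 ℕ.* s ℕ.+ k) → closedWalks₃ H ≡ + (6 ℕ.* s) →
    sumFin (degree H) ≡ + 2 * (+ n + + s) → IsPathFriendship s k H
  path-friendship s k deg-c walks₃ Σdeg = Spanning.spanning-path-friendship s k deg-c Σdeg G.ls G.lengths G.φ′ G.embedding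
    (all-visited G.embedding G.closed)
    (Allₚ.++⁺ (All.map (λ {e} → preserves-agree G.agree {e}) (All.zip (triEdges-bounded s , T.edges))) G.edges)
    (stage-model s G.ls G.lengths)
    where
    Σr : sumFin r ≡ + (2 ℕ.* s)
    Σr = ℤₚ.*-cancelˡ-≡ (+ 3) (sumFin r) (+ (2 ℕ.* s)) (trans (sym closedWalks₃≡3Σr) (trans walks₃ (trans (cong +_ (ℕₚ.*-assoc 3 2 s)) (ℤₚ.pos-* 3 (2 ℕ.* s)))))
    module T = Triangles (triangles s (ℤₚ.≤-reflexive (sym Σr)))
    N₀ = 1 ℕ.+ 2 ℕ.* s
    module G = Growth (grow (suc n) N₀ T.φ (ℕₚ.m≤n+m (suc n) N₀) T.embedding T.closed)

-- Spectral recognition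

model : ∀ s ls → All (1 ℕ.≤_) ls → Graph (pfOrder s ls)
model s ls hs = record
  { adj = pfAdj s ls
  ; sym = λ i j → edgeIn-sym (pfEdges s ls) (toℕ i) (toℕ j)
  ; irrefl = λ i → edgeIn-irrefl (Stage.bounded (stage-model s ls hs)) (toℕ i)
  }

model-trees : ∀ s ls hs → trees (model s ls hs) ≡ + (3 ℕ.^ s)
model-trees s ls hs = trans (det-cong (λ i j → cong₂ _+_
    (trans (L-entry (model s ls hs) i j) (cong (λ e → degree (model s ls hs) i * e - A (model s ls hs) i j) (δℕ-toℕ i j)))
    (cong₂ _*_ (δℕ-toℕ zero i) (δℕ-toℕ zero j))))
  (Stage.trees≡ (stage-model s ls hs))

isomorphic-cosp : ∀ {n} {G G′ : Graph n} (f : Fin n ↔ Fin n) →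
  (∀ i j → adj G i j ≡ adj G′ (Inverse.to f i) (Inverse.to f j)) → ∀ x → charPolyL G x ≡ charPolyL G′ x
isomorphic-cosp {n} {G} {G′} f iso x = trans (charPoly-pencil G x) (trans (det-cong entry)
    (trans (det-relabel π π⁻¹ inv₁ inv₂ (pencil δ (laplacian G′) x (- + 1))) (sym (charPoly-pencil G′ x))))
  where
  π = Inverse.to f
  π⁻¹ = Inverse.from f
  inv₁ : ∀ i → π (π⁻¹ i) ≡ i
  inv₁ i = Inverse.strictlyInverseˡ f i
  inv₂ : ∀ i → π⁻¹ (π i) ≡ i
  inv₂ i = Inverse.strictlyInverseʳ f i
  δ-π : ∀ i j → δ i j ≡ δ (π i) (π j)
  δ-π i j with i ≟ j
  ... | yes refl = trans (δ-refl i) (sym (δ-refl (π i)))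
  ... | no ne = trans (δ-≢ ne) (sym (δ-≢ (λ e → ne (trans (sym (inv₂ i)) (trans (cong π⁻¹ e) (inv₂ j))))))
  degree-π : ∀ i → degree G i ≡ degree G′ (π i)
  degree-π i = trans (sum-cong (λ j → cong b2ℤ (iso i j))) (sum-bijection π π⁻¹ inv₁ inv₂ (A G′ (π i)))
  L-π : ∀ i j → laplacian G i j ≡ laplacian G′ (π i) (π j)
  L-π i j = trans (L-entry G i j) (trans (cong₂ _-_ (cong₂ _*_ (degree-π i) (δ-π i j)) (cong b2ℤ (iso i j))) (sym (L-entry G′ (π i) (π j))))
  entry : ∀ i j → pencil δ (laplacian G) x (- + 1) i j ≡ pencil δ (laplacian G′) x (- + 1) (π i) (π j)
  entry i j = cong₂ (λ d l → x * d + - + 1 * l) (δ-π i j) (L-π i j)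

-- On natural numbers it is nonnegative and vanishes exactly at 1 and 2, the degrees of the vertices
-- of a path-friendship graph other than the center.
h : ℤ → ℤ
h d = (d - + 1) * (d - + 2)

-- All that is retained of cospectrality. `order≡` serves (s, k) = (0, 0) and (2, 0), where the
-- exact order matters.
record Spectral (s k : ℕ) {n} (H : Graph (suc n)) : Set where
  field
    order≥ : 2 ℕ.* s ℕ.+ k ℕ.≤ n
    order≡ : k ≡ 0 → n ≡ 2 ℕ.* s
    Σd     : sumFin (degree H) ≡ + 2 * (+ n + + s)
    Σh     : sumFin (λ v → h (degree H v)) ≡ h (+ (2 ℕ.* s ℕ.+ k))
    Σh³    : sumFin (λ v → h (degree H v) * (+ (2 ℕ.* s ℕ.+ k) - degree H v)) + closedWalks₃ H ≡ + 6 * + s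
    trees≡ : trees H ≡ + (3 ℕ.^ s)

sum-≥-length : ∀ {ls} → All (1 ℕ.≤_) ls → length ls ℕ.≤ sumℕ ls
sum-≥-length [] = z≤n
sum-≥-length (p ∷ ps) = ℕₚ.+-mono-≤ p (sum-≥-length ps)

module Polynomials {n} (d : Fin n → ℤ) where
  S₁ = sumFin d
  S₂ = sumFin (λ v → d v * d v)
  S₃ = sumFin (λ v → d v * d v * d v)

  Σh-expand : sumFin (λ v → h (d v)) ≡ S₂ + (- + 3 * S₁ + + n * + 2)
  Σh-expand = trans (sum-cong (λ v → lem (d v))) (trans (sum-+ (λ v → d v * d v) (λ v → - + 3 * d v + + 2))
    (cong (_+_ S₂) (trans (sum-+ (λ v → - + 3 * d v) (λ _ → + 2)) (cong₂ _+_ (sum-*ˡ (- + 3) d) (sum-const n (+ 2))))))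
    where
    lem : ∀ d → (d - + 1) * (d - + 2) ≡ d * d + (- + 3 * d + + 2)
    lem = solve-∀

  Σh³-expand : ∀ D → sumFin (λ v → h (d v) * (D - d v)) ≡ - S₃ + ((D + + 3) * S₂ + (- (+ 3 * D + + 2) * S₁ + + n * (+ 2 * D)))
  Σh³-expand D = trans (sum-cong (λ v → lem (d v) D)) (trans (sum-+ (λ v → - (d v * d v * d v)) (λ v → (D + + 3) * (d v * d v) + (- (+ 3 * D + + 2) * d v + + 2 * D)))
    (cong₂ _+_ (sum-neg (λ v → d v * d v * d v)) (trans (sum-+ (λ v → (D + + 3) * (d v * d v)) (λ v → - (+ 3 * D + + 2) * d v + + 2 * D))
      (cong₂ _+_ (sum-*ˡ (D + + 3) (λ v → d v * d v)) (trans (sum-+ (λ v → - (+ 3 * D + + 2) * d v) (λ _ → + 2 * D)) (cong₂ _+_ (sum-*ˡ (- (+ 3 * D + + 2)) d) (sum-const n (+ 2 * D))))))))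
    where
    lem : ∀ d D → (d - + 1) * (d - + 2) * (D - d) ≡ - (d * d * d) + ((D + + 3) * (d * d) + (- (+ 3 * D + + 2) * d + + 2 * D))
    lem = solve-∀

-- `Σh` and `Σh³` are linear combinations of the order, Σ d, Σ d² and Σ d³ - tr A³, so they agree
-- for the model and `H`. On the model they are evaluated by `degrees`: `h` vanishes at 1 and 2, and
-- D - d vanishes at the center.
spectral : ∀ s ls hs (H : Graph (pfOrder s ls)) → Cosp (laplacian (model s ls hs)) (laplacian H) → Spectral s (length ls) H
spectral s ls hs H cosp = record
  { order≥ = ℕₚ.+-monoʳ-≤ (2 ℕ.* s) (sum-≥-length hs)
  ; order≡ = λ e → trans (cong (2 ℕ.* s ℕ.+_) (empty ls e)) (ℕₚ.+-identityʳ (2 ℕ.* s))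
  ; Σd = trans (sym σ₁) (trans (S.degrees id) (lem₁ (+ (2 ℕ.* s)) (+ length ls) (+ S.twos) (+ n) (+ s) (ℤₚ.pos-* 2 s) order))
  ; Σh = trans (PH.Σh-expand) (trans (cong₂ (λ x y → x + (- + 3 * y + + suc n * + 2)) (sym σ₂) (sym σ₁))
      (trans (sym PG.Σh-expand) (trans (S.degrees h) (lem₂ (h D) (+ S.twos) (+ length ls)))))
  ; Σh³ = trans (cong (_+ closedWalks₃ H) (trans (PH.Σh³-expand D) (cong₂ (λ x y → - PH.S₃ + ((D + + 3) * x + (- (+ 3 * D + + 2) * y + + suc n * (+ 2 * D)))) (sym σ₂) (sym σ₁))))
      (trans (lem₃ PG.S₃ PH.S₃ (closedWalks₃ G) (closedWalks₃ H) ((D + + 3) * PG.S₂ + (- (+ 3 * D + + 2) * PG.S₁ + + suc n * (+ 2 * D))) σ₃)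
        (trans (cong₂ _+_ (trans (sym (PG.Σh³-expand D)) (trans (S.degrees (λ d → h d * (D - d))) (lem₄ (h D) D (+ S.twos) (+ length ls)))) (trans S.closed₃ (ℤₚ.pos-* 6 s)))
          (ℤₚ.+-identityˡ (+ 6 * + s))))
  ; trees≡ = trans (sym (cosp-trees {G = G} {H} cosp)) (model-trees s ls hs)
  }
  where
  G = model s ls hs
  n = 2 ℕ.* s ℕ.+ sumℕ ls
  D = + (2 ℕ.* s ℕ.+ length ls)
  module S = Stage (stage-model s ls hs)
  module PG = Polynomials (degree G)
  module PH = Polynomials (degree H)
  σ₁ = cosp-Σd {G = G} {H} cosp
  σ₂ = cosp-Σd² {G = G} {H} cosp
  σ₃ = cosp-Σd³ {G = G} {H} cosp
  empty : ∀ ls → length ls ≡ 0 → sumℕ ls ≡ 0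
  empty [] _ = refl
  order : + n ≡ + S.twos + + length ls
  order = trans (lem (+ n)) (trans (cong (_- + 1) (trans (sym (ℤₚ.*-identityʳ (+ suc n))) (trans (sym (sum-const (suc n) (+ 1))) (S.degrees (λ _ → + 1))))) (lem′ (+ S.twos) (+ length ls)))
    where
    lem : ∀ m → m ≡ + 1 + m - + 1
    lem = solve-∀
    lem′ : ∀ x y → + 1 + (x * + 1 + y * + 1) - + 1 ≡ x + y
    lem′ = solve-∀
  lem₁ : ∀ D l c n s → D ≡ + 2 * s → n ≡ c + l → D + l + (c * + 2 + l * + 1) ≡ + 2 * (n + s)
  lem₁ _ l c _ s refl refl = lem l c s
    where
    lem : ∀ l c s → + 2 * s + l + (c * + 2 + l * + 1) ≡ + 2 * (c + l + s)
    lem = solve-∀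
  lem₂ : ∀ x c o → x + (c * + 0 + o * + 0) ≡ x
  lem₂ = solve-∀
  lem₃ : ∀ g h wg wh p → g - wg ≡ h - wh → - h + p + wh ≡ - g + p + wg
  lem₃ g h wg wh p e = trans (lem h wh p) (trans (cong (λ x → p - x) (sym e)) (sym (lem g wg p)))
    where
    lem : ∀ h w p → - h + p + w ≡ p - (h - w)
    lem = solve-∀
  lem₄ : ∀ x D c o → x * (D - D) + (c * (+ 0 * (D - + 2)) + o * (+ 0 * (D - + 1))) ≡ + 0
  lem₄ = solve-∀

closedWalks₃-nonneg : ∀ {n} (G : Graph n) → + 0 ≤ closedWalks₃ G
closedWalks₃-nonneg G = sum-nonneg (λ i → sum-nonneg (λ j → *-nonneg (sum-nonneg (λ k → *-nonneg (b2ℤ-nonneg (adj G i k)) (b2ℤ-nonneg (adj G k j)))) (b2ℤ-nonneg (adj G j i))))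

closedWalks₃≡0⇒triangleFree : ∀ {n} (G : Graph n) → closedWalks₃ G ≡ + 0 → TriangleFree G
closedWalks₃≡0⇒triangleFree G e x y z xy yz zx = absurd (trans (sym (cong₂ _*_ (A-true G xy) (A-true G yz))) (sum-nonneg-zero pair-nonneg two-step y))
  where
  absurd : + 1 * + 1 ≡ + 0 → ⊥
  absurd ()
  pair-nonneg : ∀ {i j} k → + 0 ≤ A G i k * A G k j
  pair-nonneg {i} {j} k = *-nonneg (b2ℤ-nonneg (adj G i k)) (b2ℤ-nonneg (adj G k j))
  term-nonneg : ∀ i j → + 0 ≤ sumFin (λ k → A G i k * A G k j) * A G j i
  term-nonneg i j = *-nonneg (sum-nonneg pair-nonneg) (b2ℤ-nonneg (adj G j i))
  two-step : sumFin (λ k → A G x k * A G k z) ≡ + 0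
  two-step = trans (sym (trans (cong (sumFin (λ k → A G x k * A G k z) *_) (A-true G zx)) (ℤₚ.*-identityʳ (sumFin (λ k → A G x k * A G k z)))))
    (sum-nonneg-zero (term-nonneg x) (sum-nonneg-zero (λ i → sum-nonneg (term-nonneg i)) e x) z)

h-nonneg : ∀ m → + 0 ≤ h (+ m)
h-nonneg 0 = +≤+ z≤n
h-nonneg 1 = +≤+ z≤n
h-nonneg 2 = +≤+ z≤n
h-nonneg (suc (suc (suc m))) = subst (+ 0 ≤_) (sym (lem (+ m))) (+≤+ z≤n)
  where
  lem : ∀ x → (+ 3 + x - + 1) * (+ 3 + x - + 2) ≡ (+ 2 + x) * (+ 1 + x)
  lem = solve-∀

h≡0⇒12 : ∀ m → h (+ m) ≡ + 0 → m ≡ 1 ⊎ m ≡ 2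
h≡0⇒12 0 ()
h≡0⇒12 1 e = inj₁ refl
h≡0⇒12 2 e = inj₂ refl
h≡0⇒12 (suc (suc (suc m))) e = ⊥-elim (nonneg-absurd 1 (+-nonneg (*-nonneg {+ 3} {+ m} (+≤+ z≤n) (+≤+ z≤n)) (square-nonneg (+ m)))
    (trans (lem (+ m)) (cong (_- + 2) e)))
  where
  lem : ∀ x → + 3 * x + x * x ≡ (+ 3 + x - + 1) * (+ 3 + x - + 2) - + 2
  lem = solve-∀

-- Enumeration of the graphs of order 5

allVec : ∀ n → (Vec Bool n → Bool) → Bool
allVec zero    p = p []
allVec (suc n) p = allVec n (λ v → p (true ∷ v)) ∧ allVec n (λ v → p (false ∷ v))

allVec-sound : ∀ n p → allVec n p ≡ true → ∀ v → p v ≡ true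
allVec-sound zero p e [] = e
allVec-sound (suc n) p e (b ∷ v) = go b
  where
  both : ∀ {x y} → x ∧ y ≡ true → (x ≡ true) × (y ≡ true)
  both {true} {true} _ = refl , refl
  go : ∀ b → p (b ∷ v) ≡ true
  go true = allVec-sound n (λ v → p (true ∷ v)) (proj₁ (both e)) v
  go false = allVec-sound n (λ v → p (false ∷ v)) (proj₂ (both {allVec n (λ v → p (true ∷ v))} e)) v

-- The ten bits are the entries above the diagonal of a symmetric matrix of order 5 with zero
-- diagonal.
table : Vec Bool 10 → Fin 5 → Fin 5 → Bool
table (a ∷ b ∷ c ∷ d ∷ e ∷ f ∷ g ∷ h ∷ i ∷ j ∷ []) x y = lookup (lookup rows x) y
  where
  rows : Vec (Vec Bool 5) 5
  rows = (false ∷ a ∷ b ∷ c ∷ d ∷ []) ∷ (a ∷ false ∷ e ∷ f ∷ g ∷ []) ∷ (b ∷ e ∷ false ∷ h ∷ i ∷ []) ∷ (c ∷ f ∷ h ∷ false ∷ j ∷ []) ∷ (d ∷ g ∷ i ∷ j ∷ false ∷ []) ∷ []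

degreeOf : ∀ {n} → (Fin n → Fin n → Bool) → Fin n → ℤ
degreeOf M i = sumFin (λ j → b2ℤ (M i j))

walksOf : ∀ {n} → (Fin n → Fin n → Bool) → ℤ
walksOf M = trace (((λ i j → b2ℤ (M i j)) ⊗ (λ i j → b2ℤ (M i j))) ⊗ (λ i j → b2ℤ (M i j)))

-- The constraints on a graph of order 5 for s = 2, k = 0, where D = 4: 12 = 2(4 + 2), 6 = h 4, all
-- degrees below D, and 12 = 6 · 2.
Excluded : ∀ {n} → (Fin n → Fin n → Bool) → Set
Excluded M = sumFin (degreeOf M) ≡ + 12 × sumFin (λ v → h (degreeOf M v)) ≡ + 6 × (∀ v → degreeOf M v ≤ + 3) ×
  sumFin (λ v → h (degreeOf M v) * (+ 4 - degreeOf M v)) + walksOf M ≡ + 12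

excluded? : ∀ {n} (M : Fin n → Fin n → Bool) → Dec (Excluded M)
excluded? M = (sumFin (degreeOf M) ℤₚ.≟ + 12) ×-dec ((sumFin (λ v → h (degreeOf M v)) ℤₚ.≟ + 6) ×-dec
  (Finₚ.all? (λ v → degreeOf M v ℤₚ.≤? + 3) ×-dec (sumFin (λ v → h (degreeOf M v) * (+ 4 - degreeOf M v)) + walksOf M ℤₚ.≟ + 12)))

Excluded-cong : ∀ {n} {M M′ : Fin n → Fin n → Bool} → (∀ i j → M i j ≡ M′ i j) → Excluded M → Excluded M′
Excluded-cong {n} {M} {M′} e (p , q , r , s) =
  trans (sum-cong (λ v → sym (deg≡ v))) p , trans (sum-cong (λ v → cong h (sym (deg≡ v)))) q ,
  (λ v → subst (_≤ + 3) (deg≡ v) (r v)) ,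
  trans (cong₂ _+_ (sum-cong (λ v → cong (λ d → h d * (+ 4 - d)) (sym (deg≡ v)))) (sym walks≡)) s
  where
  deg≡ : ∀ v → degreeOf M v ≡ degreeOf M′ v
  deg≡ v = sum-cong (λ j → cong b2ℤ (e v j))
  walks≡ : walksOf M ≡ walksOf M′
  walks≡ = sum-cong (λ i → sum-cong (λ j → cong₂ _*_ (sum-cong (λ k → cong₂ _*_ (cong b2ℤ (e i k)) (cong b2ℤ (e k j)))) (cong b2ℤ (e j i))))

-- The only sequence of five degrees ≤ 3 with these sums is 3, 3, 3, 2, 1; its graph, K₄ minus an edge
-- with a pendant vertex, has one triangle too many.
abstract
  no-table-excluded : allVec 10 (λ v → not ⌊ excluded? (table v) ⌋) ≡ true
  no-table-excluded = refl

refutes : ∀ {P : Set} (p? : Dec P) → not ⌊ p? ⌋ ≡ true → ¬ P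
refutes (yes _) () p
refutes (no np) _ p = np p

excluded₅-sound : ∀ (H : Graph 5) → ¬ Excluded (adj H)
excluded₅-sound H ex = refutes (excluded? (table entries))
    (allVec-sound 10 (λ v → not ⌊ excluded? (table v) ⌋) no-table-excluded entries) (Excluded-cong (λ i j → sym (same i j)) ex)
  where
  i₀ i₁ i₂ i₃ i₄ : Fin 5
  i₀ = zero
  i₁ = suc zero
  i₂ = suc (suc zero)
  i₃ = suc (suc (suc zero))
  i₄ = suc (suc (suc (suc zero)))
  entries : Vec Bool 10
  entries = adj H i₀ i₁ ∷ adj H i₀ i₂ ∷ adj H i₀ i₃ ∷ adj H i₀ i₄ ∷ adj H i₁ i₂ ∷ adj H i₁ i₃ ∷ adj H i₁ i₄ ∷ adj H i₂ i₃ ∷ adj H i₂ i₄ ∷ adj H i₃ i₄ ∷ []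
  same : ∀ i j → table entries i j ≡ adj H i j
  same zero zero = sym (irrefl H _)
  same zero (suc zero) = refl
  same zero (suc (suc zero)) = refl
  same zero (suc (suc (suc zero))) = refl
  same zero (suc (suc (suc (suc zero)))) = refl
  same (suc zero) zero = adj-sym H _ _
  same (suc zero) (suc zero) = sym (irrefl H _)
  same (suc zero) (suc (suc zero)) = refl
  same (suc zero) (suc (suc (suc zero))) = refl
  same (suc zero) (suc (suc (suc (suc zero)))) = refl
  same (suc (suc zero)) zero = adj-sym H _ _
  same (suc (suc zero)) (suc zero) = adj-sym H _ _
  same (suc (suc zero)) (suc (suc zero)) = sym (irrefl H _)
  same (suc (suc zero)) (suc (suc (suc zero))) = refl
  same (suc (suc zero)) (suc (suc (suc (suc zero)))) = refl
  same (suc (suc (suc zero))) zero = adj-sym H _ _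
  same (suc (suc (suc zero))) (suc zero) = adj-sym H _ _
  same (suc (suc (suc zero))) (suc (suc zero)) = adj-sym H _ _
  same (suc (suc (suc zero))) (suc (suc (suc zero))) = sym (irrefl H _)
  same (suc (suc (suc zero))) (suc (suc (suc (suc zero)))) = refl
  same (suc (suc (suc (suc zero)))) zero = adj-sym H _ _
  same (suc (suc (suc (suc zero)))) (suc zero) = adj-sym H _ _
  same (suc (suc (suc (suc zero)))) (suc (suc zero)) = adj-sym H _ _
  same (suc (suc (suc (suc zero)))) (suc (suc (suc zero))) = adj-sym H _ _
  same (suc (suc (suc (suc zero)))) (suc (suc (suc (suc zero)))) = sym (irrefl H _)

module Recognition {s k n} (H : Graph (suc n)) (F : Spectral s k H) where
  open Spectral F

  D = + (2 ℕ.* s ℕ.+ k)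

  connected : Connected H
  connected = trees≢0⇒connected H (λ e → ℕₚ.<⇒≢ (ℕₚ.m^n>0 3 s) (ℤₚ.+-injective (trans (sym e) trees≡)))

  degreeℕ : ∀ v → ∃ λ m → degree H v ≡ + m
  degreeℕ v = ∣ degree H v ∣ , sym (ℤₚ.0≤i⇒+∣i∣≡i (degree-nonneg H v))

  hd-nonneg : ∀ v → + 0 ≤ h (degree H v)
  hd-nonneg v = subst (λ d → + 0 ≤ h d) (sym (proj₂ (degreeℕ v))) (h-nonneg (proj₁ (degreeℕ v)))

  -- The vertex `c` uses up all of Σ h, so every other degree is 1 or 2. Then every term of the
  -- cubic sum vanishes, and tr A³ = 6s remains.
  recognise : (∃ λ c → degree H c ≡ D) → IsPathFriendship s k H
  recognise (c , e) = Structure.path-friendship H connected c deg≤2 s k e walks₃ Σd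
    where
    rest : sumFin (upd (λ v → h (degree H v)) c (+ 0)) ≡ + 0
    rest = +-cancelʳ (sumFin (upd (λ v → h (degree H v)) c (+ 0))) (+ 0) (h D)
      (trans (ℤₚ.+-comm (sumFin (upd (λ v → h (degree H v)) c (+ 0))) (h D))
        (trans (cong (λ d → h d + sumFin (upd (λ v → h (degree H v)) c (+ 0))) (sym e))
          (trans (sym (sum-upd (λ v → h (degree H v)) c)) (trans Σh (sym (ℤₚ.+-identityˡ (h D)))))))
    h0 : ∀ v → c ≢ v → h (degree H v) ≡ + 0
    h0 v ne = trans (sym (upd-other (λ v → h (degree H v)) (+ 0) ne)) (sum-nonneg-zero (upd-nonneg hd-nonneg c) rest v)
    deg≤2 : ∀ v → c ≢ v → degree H v ≤ + 2
    deg≤2 v ne = subst (_≤ + 2) (sym (proj₂ (degreeℕ v))) (go (h≡0⇒12 (proj₁ (degreeℕ v)) (trans (cong h (sym (proj₂ (degreeℕ v)))) (h0 v ne))))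
      where
      go : ∀ {m} → m ≡ 1 ⊎ m ≡ 2 → + m ≤ + 2
      go (inj₁ refl) = +≤+ (s≤s z≤n)
      go (inj₂ refl) = +≤+ (s≤s (s≤s z≤n))
    term : ∀ v → Dec (c ≡ v) → h (degree H v) * (D - degree H v) ≡ + 0
    term v (yes refl) = trans (cong (λ d → h (degree H c) * (D - d)) e) (trans (cong (h (degree H c) *_) (ℤₚ.+-inverseʳ D)) (ℤₚ.*-zeroʳ (h (degree H c))))
    term v (no ne) = trans (cong (_* (D - degree H v)) (h0 v ne)) (ℤₚ.*-zeroˡ (D - degree H v))
    walks₃ : closedWalks₃ H ≡ + (6 ℕ.* s)
    walks₃ = trans (sym (ℤₚ.+-identityˡ (closedWalks₃ H))) (trans (cong (_+ closedWalks₃ H) (sym (sum-zero (λ v → term v (c ≟ v))))) (trans Σh³ (sym (ℤₚ.pos-* 6 s))))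

  degree≢0 : 0 ℕ.< n → ∀ v → degree H v ≢ + 0
  degree≢0 0<n v e = two 0<n all-v
    where
    closed : ∀ i j → ⌊ v ≟ i ⌋ ≡ true → adj H i j ≡ true → ⌊ v ≟ j ⌋ ≡ true
    closed i j p ij with v ≟ i
    ... | yes refl = ⊥-elim (one (trans (sym (A-true H ij)) (sum-nonneg-zero (λ j → b2ℤ-nonneg (adj H v j)) e j)))
      where
      one : + 1 ≡ + 0 → ⊥
      one ()
    self : ⌊ v ≟ v ⌋ ≡ true
    self with v ≟ v
    ... | yes _ = refl
    ... | no ne = ⊥-elim (ne refl)
    all-v : ∀ j → v ≡ j
    all-v j = decided (v ≟ j) (connected (λ i → ⌊ v ≟ i ⌋) closed self j)
      where
      decided : ∀ {P : Set} (p? : Dec P) → ⌊ p? ⌋ ≡ true → P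
      decided (yes p) _ = p
    two : ∀ {n} {v : Fin (suc n)} → 0 ℕ.< n → (∀ j → v ≡ j) → ⊥
    two {suc n} {v} _ all with trans (sym (all zero)) (all (suc zero))
    ... | ()

  one-or-two : sumFin (λ v → h (degree H v)) ≡ + 0 → ∀ v → degree H v ≡ + 1 ⊎ degree H v ≡ + 2
  one-or-two Σ≡0 v = go (h≡0⇒12 (proj₁ (degreeℕ v)) (trans (cong h (sym (proj₂ (degreeℕ v)))) (sum-nonneg-zero hd-nonneg Σ≡0 v)))
    where
    go : proj₁ (degreeℕ v) ≡ 1 ⊎ proj₁ (degreeℕ v) ≡ 2 → degree H v ≡ + 1 ⊎ degree H v ≡ + 2
    go (inj₁ e) = inj₁ (trans (proj₂ (degreeℕ v)) (cong +_ e))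
    go (inj₂ e) = inj₂ (trans (proj₂ (degreeℕ v)) (cong +_ e))

  -- As h 2 = 0, all degrees are 1 or 2, and 2 is excluded. Degrees all equal to 1 give n + 1 = 2(n
  -- + s), impossible for n ≥ 2.
  no-center-of-degree-2 : 2 ℕ.* s ℕ.+ k ≡ 2 → ¬ (∀ v → degree H v ≢ D)
  no-center-of-degree-2 D≡2 none = nonneg-absurd 0 (+-nonneg (diff-nonneg (+≤+ (subst (ℕ._≤ n) D≡2 order≥))) (*-nonneg {+ 2} {+ s} (+≤+ z≤n) (+≤+ z≤n)))
      (lem (+ n) (+ s) (trans (sym (trans (sum-cong all-1) (sum-const (suc n) (+ 1)))) Σd))
    where
    all-1 : ∀ v → degree H v ≡ + 1
    all-1 v = go (one-or-two (trans Σh (cong (λ z → h (+ z)) D≡2)) v)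
      where
      go : degree H v ≡ + 1 ⊎ degree H v ≡ + 2 → degree H v ≡ + 1
      go (inj₁ e) = e
      go (inj₂ e) = ⊥-elim (none v (trans e (cong +_ (sym D≡2))))
    lem : ∀ n s → (+ 1 + n) * + 1 ≡ + 2 * (n + s) → n - + 2 + + 2 * s ≡ -[1+ 0 ]
    lem n s e = trans (lem₁ n s) (trans (cong (λ x → x - n - + 2) (sym e)) (lem₂ n))
      where
      lem₁ : ∀ n s → n - + 2 + + 2 * s ≡ + 2 * (n + s) - n - + 2
      lem₁ = solve-∀
      lem₂ : ∀ n → (+ 1 + n) * + 1 - n - + 2 ≡ -[1+ 0 ]
      lem₂ = solve-∀

  -- If no vertex has degree D, all degrees are below D, and the degree sums then force (D − 1)(D − 2) ≤ 6s.
  module Large {y} (D≡ : 2 ℕ.* s ℕ.+ k ≡ 3 ℕ.+ y) (none : ∀ v → degree H v ≢ D) where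

    -- Beyond D ≥ 3 the values of `h` exceed h D, whereas a single nonnegative term cannot exceed
    -- the sum Σ h = h D.
    below : ∀ v → + 0 ≤ D - + 1 - degree H v
    below v = subst (λ d → + 0 ≤ D - + 1 - d) (sym em) (go (ℕₚ.<-cmp m (3 ℕ.+ y)))
      where
      m = proj₁ (degreeℕ v)
      em = proj₂ (degreeℕ v)
      go : Tri (m ℕ.< 3 ℕ.+ y) (m ≡ 3 ℕ.+ y) (3 ℕ.+ y ℕ.< m) → + 0 ≤ D - + 1 - + m
      go (tri< lt _ _) = subst (+ 0 ≤_) (trans (cong (λ z → + z - + m - + 1) (sym D≡)) (lem D (+ m))) (<⇒1≤diff (+<+ lt))
        where
        lem : ∀ d m → d - m - + 1 ≡ d - + 1 - m
        lem = solve-∀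
      go (tri≈ _ e _) = ⊥-elim (none v (trans em (cong +_ (trans e (sym D≡)))))
      go (tri> _ _ gt) = ⊥-elim (over (proj₁ extra) (proj₂ extra))
        where
        extra = ℕₚ.m≤n⇒∃[o]m+o≡n gt
        lem : ∀ y x → (+ 3 + y - + 1) * (+ 3 + y - + 2) - (+ 4 + y + x - + 1) * (+ 4 + y + x - + 2) + (+ 2 * y + (+ 5 * x + (+ 2 * (x * y) + x * x))) ≡ -[1+ 3 ]
        lem = solve-∀
        over : ∀ x → 4 ℕ.+ y ℕ.+ x ≡ m → ⊥
        over x e = nonneg-absurd 3 (+-nonneg (diff-nonneg (subst₂ _≤_ (cong h (trans em (cong +_ (sym e)))) (trans Σh (cong (λ z → h (+ z)) D≡)) (sum≥1 hd-nonneg v)))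
          (+-nonneg (*-nonneg {+ 2} {+ y} (+≤+ z≤n) (+≤+ z≤n)) (+-nonneg (*-nonneg {+ 5} {+ x} (+≤+ z≤n) (+≤+ z≤n)) (+-nonneg (*-nonneg {+ 2} (+≤+ z≤n) (*-nonneg {+ x} {+ y} (+≤+ z≤n) (+≤+ z≤n))) (square-nonneg (+ x))))))
          (lem (+ y) (+ x))

    -- Every (d - 1)(d - 2)(D - 1 - d) is nonnegative, and these terms add up to the cubic sum minus
    -- Σ h.
    slack : + 0 ≤ + 6 * + s - closedWalks₃ H - h D
    slack = subst (+ 0 ≤_) eq (sum-nonneg (λ v → *-nonneg (hd-nonneg v) (below v)))
      where
      lem : ∀ x D d → x * (D - + 1 - d) ≡ x * (D - d) - x
      lem = solve-∀
      lem₂ : ∀ p w → p ≡ p + w - w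
      lem₂ = solve-∀
      eq : sumFin (λ v → h (degree H v) * (D - + 1 - degree H v)) ≡ + 6 * + s - closedWalks₃ H - h D
      eq = trans (sum-cong (λ v → lem (h (degree H v)) D (degree H v)))
        (trans (sum-minus (λ v → h (degree H v) * (D - degree H v)) (λ v → h (degree H v)))
          (cong₂ _-_ (trans (lem₂ (sumFin (λ v → h (degree H v) * (D - degree H v))) (closedWalks₃ H)) (cong (_- closedWalks₃ H) Σh³)) Σh))

    bound : + 0 ≤ + 6 * + s - h D
    bound = subst (+ 0 ≤_) (lem (+ 6 * + s) (closedWalks₃ H) (h D)) (+-nonneg slack (closedWalks₃-nonneg H))
      where
      lem : ∀ x w z → x - w - z + w ≡ x - z
      lem = solve-∀

    -- In the equality case `slack` leaves no room for a positive tr A³.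
    triangle-free : + 6 * + s ≡ h D → TriangleFree H
    triangle-free e = closedWalks₃≡0⇒triangleFree H (ℤₚ.≤-antisym
      (ℤₚ.0≤i-j⇒j≤i (subst (+ 0 ≤_) (trans (cong (λ x → x - closedWalks₃ H - h D) e) (lem (h D) (closedWalks₃ H))) slack)) (closedWalks₃-nonneg H))
      where
      lem : ∀ z w → z - w - z ≡ + 0 - w
      lem = solve-∀

-- Excluding graphs without a vertex of degree D, by the values of s and k

exceed : ∀ S P R k → + 0 ≤ S - P → + 0 ≤ R → P ≡ S + R + + suc k → ⊥
exceed S P R k b r e = nonneg-absurd {S - P + R} k (+-nonneg b r) (trans (cong (λ P → S - P + R) e) (lem S R (+ suc k)))
  where
  lem : ∀ S R q → S - (S + R + q) + R ≡ - q
  lem = solve-∀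

-- 6s ≥ (D − 1)(D − 2) fails for s = 0 with k ≥ 3, s = 1 with k ≥ 3, s = 2 with k ≥ 2 and s ≥ 3.
h-exceeds₀ : ∀ y → + 0 ≤ y → + 0 ≤ + 6 * + 0 - h (+ 3 + y) → ⊥
h-exceeds₀ y 0≤y b = exceed (+ 6 * + 0) (h (+ 3 + y)) (+ 3 * y + y * y) 1 b (+-nonneg (*-nonneg {+ 3} {y} (+≤+ z≤n) 0≤y) (square-nonneg y)) (lem y)
  where
  lem : ∀ y → (+ 3 + y - + 1) * (+ 3 + y - + 2) ≡ + 6 * + 0 + (+ 3 * y + y * y) + + 2
  lem = solve-∀

h-exceeds₁ : ∀ y → + 0 ≤ y → + 0 ≤ + 6 * + 1 - h (+ 5 + y) → ⊥
h-exceeds₁ y 0≤y b = exceed (+ 6 * + 1) (h (+ 5 + y)) (+ 7 * y + y * y) 5 b (+-nonneg (*-nonneg {+ 7} {y} (+≤+ z≤n) 0≤y) (square-nonneg y)) (lem y)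
  where
  lem : ∀ y → (+ 5 + y - + 1) * (+ 5 + y - + 2) ≡ + 6 * + 1 + (+ 7 * y + y * y) + + 6
  lem = solve-∀

h-exceeds₂ : ∀ y → + 0 ≤ y → + 0 ≤ + 6 * + 2 - h (+ 6 + y) → ⊥
h-exceeds₂ y 0≤y b = exceed (+ 6 * + 2) (h (+ 6 + y)) (+ 9 * y + y * y) 7 b (+-nonneg (*-nonneg {+ 9} {y} (+≤+ z≤n) 0≤y) (square-nonneg y)) (lem y)
  where
  lem : ∀ y → (+ 6 + y - + 1) * (+ 6 + y - + 2) ≡ + 6 * + 2 + (+ 9 * y + y * y) + + 8
  lem = solve-∀

h-exceeds₃ : ∀ x k → + 0 ≤ x → + 0 ≤ k → + 0 ≤ + 6 * (+ 3 + x) - h (+ 2 * (+ 3 + x) + k) → ⊥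
h-exceeds₃ x k 0≤x 0≤k b = exceed (+ 6 * (+ 3 + x)) (h (+ 2 * (+ 3 + x) + k)) R 1 b R≥0 (lem x k)
  where
  R = + 12 * x + (+ 9 * k + (+ 4 * (x * x) + (+ 4 * (x * k) + k * k)))
  R≥0 : + 0 ≤ R
  R≥0 = +-nonneg (*-nonneg {+ 12} {x} (+≤+ z≤n) 0≤x) (+-nonneg (*-nonneg {+ 9} {k} (+≤+ z≤n) 0≤k)
    (+-nonneg (*-nonneg {+ 4} {x * x} (+≤+ z≤n) (square-nonneg x)) (+-nonneg (*-nonneg {+ 4} {x * k} (+≤+ z≤n) (*-nonneg 0≤x 0≤k)) (square-nonneg k))))
  lem : ∀ x k → (+ 2 * (+ 3 + x) + k - + 1) * (+ 2 * (+ 3 + x) + k - + 2) ≡ + 6 * (+ 3 + x) + (+ 12 * x + (+ 9 * k + (+ 4 * (x * x) + (+ 4 * (x * k) + k * k)))) + + 2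
  lem = solve-∀

-- Since h 1 = 0 and degree 1 is excluded, all degrees are 2, but the degree sum is 2n, that of a
-- tree on n + 1 vertices.
exceptional₀₁ : ∀ {n} (H : Graph (suc n)) → Spectral 0 1 H → ¬ (∀ v → degree H v ≢ + 1)
exceptional₀₁ {n} H F none = two (lem (+ n) (trans (sym (trans (sum-cong all-2) (sum-const (suc n) (+ 2)))) (Spectral.Σd F)))
  where
  open Recognition H F
  two : + 2 ≡ + 0 → ⊥
  two ()
  lem : ∀ n → (+ 1 + n) * + 2 ≡ + 2 * (n + + 0) → + 2 ≡ + 0
  lem n e = trans (lem₁ n) (trans (cong (_- + 2 * n) e) (lem₂ n))
    where
    lem₁ : ∀ n → + 2 ≡ (+ 1 + n) * + 2 - + 2 * n
    lem₁ = solve-∀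
    lem₂ : ∀ n → + 2 * (n + + 0) - + 2 * n ≡ + 0
    lem₂ = solve-∀
  all-2 : ∀ v → degree H v ≡ + 2
  all-2 v = go (one-or-two (Spectral.Σh F) v)
    where
    go : degree H v ≡ + 1 ⊎ degree H v ≡ + 2 → degree H v ≡ + 2
    go (inj₁ e) = ⊥-elim (none v e)
    go (inj₂ e) = e

-- Degrees are positive and below 3, so Σ h is 0, whereas it should be h 3 = 2.
exceptional₁₁ : ∀ {n} (H : Graph (suc n)) → Spectral 1 1 H → ¬ (∀ v → degree H v ≢ + 3)
exceptional₁₁ H F none = two (trans (sym (Spectral.Σh F)) (sum-zero flat))
  where
  open Recognition H F
  open Large {0} refl none
  two : + 2 ≡ + 0 → ⊥
  two ()
  too-big : ∀ {d x} → + 0 ≤ x → d ≡ + 3 + x → + 0 ≤ + 3 - + 1 - d → ⊥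
  too-big {x = x} 0≤x refl b = nonneg-absurd 0 (+-nonneg b 0≤x) (lem x)
    where
    lem : ∀ x → + 3 - + 1 - (+ 3 + x) + x ≡ -[1+ 0 ]
    lem = solve-∀
  flat : ∀ v → h (degree H v) ≡ + 0
  flat v = go (proj₁ (degreeℕ v)) (proj₂ (degreeℕ v))
    where
    go : ∀ m → degree H v ≡ + m → h (degree H v) ≡ + 0
    go 0 e = ⊥-elim (degree≢0 (ℕₚ.≤-trans (s≤s z≤n) (Spectral.order≥ F)) v e)
    go 1 e = cong h e
    go 2 e = cong h e
    go (suc (suc (suc x))) e = ⊥-elim (too-big {x = + x} (+≤+ z≤n) e (below v))

-- Equality case h 4 = 6 = 6s: `H` is triangle-free, with as many edges as vertices and 3 spanning
-- trees.
exceptional₁₂ : ∀ {n} (H : Graph (suc n)) → Spectral 1 2 H → ¬ (∀ v → degree H v ≢ + 4)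
exceptional₁₂ {n} H F none = unicyclic-trees≢3 H (Recognition.Large.triangle-free H F {1} refl none refl)
  (trans (Spectral.Σd F) (cong (+ 2 *_) (ℤₚ.+-comm (+ n) (+ 1)))) (Spectral.trees≡ F)

-- Without paths the order is exactly 5, which makes the enumeration applicable.
exceptional₂₀ : ∀ {n} (H : Graph (suc n)) → Spectral 2 0 H → ¬ (∀ v → degree H v ≢ + 4)
exceptional₂₀ {n} H F none = go n H F none (Spectral.order≡ F refl)
  where
  lem : ∀ d → + 4 - + 1 - d ≡ + 3 - d
  lem = solve-∀
  go : ∀ n (H : Graph (suc n)) → Spectral 2 0 H → (∀ v → degree H v ≢ + 4) → n ≡ 4 → ⊥
  go .4 H F none refl = excluded₅-sound H (Spectral.Σd F , Spectral.Σh F ,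
    (λ v → ℤₚ.0≤i-j⇒j≤i (subst (+ 0 ≤_) (lem (degree H v)) (Recognition.Large.below H F {1} refl none v))) , Spectral.Σh³ F)

-- Equality case h 5 = 12 = 6s: `H` is triangle-free, with one edge more than vertices and 9
-- spanning trees.
exceptional₂₁ : ∀ {n} (H : Graph (suc n)) → Spectral 2 1 H → ¬ (∀ v → degree H v ≢ + 5)
exceptional₂₁ {n} H F none = bicyclic-trees≢9 H (Recognition.Large.triangle-free H F {2} refl none refl)
  (trans (Spectral.Σd F) (lem (+ n))) (Spectral.trees≡ F)
  where
  lem : ∀ n → + 2 * (n + + 2) ≡ + 2 * (+ 1 + n) + + 2
  lem = solve-∀

-- `S` and `D` are passed up to equality, so that the bound can be restated in the integer
-- expressions of `h-exceeds₀` to `h-exceeds₃`.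
exceeds : ∀ s k {n} (H : Graph (suc n)) → Spectral s k H → (∀ v → degree H v ≢ + (2 ℕ.* s ℕ.+ k)) →
  ∀ {y S D} → 2 ℕ.* s ℕ.+ k ≡ 3 ℕ.+ y → + s ≡ S → + (2 ℕ.* s ℕ.+ k) ≡ D → (+ 0 ≤ + 6 * S - h D → ⊥) → ⊥
exceeds s k H F none D≡ refl refl absurd = absurd (Recognition.Large.bound H F D≡ none)

exceptional₀₂ : ∀ {n} (H : Graph (suc n)) → Spectral 0 2 H → ¬ (∀ v → degree H v ≢ + 2)
exceptional₀₂ H F none = Recognition.no-center-of-degree-2 H F refl none

exceptional₁₀ : ∀ {n} (H : Graph (suc n)) → Spectral 1 0 H → ¬ (∀ v → degree H v ≢ + 2)
exceptional₁₀ H F none = Recognition.no-center-of-degree-2 H F refl none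

exceptional₀₊ : ∀ y {n} (H : Graph (suc n)) → Spectral 0 (3 ℕ.+ y) H → ¬ (∀ v → degree H v ≢ + (3 ℕ.+ y))
exceptional₀₊ y H F none = exceeds 0 (3 ℕ.+ y) H F none refl refl refl (h-exceeds₀ (+ y) (+≤+ z≤n))

exceptional₁₊ : ∀ y {n} (H : Graph (suc n)) → Spectral 1 (3 ℕ.+ y) H → ¬ (∀ v → degree H v ≢ + (5 ℕ.+ y))
exceptional₁₊ y H F none = exceeds 1 (3 ℕ.+ y) H F none refl refl refl (h-exceeds₁ (+ y) (+≤+ z≤n))

exceptional₂₊ : ∀ y {n} (H : Graph (suc n)) → Spectral 2 (2 ℕ.+ y) H → ¬ (∀ v → degree H v ≢ + (6 ℕ.+ y))
exceptional₂₊ y H F none = exceeds 2 (2 ℕ.+ y) H F none refl refl refl (h-exceeds₂ (+ y) (+≤+ z≤n))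

exceptional₊ : ∀ x k {n} (H : Graph (suc n)) → Spectral (3 ℕ.+ x) k H → ¬ (∀ v → degree H v ≢ + (2 ℕ.* (3 ℕ.+ x) ℕ.+ k))
exceptional₊ x k H F none = exceeds (3 ℕ.+ x) k H F none {S = + 3 + + x} {D = + 2 * (+ 3 + + x) + + k} refl refl (cong (_+ + k) (ℤₚ.pos-* 2 (3 ℕ.+ x)))
  (h-exceeds₃ (+ x) (+ k) (+≤+ z≤n) (+≤+ z≤n))

exceptional₀₀ : ∀ {n} (H : Graph (suc n)) → Spectral 0 0 H → ¬ (∀ v → degree H v ≢ + 0)
exceptional₀₀ {n} H F none = go n H none (Spectral.order≡ F refl)
  where
  go : ∀ n (H : Graph (suc n)) → (∀ v → degree H v ≢ + 0) → n ≡ 0 → ⊥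
  go .0 H none refl = none zero (cong (_+ + 0) (A-irrefl H zero))

exceptional : ∀ s k {n} (H : Graph (suc n)) → Spectral s k H → ¬ (∀ v → degree H v ≢ + (2 ℕ.* s ℕ.+ k))
exceptional 0 0 H F = exceptional₀₀ H F
exceptional 0 1 H F = exceptional₀₁ H F
exceptional 0 2 H F = exceptional₀₂ H F
exceptional 0 (suc (suc (suc y))) H F = exceptional₀₊ y H F
exceptional 1 0 H F = exceptional₁₀ H F
exceptional 1 1 H F = exceptional₁₁ H F
exceptional 1 2 H F = exceptional₁₂ H F
exceptional 1 (suc (suc (suc y))) H F = exceptional₁₊ y H F
exceptional 2 0 H F = exceptional₂₀ H F
exceptional 2 1 H F = exceptional₂₁ H F
exceptional 2 (suc (suc y)) H F = exceptional₂₊ y H F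
exceptional (suc (suc (suc x))) k H F = exceptional₊ x k H F

spectral-recognition : ∀ s k {n} (H : Graph (suc n)) → Spectral s k H → IsPathFriendship s k H
spectral-recognition s k H F = go (Finₚ.any? (λ c → degree H c ℤₚ.≟ + (2 ℕ.* s ℕ.+ k)))
  where
  go : Dec (∃ λ c → degree H c ≡ + (2 ℕ.* s ℕ.+ k)) → IsPathFriendship s k H
  go (yes found) = Recognition.recognise H F found
  go (no none) = ⊥-elim (exceptional s k H F (λ v e → none (v , e)))

theorem3p9 : (s k : ℕ) {n m : ℕ} (G : Graph n) (H : Graph m) →
    IsPathFriendship s k G → LCospectral G H → IsPathFriendship s k H
theorem3p9 s k G H (ls , refl , hs , f , iso) (refl , same) with ↔⇒≡ f
-- Finite types in bijection have equal size, so `G` and the model share their vertex type and the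
-- bijection becomes a relabelling.
... | refl = spectral-recognition s (length ls) H (spectral s ls hs H (charPoly-cosp (model s ls hs) H
  (λ x → trans (sym (isomorphic-cosp {G = G} {model s ls hs} f iso x)) (same x))))
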